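{- Let $n\ge 1$ and $w\in\mathfrak{S}_n$, and let $w^r=w_n\dots w_1$ denote the reverse of $w=w_1\dots w_n$. Then $Q(w)=Q(w^r)$ if and only if $Q(w)$ satisfies both of the following properties: (i) $Q(w)$ has a symmetric hook shape; (ii) for every $i\in[n]$ with $i>1$, if $i$ lies in the first row of $Q(w)$, then $n-i+2$ lies in the first column of $Q(w)$. In particular, $$|\{w\in\mathfrak{S}_n : Q(w)=Q(w^r)\}| = \begin{cases} 2^{\frac{n-1}{2}}\binom{n-1}{\frac{n-1}{2}} & n \text{ odd},\\ 0 & n\text{ even}.\end{cases}$$
   Context: Permutations are written in one-line notation $w=w_1\dots w_n$. $Q(w)$ denotes the recording tableau of $w$ under the Robinson–Schensted(–Knuth) correspondence using Schensted row insertion: $P(w)$ is obtained by successively row-inserting $w_1,\dots,w_n$ into the empty tableau, and $Q(w)$ is the standard Young tableau of the same shape whose cell containing $k$ is the cell created at the $k$-th insertion. A shape is symmetric if it equals its transpose; a hook shape is one of the form $(k,1^{n-k})$. Thus a symmetric hook shape of size $n$ is $((n+1)/2,1^{(n-1)/2})$ with $n$ odd (for $n=1$ this is a single box). -}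

module Defs where

open import Data.Nat using (ℕ; zero; suc; _+_; _*_; _∸_; _^_; _≤_; _<ᵇ_; _<?_)
open import Data.Nat.Combinatorics using (_C_)
open import Data.Bool using (true; false)
open import Data.Fin using (Fin; toℕ)
open import Data.Vec using (Vec; lookup; toList)
open import Data.List using (List; []; _∷_; [_]; _++_; map; length; filter; upTo; replicate; concatMap; take)
open import Data.List.Membership.Propositional using (_∈_)
open import Data.List.Relation.Unary.Unique.Propositional using (Unique)
open import Data.Maybe using (Maybe; just; nothing)
open import Data.Product using (Σ; _×_; _,_; proj₂; ∃)
open import Function.Bundles using (_⇔_)
open import Relation.Binary.PropositionalEquality using (_≡_)

-- A permutation in one-line notation w = w₁ … wₙ, values in Fin n
-- (i.e. the letters 0,…,n-1 play the role of 1,…,n; only their order matters for RSK).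
IsPerm : {n : ℕ} → Vec (Fin n) n → Set
IsPerm {n} w = ∀ (i j : Fin n) → lookup w i ≡ lookup w j → i ≡ j

-- Tableaux as lists of rows (top row first).
Tableau : Set
Tableau = List (List ℕ)

rowIns : ℕ → List ℕ → List ℕ × Maybe ℕ
rowIns x [] = [ x ] , nothing
rowIns x (y ∷ ys) with x <ᵇ y
... | true  = (x ∷ ys) , just y
... | false with rowIns x ys
...   | r , b = (y ∷ r) , b

insertP : ℕ → Tableau → Tableau × ℕ
insertP x [] = [ [ x ] ] , 0
insertP x (row ∷ rows) with rowIns x row
... | r , nothing = (r ∷ rows) , 0
... | r , just y with insertP y rows
...   | t , i = (r ∷ t) , suc i

addAt : ℕ → ℕ → Tableau → Tableau
addAt k zero [] = [ [ k ] ]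
addAt k zero (r ∷ rs) = (r ++ [ k ]) ∷ rs
addAt k (suc i) [] = [ [ k ] ]
addAt k (suc i) (r ∷ rs) = r ∷ addAt k i rs

rsAux : ℕ → List ℕ → Tableau → Tableau → Tableau × Tableau
rsAux k [] P Q = P , Q
rsAux k (x ∷ xs) P Q with insertP x P
... | P' , i = rsAux (suc k) xs P' (addAt k i Q)

Qtab : {n : ℕ} → Vec (Fin n) n → Tableau
Qtab w = proj₂ (rsAux 1 (map toℕ (toList w)) [] [])

shape : Tableau → List ℕ
shape = map length

conj : List ℕ → List ℕ
conj [] = []
conj (l ∷ ls) = map (λ j → length (filter (j <?_) (l ∷ ls))) (upTo l)

Symmetric : List ℕ → Set
Symmetric λ' = conj λ' ≡ λ'

IsHook : ℕ → List ℕ → Set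
IsHook n λ' = Σ ℕ (λ k → 1 ≤ k × k ≤ n × λ' ≡ k ∷ replicate (n ∸ k) 1)

SymmetricHook : ℕ → List ℕ → Set
SymmetricHook n λ' = IsHook n λ' × Symmetric λ'

firstRow : Tableau → List ℕ
firstRow [] = []
firstRow (r ∷ _) = r

firstCol : Tableau → List ℕ
firstCol = concatMap (take 1)

CondII : ℕ → Tableau → Set
CondII n T = ∀ (i : ℕ) → 2 ≤ i → i ≤ n → i ∈ firstRow T → (n ∸ i + 2) ∈ firstCol T

HasCard : (n : ℕ) → (Vec (Fin n) n → Set) → ℕ → Set
HasCard n P N = Σ (List (Vec (Fin n) n)) λ l →
  Unique l × (∀ w → (w ∈ l ⇔ (IsPerm w × P w))) × length l ≡ N

{-# OPTIONS --safe #-}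
-- Insert a word u into a tableau and let ρ list the rows of the new cells.  Then ρ determines the
-- largest sizes of one and of two disjoint decreasing subsequences of u: moving a (suitably padded)
-- row of the tableau across the word is a sequence of Knuth moves, and these preserve such sizes.
-- So if Q(w) = Q(w^r), then in every centred segment N of w one (two) decreasing subsequences can
-- cover as many letters as one (two) increasing ones.  By induction on N its insertion tableau has
-- a rows and a columns with 2a = |N| + 1, and therefore is a symmetric hook: the only alternative
-- is |N| = 2a + 1, when the first two rows or the first two columns have at least a + 3 cells, and
-- then two increasing and two decreasing subsequences of size a + 3 would share more than the
-- possible four letters.  Conversely, w has hook shape if and only if its longest increasing and
-- decreasing subsequences have n + 1 letters in total, which is invariant under reversal, and a
-- hook-shaped Q(w) is given by the descents of w, which reversal reverses and complements.  The
-- words with a given hook Q are counted by inverse insertion.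
module Submission where

open import Defs
open import Data.Bool using (Bool; true; false; not)
import Data.Bool as Bool
open import Data.Bool.Properties using (not-involutive)
open import Data.Empty using (⊥-elim)
open import Data.Fin using (Fin; zero; suc; toℕ; fromℕ<)
open import Data.Fin.Properties using (toℕ<n; toℕ-injective; toℕ-fromℕ<)
open import Data.List as List using (List; []; _∷_; [_]; _++_; _∷ʳ_; _ʳ++_; length; map; replicate; filter; applyUpTo; concatMap; take; drop; cartesianProduct; tabulate; initLast; _∷ʳ′_)
open import Data.List.Membership.Propositional using (_∈_)
open import Data.List.Membership.Propositional.Properties using (∈-++⁻; ∈-++⁺ˡ; ∈-++⁺ʳ; ∈-map⁺; ∈-map⁻; ∈-cartesianProduct⁺; ∈-cartesianProduct⁻)
open import Data.List.Properties
open import Data.List.Relation.Binary.Permutation.Propositional as Perm using (_↭_; ↭-sym)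
open import Data.List.Relation.Binary.Permutation.Propositional.Properties using (All-resp-↭; ↭-reverse; shift; ↭-length)
import Data.List.Relation.Binary.Permutation.Propositional.Properties as Permₚ
open import Data.List.Relation.Unary.All as All using (All; []; _∷_)
import Data.List.Relation.Unary.All.Properties as Allₚ
open import Data.List.Relation.Unary.AllPairs as AllPairs using (AllPairs; []; _∷_)
import Data.List.Relation.Unary.AllPairs.Properties as AllPairsₚ
open import Data.List.Relation.Unary.Any using (here; there)
open import Data.List.Relation.Unary.Unique.Propositional using (Unique)
import Data.List.Relation.Unary.Unique.Propositional.Properties as Uniqueₚ
open import Data.Maybe as Maybe using (Maybe; just; nothing)
open import Data.Nat using (ℕ; zero; suc; _+_; _∸_; _*_; _^_; _⊓_; _⊔_; _≤_; _<_; _<ᵇ_; _<?_; _≟_; z≤n; s≤s; s≤s⁻¹)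
open import Data.Nat.Properties
open import Data.Nat.Solver using (module +-*-Solver)
open import Data.Product using (∃; _×_; _,_; proj₁; proj₂)
open import Data.Sum using (_⊎_; inj₁; inj₂)
open import Data.Unit using (tt)
open import Data.Vec using (Vec; []; _∷_; lookup; toList; reverse)
open import Data.Vec.Properties using (toList-reverse)
open import Function.Bundles using (_⇔_; mk⇔; Equivalence)
open import Function.Construct.Composition using (_⇔-∘_)
open import Relation.Binary.PropositionalEquality using (_≡_; _≢_; refl; sym; trans; cong; cong₂; subst; subst₂)
open import Relation.Nullary using (yes; no; ¬_)

-- Knuth equivalence and pairs of chains

-- The obstacle is that a centred segment of `w` is not inserted into the empty tableau: it meets
-- the tableau of the letters before it, in general not the one that its reverse meets. Equal
-- entries of ρ must therefore suffice to compare chains whatever the two starting tableaux are;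
-- this is `Run-D`. Only decreasing chains are carried over in this way; increasing ones appear as
-- decreasing chains of the reverse. A row crosses a word by Knuth moves only while every insertion
-- bumps a letter, so a letter that would be appended needs something to bump: this is the padding.
-- It repeats letters, whence the weak inequalities in the Knuth relations. One chain of each kind
-- gives only 2a ≤ |N| + 1; pairs of chains are there to exclude |N| = 2a + 1. The four common
-- letters come from the four pairs of an increasing and a decreasing chain. In the count for n = 2m
-- + 1, the bits of Q form an anti-palindrome with a free first half (2^m choices), and P has corner
-- 0 and a leg of m letters chosen from the other 2m.

module Chains {Bnd : Set} (_◂_ : Bnd → ℕ → Set) (last : ℕ → Bnd) where

  -- A choice of letters of a word, their number in the last index, split into two chains whose
  -- next letters must be admitted by the two bounds.
  data Pick : Bnd → Bnd → List ℕ → ℕ → Set where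
    done  : ∀ {a b} → Pick a b [] 0
    skip  : ∀ {a b x w s} → Pick a b w s → Pick a b (x ∷ w) s
    left  : ∀ {a b x w s} → a ◂ x → Pick (last x) b w s → Pick a b (x ∷ w) (suc s)
    right : ∀ {a b x w s} → b ◂ x → Pick a (last x) w s → Pick a b (x ∷ w) (suc s)

  Pick-swap : ∀ {a b w s} → Pick a b w s → Pick b a w s
  Pick-swap done        = done
  Pick-swap (skip p)    = skip (Pick-swap p)
  Pick-swap (left h p)  = right h (Pick-swap p)
  Pick-swap (right h p) = left h (Pick-swap p)

  Pick-monoˡ : ∀ {a a' b w s} → All (λ x → a ◂ x → a' ◂ x) w → Pick a b w s → Pick a' b w s
  Pick-monoˡ _        done        = done
  Pick-monoˡ (_ ∷ fs) (skip p)    = skip (Pick-monoˡ fs p)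
  Pick-monoˡ (f ∷ _)  (left h p)  = left (f h) p
  Pick-monoˡ (_ ∷ fs) (right h p) = right h (Pick-monoˡ fs p)

  Pick-monoʳ : ∀ {a b b' w s} → All (λ x → b ◂ x → b' ◂ x) w → Pick a b w s → Pick a b' w s
  Pick-monoʳ fs p = Pick-swap (Pick-monoˡ fs (Pick-swap p))

  Pick-++ : ∀ v {a b w s} → Pick a b w s → Pick a b (v ++ w) s
  Pick-++ []      p = p
  Pick-++ (_ ∷ v) p = skip (Pick-++ v p)

  private
    SameChain : Bnd → Bnd → ℕ → ℕ → List ℕ → ℕ → Set
    SameChain a b p q w s = last p ◂ q × ∃ λ t → s ≡ suc (suc t) ×
      ((a ◂ p × Pick (last q) b w t) ⊎ (b ◂ p × Pick a (last q) w t))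

  -- A choice survives the swap unless one chain takes both letters. In that case the bounds and the
  -- tail are recorded, to be repaired with a third letter.
  transpose : ∀ {a b p q w s} → Pick a b (p ∷ q ∷ w) s →
              Pick a b (q ∷ p ∷ w) s ⊎ SameChain a b p q w s
  transpose (skip (skip r))      = inj₁ (skip (skip r))
  transpose (skip (left h r))    = inj₁ (left h (skip r))
  transpose (skip (right h r))   = inj₁ (right h (skip r))
  transpose (left h (skip r))    = inj₁ (skip (left h r))
  transpose (left h (left k r))  = inj₂ (k , _ , refl , inj₁ (h , r))
  transpose (left h (right k r)) = inj₁ (right k (left h r))
  transpose (right h (skip r))   = inj₁ (skip (right h r))
  transpose (right h (left k r)) = inj₁ (left k (right h r))
  transpose (right h (right k r)) = inj₂ (k , _ , refl , inj₂ (h , r))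

  transpose-unordered : ∀ {a b p q w s} → ¬ (last p ◂ q) →
                        Pick a b (p ∷ q ∷ w) s → Pick a b (q ∷ p ∷ w) s
  transpose-unordered ¬pq r with transpose r
  ... | inj₁ r'       = r'
  ... | inj₂ (pq , _) = ⊥-elim (¬pq pq)

  -- If p and q lie in one chain, then y either replaces p, or its own chain and that of
  -- p, q exchange their tails.
  transpose-afterʸ : ∀ {y p q} → (∀ b → b ◂ p → b ◂ y) → last y ◂ q →
    (∀ t → last y ◂ t → last p ◂ t) → ¬ (last y ◂ p) →
    ∀ {a b w s} → Pick a b (y ∷ p ∷ q ∷ w) s → Pick a b (y ∷ q ∷ p ∷ w) s
  transpose-afterʸ {y} {p} {q} to-y yq y⇒p ¬yp = go
    where
    goˡ : ∀ {a b w s} → a ◂ y → Pick (last y) b (p ∷ q ∷ w) s → Pick a b (y ∷ q ∷ p ∷ w) (suc s)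
    goˡ ay r with transpose r
    ... | inj₁ r' = left ay r'
    ... | inj₂ (_ , _ , refl , inj₁ (yp , _)) = ⊥-elim (¬yp yp)
    ... | inj₂ (_ , _ , refl , inj₂ (bp , r')) =
      left ay (left yq (right bp (Pick-monoʳ (All.universal y⇒p _) (Pick-swap r'))))
    go : ∀ {a b w s} → Pick a b (y ∷ p ∷ q ∷ w) s → Pick a b (y ∷ q ∷ p ∷ w) s
    go (skip r) with transpose r
    ... | inj₁ r' = skip r'
    ... | inj₂ (_ , _ , refl , inj₁ (ap , r')) = left (to-y _ ap) (left yq (skip r'))
    ... | inj₂ (_ , _ , refl , inj₂ (bp , r')) = right (to-y _ bp) (right yq (skip r'))
    go (left h r)  = goˡ h r
    go (right h r) = Pick-swap (goˡ h (Pick-swap r))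

  -- If `y` is not chosen, it replaces `q`. If the other chain takes `y`, then `q` moves to that
  -- chain and `y` follows `p`, and the two tails change sides.
  transpose-beforeʸ : ∀ {y p q} → last p ◂ y → (∀ t → last q ◂ t → last y ◂ t) →
    (∀ b → b ◂ y → b ◂ q) → ¬ (last q ◂ y) →
    ∀ {a b w s} → Pick a b (p ∷ q ∷ y ∷ w) s → Pick a b (q ∷ p ∷ y ∷ w) s
  transpose-beforeʸ {y} {p} {q} py q⇒y to-q ¬qy = go
    where
    goˡ : ∀ {a b w t} → a ◂ p → Pick (last q) b (y ∷ w) t → Pick a b (q ∷ p ∷ y ∷ w) (suc (suc t))
    goˡ ap (skip r)     = skip (left ap (left py (Pick-monoˡ (All.universal q⇒y _) r)))
    goˡ ap (left qy _)  = ⊥-elim (¬qy qy)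
    goˡ ap (right by r) = right (to-q _ by) (left ap (left py (Pick-swap r)))
    go : ∀ {a b w s} → Pick a b (p ∷ q ∷ y ∷ w) s → Pick a b (q ∷ p ∷ y ∷ w) s
    go r with transpose r
    ... | inj₁ r' = r'
    ... | inj₂ (_ , _ , refl , inj₁ (ap , r')) = goˡ ap r'
    ... | inj₂ (_ , _ , refl , inj₂ (bp , r')) = Pick-swap (goˡ bp (Pick-swap r'))

-- Strictly decreasing chains; the bound 0 disables a chain.
module D = Chains (λ b x → x < b) (λ x → x)

data _admits_ : Maybe ℕ → ℕ → Set where
  bound : ∀ {a x} → a ≤ x → just a admits x

-- Weakly and strictly increasing chains; the bound nothing disables a chain.
module W = Chains _admits_ just
module I = Chains _admits_ (λ x → just (suc x))

-- Knuth equivalence and the invariance of pairs of chains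

infix 4 _≋_
data _≋_ : List ℕ → List ℕ → Set where
  ≋-refl  : ∀ {u} → u ≋ u
  ≋-sym   : ∀ {u v} → u ≋ v → v ≋ u
  ≋-trans : ∀ {u v w} → u ≋ v → v ≋ w → u ≋ w
  ≋-cons  : ∀ x {u v} → u ≋ v → x ∷ u ≋ x ∷ v
  knuth₁  : ∀ {x y z w} → x < y → y ≤ z → y ∷ x ∷ z ∷ w ≋ y ∷ z ∷ x ∷ w
  knuth₂  : ∀ {x y z w} → x ≤ y → y < z → x ∷ z ∷ y ∷ w ≋ z ∷ x ∷ y ∷ w

≋-reflexive : ∀ {u v} → u ≡ v → u ≋ v
≋-reflexive refl = ≋-refl

≋-++ˡ : ∀ p {u v} → u ≋ v → p ++ u ≋ p ++ v
≋-++ˡ []      h = h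
≋-++ˡ (x ∷ p) h = ≋-cons x (≋-++ˡ p h)

_⊑D_ _⊑W_ : List ℕ → List ℕ → Set
u ⊑D v = ∀ {a b s} → D.Pick a b u s → D.Pick a b v s
u ⊑W v = ∀ {a b s} → W.Pick a b u s → W.Pick a b v s

cons-D : ∀ {x u v} → u ⊑D v → (x ∷ u) ⊑D (x ∷ v)
cons-D f (D.skip r)    = D.skip (f r)
cons-D f (D.left h r)  = D.left h (f r)
cons-D f (D.right h r) = D.right h (f r)

cons-W : ∀ {x u v} → u ⊑W v → (x ∷ u) ⊑W (x ∷ v)
cons-W f (W.skip r)    = W.skip (f r)
cons-W f (W.left h r)  = W.left h (f r)
cons-W f (W.right h r) = W.right h (f r)

-- In each relation the two exchanged letters can follow each other in a chain in only one of their
-- orders. From that order the third letter `y` repairs the choice; from the other nothing is lost.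
≋⇒D : ∀ {u v} → u ≋ v → (u ⊑D v) × (v ⊑D u)
≋⇒D ≋-refl        = (λ r → r) , (λ r → r)
≋⇒D (≋-sym h)     = proj₂ (≋⇒D h) , proj₁ (≋⇒D h)
≋⇒D (≋-trans h k) = (λ r → proj₁ (≋⇒D k) (proj₁ (≋⇒D h) r)) , (λ r → proj₂ (≋⇒D h) (proj₂ (≋⇒D k) r))
≋⇒D (≋-cons x h)  = cons-D (proj₁ (≋⇒D h)) , cons-D (proj₂ (≋⇒D h))
≋⇒D (knuth₁ x<y y≤z) =
  cons-D (D.transpose-unordered (≤⇒≯ (≤-trans (<⇒≤ x<y) y≤z))) ,
  D.transpose-afterʸ (λ _ → ≤-<-trans y≤z) x<y (λ _ t<y → <-≤-trans t<y y≤z) (≤⇒≯ y≤z)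
≋⇒D (knuth₂ x≤y y<z) =
  D.transpose-unordered (≤⇒≯ (≤-trans x≤y (<⇒≤ y<z))) ,
  D.transpose-beforeʸ y<z (λ _ t<x → <-≤-trans t<x x≤y) (λ _ → ≤-<-trans x≤y) (≤⇒≯ x≤y)

≋⇒W : ∀ {u v} → u ≋ v → (u ⊑W v) × (v ⊑W u)
≋⇒W ≋-refl        = (λ r → r) , (λ r → r)
≋⇒W (≋-sym h)     = proj₂ (≋⇒W h) , proj₁ (≋⇒W h)
≋⇒W (≋-trans h k) = (λ r → proj₁ (≋⇒W k) (proj₁ (≋⇒W h) r)) , (λ r → proj₂ (≋⇒W h) (proj₂ (≋⇒W k) r))
≋⇒W (≋-cons x h)  = cons-W (proj₁ (≋⇒W h)) , cons-W (proj₂ (≋⇒W h))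
≋⇒W (knuth₁ x<y y≤z) =
  W.transpose-afterʸ (λ { _ (bound h) → bound (≤-trans h (<⇒≤ x<y)) }) (bound y≤z)
    (λ { _ (bound h) → bound (≤-trans (<⇒≤ x<y) h) }) (λ { (bound h) → <⇒≱ x<y h }) ,
  cons-W (W.transpose-unordered λ { (bound h) → <⇒≱ (<-≤-trans x<y y≤z) h })
≋⇒W (knuth₂ x≤y y<z) =
  W.transpose-beforeʸ (bound x≤y) (λ { _ (bound h) → bound (≤-trans (<⇒≤ y<z) h) })
    (λ { _ (bound h) → bound (≤-trans h (<⇒≤ y<z)) }) (λ { (bound h) → <⇒≱ y<z h }) ,
  W.transpose-unordered λ { (bound h) → <⇒≱ (≤-<-trans x≤y y<z) h }

-- Row insertion

Sorted : List ℕ → Set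
Sorted = AllPairs _≤_

data RowIns (x : ℕ) : List ℕ → List ℕ → Maybe ℕ → Set where
  end   : RowIns x [] [ x ] nothing
  here  : ∀ {y r} → x < y → RowIns x (y ∷ r) (x ∷ r) (just y)
  there : ∀ {y r r' b} → y ≤ x → RowIns x r r' b → RowIns x (y ∷ r) (y ∷ r') b

data Ins (x : ℕ) : Tableau → Tableau → ℕ → Set where
  new  : Ins x [] [ [ x ] ] 0
  stop : ∀ {r r' T} → RowIns x r r' nothing → Ins x (r ∷ T) (r' ∷ T) 0
  bump : ∀ {r r' y T T' i} → RowIns x r r' (just y) → Ins y T T' i → Ins x (r ∷ T) (r' ∷ T') (suc i)

-- The start is arbitrary because a segment of a word is inserted into the tableau left by the
-- letters before it.
data Run : Tableau → List ℕ → List ℕ → Tableau → Set where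
  []  : ∀ {T} → Run T [] [] T
  _∷_ : ∀ {x u i ρ T T' T''} → Ins x T T' i → Run T' u ρ T'' → Run T (x ∷ u) (i ∷ ρ) T''

rowIns-RowIns : ∀ x r → RowIns x r (proj₁ (rowIns x r)) (proj₂ (rowIns x r))
rowIns-RowIns x [] = end
rowIns-RowIns x (y ∷ r) with x <ᵇ y in eq
... | true  = here (<ᵇ⇒< x y (subst Bool.T (sym eq) tt))
... | false = there (≮⇒≥ λ x<y → subst Bool.T eq (<⇒<ᵇ x<y)) (rowIns-RowIns x r)

insertP-Ins : ∀ x T → Ins x T (proj₁ (insertP x T)) (proj₂ (insertP x T))
insertP-Ins x [] = new
insertP-Ins x (r ∷ T) with rowIns x r | rowIns-RowIns x r
... | r' , nothing | h = stop h
... | r' , just y  | h = bump h (insertP-Ins y T)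

RowIns-functional : ∀ {x r r₁ r₂ b₁ b₂} → RowIns x r r₁ b₁ → RowIns x r r₂ b₂ → r₁ ≡ r₂ × b₁ ≡ b₂
RowIns-functional end end = refl , refl
RowIns-functional (here _) (here _) = refl , refl
RowIns-functional (here h) (there k _) with () ← <⇒≱ h k
RowIns-functional (there k _) (here h) with () ← <⇒≱ h k
RowIns-functional (there _ p) (there _ q) with refl , refl ← RowIns-functional p q = refl , refl

Ins-functional : ∀ {x T T₁ T₂ i₁ i₂} → Ins x T T₁ i₁ → Ins x T T₂ i₂ → T₁ ≡ T₂ × i₁ ≡ i₂
Ins-functional new new = refl , refl
Ins-functional (stop p) (stop q) with refl , refl ← RowIns-functional p q = refl , refl
Ins-functional (stop p) (bump q _) with _ , () ← RowIns-functional p q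
Ins-functional (bump p _) (stop q) with _ , () ← RowIns-functional p q
Ins-functional (bump p P) (bump q Q) with refl , refl ← RowIns-functional p q
  with refl , refl ← Ins-functional P Q = refl , refl

Run-functional : ∀ {T u ρ₁ ρ₂ T₁ T₂} → Run T u ρ₁ T₁ → Run T u ρ₂ T₂ → ρ₁ ≡ ρ₂ × T₁ ≡ T₂
Run-functional [] [] = refl , refl
Run-functional (p ∷ P) (q ∷ Q) with refl , refl ← Ins-functional p q
  with refl , refl ← Run-functional P Q = refl , refl

run : ∀ T u → ∃ λ ρ → ∃ λ T' → Run T u ρ T'
run T [] = [] , T , []
run T (x ∷ u) with ρ , T' , R ← run (proj₁ (insertP x T)) u = _ , T' , (insertP-Ins x T ∷ R)

Run-++ : ∀ {T T' T'' u v ρ σ} → Run T u ρ T' → Run T' v σ T'' → Run T (u ++ v) (ρ ++ σ) T''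
Run-++ []      S = S
Run-++ (p ∷ R) S = p ∷ Run-++ R S

Run-split : ∀ {T} u {v ρ T''} → Run T (u ++ v) ρ T'' →
            ∃ λ σ → ∃ λ τ → ∃ λ T' → ρ ≡ σ ++ τ × Run T u σ T' × Run T' v τ T''
Run-split []      R       = [] , _ , _ , refl , [] , R
Run-split (x ∷ u) (p ∷ R) with σ , τ , T' , refl , A , B ← Run-split u R = _ , τ , T' , refl , p ∷ A , B

Run-length : ∀ {T u ρ T'} → Run T u ρ T' → length u ≡ length ρ
Run-length []      = refl
Run-length (_ ∷ R) = cong suc (Run-length R)

RowIns-All : ∀ {P : ℕ → Set} {x r r' b} → RowIns x r r' b → P x → All P r → All P r'
RowIns-All end         px []         = px ∷ []
RowIns-All (here _)    px (_ ∷ ps)   = px ∷ ps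
RowIns-All (there _ R) px (p ∷ ps)   = p ∷ RowIns-All R px ps

RowIns-bumped : ∀ {P : ℕ → Set} {x r r' y} → RowIns x r r' (just y) → All P r → P y
RowIns-bumped (here _)    (p ∷ _)  = p
RowIns-bumped (there _ R) (_ ∷ ps) = RowIns-bumped R ps

RowIns-< : ∀ {x r r' y} → RowIns x r r' (just y) → x < y
RowIns-< (here h)    = h
RowIns-< (there _ R) = RowIns-< R

RowIns-sorted : ∀ {x r r' b} → RowIns x r r' b → Sorted r → Sorted r'
RowIns-sorted end         []       = [] ∷ []
RowIns-sorted (here h)    (p ∷ s)  = All.map (≤-trans (<⇒≤ h)) p ∷ s
RowIns-sorted (there k R) (p ∷ s)  = RowIns-All R k p ∷ RowIns-sorted R s

RowIns-end : ∀ {x r r'} → RowIns x r r' nothing → r' ≡ r ++ [ x ]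
RowIns-end end         = refl
RowIns-end (there _ R) = cong (_ ∷_) (RowIns-end R)

≋-carry-left : ∀ {x y} s r → x < y → Sorted (y ∷ r) → y ∷ r ++ x ∷ s ≋ y ∷ x ∷ r ++ s
≋-carry-left s []      x<y _ = ≋-refl
≋-carry-left {x} {y} s (z ∷ r) x<y ((y≤z ∷ _) ∷ zr) =
  ≋-trans (≋-cons y (≋-carry-left s r (<-≤-trans x<y y≤z) zr)) (≋-sym (knuth₁ x<y y≤z))

-- The inserted letter moves left past the larger letters by `knuth₁` up to the place of `y`; then
-- `y` moves to the front past the smaller ones by `knuth₂`.
≋-RowIns : ∀ {x r r' y} s → Sorted r → RowIns x r r' (just y) → r ++ x ∷ s ≋ y ∷ r' ++ s
≋-RowIns {r = r@(_ ∷ r₁)} s sr (here h) = ≋-carry-left s r₁ h sr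
≋-RowIns {x} {r = z ∷ r} {y = y} s (z≤ ∷ sr) (there z≤x R) =
  ≋-trans (≋-cons z (≋-RowIns s sr R)) (front R z≤)
  where
  front : ∀ {r r'} → RowIns x r r' (just y) → All (z ≤_) r → z ∷ y ∷ r' ++ s ≋ y ∷ z ∷ r' ++ s
  front (here h) _ = knuth₂ z≤x h
  front (there k R) (z≤t ∷ _) = knuth₂ z≤t (≤-<-trans k (RowIns-< R))

SortedRows : Tableau → Set
SortedRows = All Sorted

Ins-SortedRows : ∀ {x T T' i} → Ins x T T' i → SortedRows T → SortedRows T'
Ins-SortedRows new        []       = ([] ∷ []) ∷ []
Ins-SortedRows (stop R)   (s ∷ ss) = RowIns-sorted R s ∷ ss
Ins-SortedRows (bump R I) (s ∷ ss) = RowIns-sorted R s ∷ Ins-SortedRows I ss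

Run-SortedRows : ∀ {T u ρ T'} → Run T u ρ T' → SortedRows T → SortedRows T'
Run-SortedRows []      s = s
Run-SortedRows (p ∷ R) s = Run-SortedRows R (Ins-SortedRows p s)

reading : Tableau → List ℕ
reading []      = []
reading (r ∷ T) = reading T ++ r

≋-Ins : ∀ {x T T' i} → SortedRows T → Ins x T T' i → ∀ s → reading T ++ x ∷ s ≋ reading T' ++ s
≋-Ins _ new s = ≋-refl
≋-Ins {x} {T = r ∷ T} _ (stop R) s rewrite RowIns-end R =
  ≋-reflexive (trans (++-assoc (reading T) r (x ∷ s))
    (trans (cong (reading T ++_) (sym (++-assoc r [ x ] s)))
      (sym (++-assoc (reading T) (r ++ [ x ]) s))))
≋-Ins {x} {T = r ∷ T} (sr ∷ sT) (bump {r' = r'} {T' = T'} R I) s =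
  ≋-trans (≋-reflexive (++-assoc (reading T) r (x ∷ s)))
    (≋-trans (≋-++ˡ (reading T) (≋-RowIns s sr R))
      (≋-trans (≋-Ins sT I (r' ++ s))
        (≋-reflexive (sym (++-assoc (reading T') r' s)))))

≋-Run : ∀ {T u ρ T'} → SortedRows T → Run T u ρ T' → reading T ++ u ≋ reading T'
≋-Run {T} _ []      = ≋-reflexive (++-identityʳ (reading T))
≋-Run sT (_∷_ {u = u} p R) = ≋-trans (≋-Ins sT p u) (≋-Run (Ins-SortedRows p sT) R)

-- Decreasing chains and recording tableaux

live : ℕ → ℕ
live zero    = 0
live (suc _) = 1

private
  usable : ℕ → List ℕ → ℕ
  usable b []      = 0
  usable b (x ∷ r) with x <? b
  ... | yes _ = 1
  ... | no  _ = 0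

  usable-< : ∀ {b x} r → x < b → usable b (x ∷ r) ≡ 1
  usable-< {b} {x} r h with x <? b
  ... | yes _ = refl
  ... | no k  = ⊥-elim (k h)

  usable-≤ : ∀ {x} r → All (x ≤_) r → usable x r ≡ 0
  usable-≤ [] [] = refl
  usable-≤ {x} (y ∷ r) (h ∷ _) with y <? x
  ... | yes k = ⊥-elim (<⇒≱ k h)
  ... | no _  = refl

  usable-cons : ∀ b x r → All (x ≤_) r → usable b r ≤ usable b (x ∷ r)
  usable-cons b x [] _ = z≤n
  usable-cons b x (y ∷ r) (h ∷ _) with y <? b | x <? b
  ... | no _  | _     = z≤n
  ... | yes _ | yes _ = ≤-refl
  ... | yes p | no q  = ⊥-elim (q (≤-<-trans h p))

  usable-live : ∀ b r → usable b r ≤ live b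
  usable-live b [] = z≤n
  usable-live b (x ∷ r) with x <? b
  usable-live (suc b) (x ∷ r) | yes _ = ≤-refl
  ... | no _ = z≤n

  -- `usable` asks whether the least letter of the row is below the bound. Unlike `live` it carries
  -- the induction: once a chain has taken `x`, nothing left in the row is below its bound.
  row-cost : ∀ {a b s u} r → Sorted r → D.Pick a b (r ++ u) s →
             ∃ λ t → D.Pick a b u t × s ≤ t + (usable a r + usable b r)
  row-cost {s = s} [] _ p = s , p , m≤m+n s 0
  row-cost {a} {b} (x ∷ r) (x≤ ∷ sr) (D.skip p) with t , q , h ← row-cost r sr p =
    t , q , ≤-trans h (+-monoʳ-≤ t (+-mono-≤ (usable-cons a x r x≤) (usable-cons b x r x≤)))
  row-cost {a} {b} (x ∷ r) (x≤ ∷ sr) (D.left x<a p) with t , q , h ← row-cost r sr p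
    rewrite usable-≤ r x≤ | usable-< {a} r x<a =
    t , D.Pick-monoˡ (All.universal (λ _ k → <-trans k x<a) _) q ,
    ≤-trans (s≤s h) (≤-trans (≤-reflexive (sym (+-suc t _)))
      (+-monoʳ-≤ t (s≤s (usable-cons b x r x≤))))
  row-cost {a} {b} (x ∷ r) (x≤ ∷ sr) (D.right x<b p) with t , q , h ← row-cost r sr p
    rewrite usable-≤ r x≤ | usable-< {b} r x<b =
    t , D.Pick-monoʳ (All.universal (λ _ k → <-trans k x<b) _) q ,
    ≤-trans (s≤s h) (≤-trans (≤-reflexive (sym (+-suc t _))) (+-monoʳ-≤ t
      (≤-trans (≤-reflexive (cong suc (+-identityʳ _)))
        (≤-trans (s≤s (usable-cons a x r x≤)) (≤-reflexive (+-comm 1 _))))))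

-- A weakly increasing row meets every decreasing chain at most once.
Pick-row : ∀ {a b s u} r → Sorted r → D.Pick a b (r ++ u) s →
           ∃ λ t → D.Pick a b u t × s ≤ t + (live a + live b)
Pick-row {a} {b} r sr p with t , q , h ← row-cost r sr p =
  t , q , ≤-trans h (+-monoʳ-≤ t (+-mono-≤ (usable-live a r) (usable-live b r)))

live-mono : ∀ {a b} → a ≤ b → live a ≤ live b
live-mono {zero}  _       = z≤n
live-mono {suc a} (s≤s _) = ≤-refl

Pick-++-row : ∀ {a b s} u {r} → Sorted r → D.Pick a b (u ++ r) s →
              ∃ λ t → D.Pick a b u t × s ≤ t + (live a + live b)
Pick-++-row {a} {b} {s} [] {r} sr p
  with t , q , h ← Pick-row r sr (subst (λ w → D.Pick a b w s) (sym (++-identityʳ r)) p)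
  with D.done ← q = 0 , D.done , h
Pick-++-row (x ∷ u) sr (D.skip p) with t , q , h ← Pick-++-row u sr p = t , D.skip q , h
Pick-++-row {b = b} (x ∷ u) sr (D.left k p) with t , q , h ← Pick-++-row u sr p =
  suc t , D.left k q , s≤s (≤-trans h (+-monoʳ-≤ t (+-monoˡ-≤ (live b) (live-mono (<⇒≤ k)))))
Pick-++-row {a = a} (x ∷ u) sr (D.right k p) with t , q , h ← Pick-++-row u sr p =
  suc t , D.right k q , s≤s (≤-trans h (+-monoʳ-≤ t (+-monoʳ-≤ (live a) (live-mono (<⇒≤ k)))))

Pick-above : ∀ {C h b u s} → All (_< h) u → h < C → D.Pick C b u s → D.Pick C b (h ∷ u) (1 + s)
Pick-above u<h h<C p = D.left h<C (D.Pick-monoˡ (All.map (λ x<h _ → x<h) u<h) p)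

-- One or two decreasing chains with bound C: the second bound is 0 or C.
data Width : ℕ → ℕ → ℕ → Set where
  one : ∀ {C} → Width C 0 1
  two : ∀ {C} → Width C C 2

-- Two copies of `h` are supplied because two disjoint chains must each be able to start with one;
-- lying above `u`, they cost no later letter.
Pick-highs : ∀ {C b k h u s} → Width C b k → All (_< h) u → h < C → D.Pick C b u s →
             D.Pick C b (h ∷ h ∷ u) (k + s)
Pick-highs one u<h h<C p = D.skip (Pick-above u<h h<C p)
Pick-highs two u<h h<C p =
  D.left h<C (D.right h<C (D.Pick-monoʳ (All.map (λ x<h _ → x<h) u<h)
    (D.Pick-monoˡ (All.map (λ x<h _ → x<h) u<h) p)))

Pick-none : ∀ r {a b} → D.Pick a b r 0
Pick-none []      = D.done
Pick-none (_ ∷ r) = D.skip (Pick-none r)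

Pick-lows : ∀ {a b u s} r → 0 < a → All (0 <_) u → D.Pick a b u s →
            D.Pick a b (u ++ 0 ∷ 0 ∷ r) (s + (1 + live b))
Pick-lows {b = zero}  r 0<a _ D.done = D.left 0<a (D.skip (Pick-none r))
Pick-lows {b = suc b} r 0<a _ D.done = D.left 0<a (D.right (s≤s z≤n) (Pick-none r))
Pick-lows r 0<a (_ ∷ ps) (D.skip p)    = D.skip (Pick-lows r 0<a ps p)
Pick-lows r 0<a (q ∷ ps) (D.left h p)  = D.left h (Pick-lows r q ps p)
Pick-lows {b = suc b} r 0<a (s≤s _ ∷ ps) (D.right h p) = D.right h (Pick-lows r 0<a ps p)

width-live : ∀ {C b k} → 0 < C → Width C b k → live C + live b ≡ k
width-live {suc C} _ one = refl
width-live {suc C} _ two = refl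

-- Letters ≥ B mark the letters that stayed in earlier rows, letters < B still move.  A letter
-- appended to the row becomes B, after the earlier marks are raised by one.
data Pass (B : ℕ) : List ℕ → List ℕ → List ℕ → Set where
  []     : ∀ {r} → Pass B r [] []
  mark   : ∀ {h r u u'} → B ≤ h → Pass B r u u' → Pass B r (h ∷ u) (suc h ∷ u')
  bumps  : ∀ {x y r r' u u'} → x < B → RowIns x r r' (just y) → Pass B r' u u' →
           Pass B r (x ∷ u) (y ∷ u')
  stays  : ∀ {x r r' u u'} → x < B → RowIns x r r' nothing → Pass B r' u u' →
           Pass B r (x ∷ u) (B ∷ u')

-- The list holds the multiplicities of `b`, `b + 1`, and so on, so that an insertion moves one unit
-- between neighbouring entries.
blocks : ℕ → List ℕ → List ℕ
blocks b []       = []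
blocks b (c ∷ cs) = replicate c b ++ blocks (suc b) cs

blocks-≥ : ∀ b cs → All (b ≤_) (blocks b cs)
blocks-≥ b []       = []
blocks-≥ b (c ∷ cs) = Allₚ.++⁺ (Allₚ.replicate⁺ c ≤-refl) (All.map <⇒≤ (blocks-≥ (suc b) cs))

blocks-sorted : ∀ b cs → Sorted (blocks b cs)
blocks-sorted b []       = []
blocks-sorted b (zero ∷ cs)  = blocks-sorted (suc b) cs
blocks-sorted b (suc c ∷ cs) = blocks-≥ b (c ∷ cs) ∷ blocks-sorted b (c ∷ cs)

RowIns-++ : ∀ {x r r' y} t → RowIns x r r' (just y) → RowIns x (r ++ t) (r' ++ t) (just y)
RowIns-++ t (here h)    = here h
RowIns-++ t (there k R) = there k (RowIns-++ t R)

RowIns-skip : ∀ {x t t' b} r → All (_≤ x) r → RowIns x t t' b → RowIns x (r ++ t) (r ++ t') b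
RowIns-skip []      _        R = R
RowIns-skip (_ ∷ r) (k ∷ ks) R = there k (RowIns-skip r ks R)

RowIns-end-≤ : ∀ {x r r'} → RowIns x r r' nothing → All (_≤ x) r
RowIns-end-≤ end         = []
RowIns-end-≤ (there k R) = k ∷ RowIns-end-≤ R

-- The letter `b + i` takes the place of the first copy of its successor, which explains why a mark
-- is raised by one. The lower bound on the multiplicities drops by at most one, so multiplicities
-- as large as the length of the word never run out.
blocks-insert : ∀ b cs {m} i → suc i < length cs → All (suc m ≤_) cs →
  ∃ λ cs' → length cs' ≡ length cs × All (m ≤_) cs' ×
  RowIns (b + i) (blocks b cs) (blocks b cs') (just (b + suc i))
blocks-insert b (c ∷ zero ∷ cs) zero _ (_ ∷ () ∷ _)
blocks-insert b (c ∷ suc c' ∷ cs) {m} zero _ (p ∷ s≤s p' ∷ ps)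
  rewrite +-identityʳ b | +-comm b 1 =
  suc c ∷ c' ∷ cs , refl , ≤-trans (n≤1+n m) (m≤n⇒m≤1+n p) ∷ p' ∷ All.map (≤-trans (n≤1+n m)) ps ,
  subst (λ r → RowIns b (replicate c b ++ suc b ∷ blocks (suc b) (c' ∷ cs)) r (just (suc b))) (rotate c)
    (RowIns-skip (replicate c b) (Allₚ.replicate⁺ c ≤-refl) (here ≤-refl))
  where
  rotate : ∀ c {t} → replicate c b ++ b ∷ t ≡ b ∷ replicate c b ++ t
  rotate zero    = refl
  rotate (suc c) = cong (b ∷_) (rotate c)
blocks-insert b (c ∷ cs) {m} (suc i) (s≤s i<) (p ∷ ps)
  with cs' , l , ms , R ← blocks-insert (suc b) cs i i< ps =
  c ∷ cs' , cong suc l , ≤-trans (n≤1+n m) p ∷ ms ,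
  RowIns-skip (replicate c b) (Allₚ.replicate⁺ c (m≤m+n b (suc i)))
    (subst₂ (λ x y → RowIns x (blocks (suc b) cs) (blocks (suc b) cs') (just y))
      (sym (+-suc b i)) (sym (+-suc b (suc i))) R)

-- The copies of the marks make every insertion bump a letter; the largest mark before the word and
-- the zeros after it extend every decreasing chain of the word by one letter.
padded : ℕ → List ℕ → List ℕ → List ℕ
padded B r cs = 0 ∷ 0 ∷ r ++ blocks B cs

padded-sorted : ∀ {B r} cs → Sorted r → All (_< B) r → Sorted (padded B r cs)
padded-sorted {B} {r} cs sr r<B =
  All.universal (λ _ → z≤n) _ ∷ All.universal (λ _ → z≤n) _ ∷
  AllPairsₚ.++⁺ sr (blocks-sorted B cs)
    (All.map (λ x<B → All.map (≤-trans (<⇒≤ x<B)) (blocks-≥ B cs)) r<B)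

≋-step : ∀ {x r r' y u} u' {t} → Sorted r → RowIns x r r' (just y) →
         r' ++ u ≋ u' ++ t → r ++ x ∷ u ≋ y ∷ u' ++ t
≋-step {y = y} {u = u} _ sr R h = ≋-trans (≋-RowIns u sr R) (≋-cons y h)

-- Each step of `Pass` is a bumping insertion into the padded row, so the whole row crosses the
-- word. The hypotheses on `cs` keep a copy of the successor available for every mark and of `B` for
-- every appended letter.
≋-Pass : ∀ {B r u u'} → Sorted r → All (_< B) r → Pass B r u u' →
  ∀ cs → All (length u ≤_) cs → All (λ x → suc (suc x) ≤ B + length cs) u → 0 < length cs →
  ∃ λ t → Sorted (0 ∷ 0 ∷ t) × padded B r cs ++ u ≋ u' ++ 0 ∷ 0 ∷ t
≋-Pass {B} {r} sr r<B [] cs _ _ _ =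
  r ++ blocks B cs , padded-sorted cs sr r<B , ≋-reflexive (++-identityʳ (padded B r cs))
≋-Pass {B} {r} sr r<B (mark {h = h} {u = u} {u' = u'} B≤h P) cs len (h< ∷ u<) 0<
  with i , refl ← m≤n⇒∃[o]m+o≡n B≤h
  with cs' , l , ms , R ← blocks-insert B cs i
        (+-cancelˡ-< B _ _ (≤-trans (≤-reflexive (cong suc (+-suc B i))) h<)) len
  with t , st , e ← ≋-Pass sr r<B P cs' ms
        (All.map (λ k → ≤-trans k (≤-reflexive (cong (B +_) (sym l)))) u<)
        (≤-trans 0< (≤-reflexive (sym l))) =
  t , st , subst (λ z → padded B r cs ++ B + i ∷ u ≋ z ∷ u' ++ 0 ∷ 0 ∷ t) (+-suc B i)
    (≋-step u' (padded-sorted cs sr r<B)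
      (there z≤n (there z≤n (RowIns-skip r (All.map (λ k → ≤-trans (<⇒≤ k) (m≤m+n B i)) r<B) R))) e)
≋-Pass {B} {r} sr r<B (bumps {u' = u'} x<B R P) cs len (_ ∷ u<) 0<
  with t , st , e ← ≋-Pass (RowIns-sorted R sr) (RowIns-All R x<B r<B) P cs
                      (All.map (≤-trans (n≤1+n _)) len) u< 0< =
  t , st , ≋-step u' (padded-sorted cs sr r<B) (there z≤n (there z≤n (RowIns-++ (blocks B cs) R))) e
-- The letter replaces the first copy of `B`; seen from `r` alone it is appended, and one copy of
-- `B` fewer remains.
≋-Pass {B} {r} sr r<B (stays {x} {u' = u'} x<B R P) (suc c ∷ cs) (s≤s k ∷ ks) (_ ∷ u<) 0<
  with t , st , e ← ≋-Pass (RowIns-sorted R sr) (RowIns-All R x<B r<B) P (c ∷ cs)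
                      (k ∷ All.map (≤-trans (n≤1+n _)) ks) u< 0< =
  t , st , ≋-step u' (padded-sorted (suc c ∷ cs) sr r<B) (there z≤n (there z≤n
     (subst (λ z → RowIns x (r ++ blocks B (suc c ∷ cs)) z (just B))
       (trans (sym (++-assoc r [ x ] _)) (cong (_++ blocks B (c ∷ cs)) (sym (RowIns-end R))))
       (RowIns-skip r (RowIns-end-≤ R) (here x<B))))) e

blocks-top : ∀ B m K → ∃ λ v → blocks B (replicate (suc K) (suc (suc m))) ≡ v ++ B + K ∷ B + K ∷ []
blocks-top B m zero rewrite +-identityʳ B | ++-identityʳ (replicate m B) = replicate m B , move m
  where
  move : ∀ m → B ∷ B ∷ replicate m B ≡ replicate m B ++ B ∷ B ∷ []
  move zero    = refl
  move (suc m) = cong (B ∷_) (move m)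
blocks-top B m (suc K) with v , e ← blocks-top (suc B) m K rewrite +-suc B K =
  replicate (suc (suc m)) B ++ v ,
  trans (cong (replicate (suc (suc m)) B ++_) e) (sym (++-assoc (replicate (suc (suc m)) B) v _))

Pass-positive : ∀ {B r u u'} → 0 < B → All (0 <_) r → All (0 <_) u → Pass B r u u' → All (0 <_) u'
Pass-positive _ _ _ [] = []
Pass-positive 0<B pr (_ ∷ pu)  (mark _ P)    = s≤s z≤n ∷ Pass-positive 0<B pr pu P
Pass-positive 0<B pr (px ∷ pu) (bumps _ R P) = RowIns-bumped R pr ∷ Pass-positive 0<B (RowIns-All R px pr) pu P
Pass-positive 0<B pr (px ∷ pu) (stays _ R P) = 0<B ∷ Pass-positive 0<B (RowIns-All R px pr) pu P

module _ {B : ℕ} {r u u' : List ℕ} {C b k K : ℕ} (sr : Sorted r) (r<B : All (_< B) r) (P : Pass B r u u')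
         (u< : All (_< B + K) u) (K<C : B + K < C) (wd : Width C b k) where

  private
    -- The marks `B` to `B + K` lie above all letters of `u`. Multiplicity `length u` suffices for
    -- the insertions, and two copies of the largest mark must exist for `Pick-highs`.
    cs : List ℕ
    cs = replicate (suc K) (suc (suc (length u)))

    0<C : 0 < C
    0<C = ≤-<-trans z≤n K<C

    exchange = ≋-Pass sr r<B P cs
      (Allₚ.replicate⁺ (suc K) (≤-trans (n≤1+n _) (n≤1+n _)))
      (All.map (λ {x} x< → ≤-trans (s≤s x<) (≤-reflexive
        (trans (sym (+-suc B K)) (cong (λ l → B + suc l) (sym (length-replicate K)))))) u<)
      (s≤s z≤n)

    cost : live C + live b ≡ k
    cost = width-live 0<C wd

  -- The `k` chains gain `k` top marks in front of `u` and lose at most `k` letters to the sorted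
  -- row that ends up behind `u'`.
  Pass-D⇒ : ∀ {s} → D.Pick C b u s → ∃ λ t → D.Pick C b u' t × s ≤ t
  Pass-D⇒ {s} p with t , st , e ← exchange | v , top ← blocks-top B (length u) K
    with t' , q , h ← Pick-++-row u' st (proj₁ (≋⇒D e) (subst (λ w → D.Pick C b w (k + s))
           (sym (trans (cong (λ w → 0 ∷ 0 ∷ (r ++ w) ++ u) top)
             (cong (λ w → 0 ∷ 0 ∷ w) (trans (++-assoc r (v ++ B + K ∷ B + K ∷ []) u)
               (cong (r ++_) (++-assoc v _ u))))))
           (D.skip (D.skip (D.Pick-++ r (D.Pick-++ v (Pick-highs wd u< K<C p))))))) =
    t' , q , +-cancelˡ-≤ k s t' (≤-trans h (≤-reflexive (trans (cong (t' +_) cost) (+-comm t' k))))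

  -- Conversely each active chain of `u'` gains a zero behind it and loses at most one letter to the
  -- padded row in front of `u`. This needs all letters of `u'` to be positive.
  Pass-D⇐ : ∀ {s} → 0 < B → All (0 <_) r → All (0 <_) u → D.Pick C b u' s → ∃ λ t → D.Pick C b u t × s ≤ t
  Pass-D⇐ {s} 0<B pr pu p with t , st , e ← exchange
    with t' , q , h ← Pick-row (padded B r cs) (padded-sorted cs sr r<B)
           (proj₂ (≋⇒D e) (Pick-lows t 0<C (Pass-positive 0<B pr pu P) p)) =
    t' , q , +-cancelʳ-≤ (1 + live b) s t'
      (≤-trans h (≤-reflexive (cong (λ l → t' + (l + live b)) (live-pos 0<C))))
    where
    live-pos : ∀ {C} → 0 < C → live C ≡ 1
    live-pos (s≤s _) = refl

data Passes (B : ℕ) : Tableau → List ℕ → List ℕ → Set where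
  []  : ∀ {u} → Passes B [] u u
  _∷_ : ∀ {r T u u' u''} → Pass B r u u' → Passes B T u' u'' → Passes B (r ∷ T) u u''

Passes-nil : ∀ {B} T → Passes B T [] []
Passes-nil []      = []
Passes-nil (r ∷ T) = [] ∷ Passes-nil T

Passes-mark : ∀ {B T u u' h} → B ≤ h → Passes B T u u' → Passes B T (h ∷ u) (length T + h ∷ u')
Passes-mark B≤h [] = []
Passes-mark {B} {r ∷ T} {h = h} B≤h (_∷_ {u' = v} {u'' = w} P Ps) = mark B≤h P ∷
  subst (λ z → Passes B T (suc h ∷ v) (z ∷ w)) (+-suc (length T) h) (Passes-mark (m≤n⇒m≤1+n B≤h) Ps)

-- The final mark of a letter whose insertion into M rows ends in row i.
code : ℕ → ℕ → ℕ → ℕ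
code B M i = B + (M ∸ suc i)

pad : Tableau → ℕ → Tableau
pad T m = T ++ replicate m []

Passes-stop : ∀ {B x r r' T u u'} → x < B → RowIns x r r' nothing → Passes B (r' ∷ T) u u' →
              Passes B (r ∷ T) (x ∷ u) (B + length T ∷ u')
Passes-stop {B} {T = T} x<B R (_∷_ {u' = v} {u'' = w} P Ps) = stays x<B R P ∷
  subst (λ z → Passes B T (B ∷ v) (z ∷ w)) (+-comm (length T) B) (Passes-mark ≤-refl Ps)

-- Insertion into a tableau padded by empty rows, which replace the creation of a new row.
data Put (x : ℕ) : Tableau → Tableau → ℕ → Set where
  stop : ∀ {r r' T} → RowIns x r r' nothing → Put x (r ∷ T) (r' ∷ T) 0
  bump : ∀ {r r' y T T' i} → RowIns x r r' (just y) → Put y T T' i → Put x (r ∷ T) (r' ∷ T') (suc i)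

Ins-Put : ∀ {x T T' i m} → Ins x T T' i → ∃ λ m' → m ≤ m' × Put x (pad T (suc m)) (pad T' m') i
Ins-Put {m = m} new        = m , ≤-refl , stop end
Ins-Put {m = m} (stop R)   = suc m , n≤1+n m , stop R
Ins-Put (bump R I) with m' , h , P ← Ins-Put I = m' , h , bump R P

Put-length : ∀ {x T T' i} → Put x T T' i → length T ≡ length T'
Put-length (stop _)   = refl
Put-length (bump _ P) = cong suc (Put-length P)

Passes-Put : ∀ {B x T T' i u u'} → x < B → All (All (_< B)) T → Put x T T' i → Passes B T' u u' →
             Passes B T (x ∷ u) (code B (length T) i ∷ u')
Passes-Put x<B _ (stop R) Ps = Passes-stop x<B R Ps
Passes-Put x<B (r<B ∷ T<B) (bump R P) (Q ∷ Qs) =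
  bumps x<B R Q ∷ Passes-Put (RowIns-bumped R r<B) T<B P Qs

Put-All : ∀ {P : ℕ → Set} {x T T' i} → P x → All (All P) T → Put x T T' i → All (All P) T'
Put-All px (pr ∷ pT) (stop R)   = RowIns-All R px pr ∷ pT
Put-All px (pr ∷ pT) (bump R I) = RowIns-All R px pr ∷ Put-All (RowIns-bumped R pr) pT I

Passes-Run : ∀ {B T u ρ T' m} → All (_< B) u → All (All (_< B)) (pad T m) → length u ≤ m → Run T u ρ T' →
             Passes B (pad T m) u (map (code B (length (pad T m))) ρ)
Passes-Run {T = T} {m = m} _ _ _ [] = Passes-nil (pad T m)
Passes-Run {B} {T} {x ∷ u} {i ∷ ρ} {m = suc m} (x<B ∷ u<B) T<B (s≤s l) (_∷_ {T' = T'} p R)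
  with m' , h , P ← Ins-Put {m = m} p =
  Passes-Put x<B T<B P (subst (λ n → Passes B (pad T' m') u (map (code B n) ρ)) (sym (Put-length P))
    (Passes-Run u<B (Put-All x<B T<B P) (≤-trans l h) R))

Pass-< : ∀ {B r u u' N} → B < N → All (_< B) r → All (_< N) u → Pass B r u u' → All (_< suc N) u'
Pass-< _ _ _ [] = []
Pass-< B<N rB (h< ∷ uN) (mark _ P) = s≤s h< ∷ Pass-< B<N rB uN P
Pass-< B<N rB (_ ∷ uN) (bumps x<B R P) =
  <-trans (RowIns-bumped R rB) (m<n⇒m<1+n B<N) ∷ Pass-< B<N (RowIns-All R x<B rB) uN P
Pass-< B<N rB (_ ∷ uN) (stays x<B R P) = m<n⇒m<1+n B<N ∷ Pass-< B<N (RowIns-All R x<B rB) uN P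

module _ {B C b k : ℕ} (wd : Width C b k) where

  Passes-D⇒ : ∀ {T u u' s} K → SortedRows T → All (All (_< B)) T → Passes B T u u' → All (_< B + suc K) u →
    B + (suc K + length T) < C → D.Pick C b u s → ∃ λ t → D.Pick C b u' t × s ≤ t
  Passes-D⇒ K _ _ [] _ _ p = _ , p , ≤-refl
  Passes-D⇒ {T = r ∷ T} K (sr ∷ sT) (rB ∷ TB) (P ∷ Ps) u< K<C p
    with t , q , h ← Pass-D⇒ sr rB P u< (≤-<-trans (+-monoʳ-≤ B (m≤m+n (suc K) _)) K<C) wd p
    with t' , q' , h' ← Passes-D⇒ (suc K) sT TB Ps
           (All.map (λ l → ≤-trans l (≤-reflexive (sym (+-suc B (suc K)))))
             (Pass-< (m<m+n B (s≤s z≤n)) rB u< P))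
           (≤-<-trans (≤-reflexive (cong (B +_) (sym (+-suc (suc K) (length T))))) K<C) q =
    t' , q' , ≤-trans h h'

  Passes-D⇐ : ∀ {T u u' s} K → SortedRows T → All (All (_< B)) T → Passes B T u u' → All (_< B + suc K) u →
    B + (suc K + length T) < C → 0 < B → All (All (0 <_)) T → All (0 <_) u →
    D.Pick C b u' s → ∃ λ t → D.Pick C b u t × s ≤ t
  Passes-D⇐ K _ _ [] _ _ _ _ _ p = _ , p , ≤-refl
  Passes-D⇐ {T = r ∷ T} K (sr ∷ sT) (rB ∷ TB) (P ∷ Ps) u< K<C 0<B (pr ∷ pT) pu p
    with t , q , h ← Passes-D⇐ (suc K) sT TB Ps
           (All.map (λ l → ≤-trans l (≤-reflexive (sym (+-suc B (suc K)))))
             (Pass-< (m<m+n B (s≤s z≤n)) rB u< P))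
           (≤-<-trans (≤-reflexive (cong (B +_) (sym (+-suc (suc K) (length T))))) K<C)
           0<B pT (Pass-positive 0<B pr pu P) p
    with t' , q' , h' ← Pass-D⇐ sr rB P u< (≤-<-trans (+-monoʳ-≤ B (m≤m+n (suc K) _)) K<C) wd 0<B pr pu q =
    t' , q' , ≤-trans h h'

-- Raising all letters by one keeps every insertion and frees 0 for the padding.
RowIns-suc : ∀ {x r r' b} → RowIns x r r' b → RowIns (suc x) (map suc r) (map suc r') (Maybe.map suc b)
RowIns-suc end         = end
RowIns-suc (here h)    = here (s≤s h)
RowIns-suc (there k R) = there (s≤s k) (RowIns-suc R)

Ins-suc : ∀ {x T T' i} → Ins x T T' i → Ins (suc x) (map (map suc) T) (map (map suc) T') i
Ins-suc new        = new
Ins-suc (stop R)   = stop (RowIns-suc R)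
Ins-suc (bump R I) = bump (RowIns-suc R) (Ins-suc I)

Run-suc : ∀ {T u ρ T'} → Run T u ρ T' → Run (map (map suc) T) (map suc u) ρ (map (map suc) T')
Run-suc []      = []
Run-suc (p ∷ R) = Ins-suc p ∷ Run-suc R

Pick-suc : ∀ {a b u s} → D.Pick a b u s → D.Pick (suc a) (suc b) (map suc u) s
Pick-suc D.done        = D.done
Pick-suc (D.skip p)    = D.skip (Pick-suc p)
Pick-suc (D.left h p)  = D.left (s≤s h) (Pick-suc p)
Pick-suc (D.right h p) = D.right (s≤s h) (Pick-suc p)

Pick-pred : ∀ {a b} u {s} → D.Pick (suc a) (suc b) (map suc u) s → D.Pick a b u s
Pick-pred []      D.done             = D.done
Pick-pred (_ ∷ u) (D.skip p)         = D.skip (Pick-pred u p)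
Pick-pred (_ ∷ u) (D.left (s≤s h) p)  = D.left h (Pick-pred u p)
Pick-pred (_ ∷ u) (D.right (s≤s h) p) = D.right h (Pick-pred u p)

bounded : ∀ u → ∃ λ B → All (_< B) u
bounded []      = 0 , []
bounded (x ∷ u) with B , h ← bounded u =
  suc x ⊔ B , m≤m⊔n (suc x) B ∷ All.map (λ l → ≤-trans l (m≤n⊔m (suc x) B)) h

bounded-rows : ∀ T → ∃ λ B → All (All (_< B)) T
bounded-rows []      = 0 , []
bounded-rows (r ∷ T) with A , g ← bounded r | B , h ← bounded-rows T =
  A ⊔ B , All.map (λ l → ≤-trans l (m≤m⊔n A B)) g ∷
    All.map (All.map (λ l → ≤-trans l (m≤n⊔m A B))) h

private
  pad-All : ∀ {P : List ℕ → Set} {T} m → P [] → All P T → All P (pad T m)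
  pad-All m p ps = Allₚ.++⁺ ps (Allₚ.replicate⁺ m p)

  suc-< : ∀ {B u} → All (_< B) u → All (_< suc B) (map suc u)
  suc-< ps = Allₚ.map⁺ (All.map s≤s ps)

  suc-positive : ∀ u → All (0 <_) (map suc u)
  suc-positive u = Allₚ.map⁺ (All.universal (λ _ → s≤s z≤n) u)

  suc-sorted : ∀ {T} → SortedRows T → SortedRows (map (map suc) T)
  suc-sorted ps = Allₚ.map⁺ (All.map (λ s → AllPairsₚ.map⁺ (AllPairs.map s≤s s)) ps)

  Width-any : ∀ {C b k} C' → Width C b k → ∃ λ b' → Width C' b' k
  Width-any C' one = 0 , one
  Width-any C' two = C' , two

  shift-in : ∀ {C C' b b' k s} u → Width C b k → Width C' b' k → All (_< C') (map suc u) →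
             D.Pick C b u s → D.Pick C' b' (map suc u) s
  shift-in u one one u<C' p = D.Pick-monoˡ (All.map (λ l _ → l) u<C')
    (D.Pick-monoʳ (All.map (λ { (s≤s _) (s≤s ()) }) (suc-positive u)) (Pick-suc p))
  shift-in u two two u<C' p = D.Pick-monoˡ (All.map (λ l _ → l) u<C')
    (D.Pick-monoʳ (All.map (λ l _ → l) u<C') (Pick-suc p))

  shift-out : ∀ {C C' b b' k s} u → Width C b k → Width C' b' k → All (_< C) u →
              D.Pick C' b' (map suc u) s → D.Pick C b u s
  shift-out u one one u<C p = Pick-pred u (D.Pick-monoˡ (All.map (λ l _ → l) (suc-< u<C))
    (D.Pick-monoʳ (All.universal (λ _ ()) _) p))
  shift-out u two two u<C p = Pick-pred u (D.Pick-monoˡ (All.map (λ l _ → l) (suc-< u<C))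
    (D.Pick-monoʳ (All.map (λ l _ → l) (suc-< u<C)) p))

-- Both words reduce to the word of final marks, which depends on ρ only.
Run-D : ∀ {T T' u v ρ T₁ T₂ C b k s} → SortedRows T → SortedRows T' →
        Run T u ρ T₁ → Run T' v ρ T₂ → Width C b k → All (_< C) v →
        D.Pick C b u s → ∃ λ t → D.Pick C b v t × s ≤ t
Run-D {T} {T'} {u} {v} {ρ} {C = C} {b} {k} {s} sT sT' R R' wd v<C p
  with B , (u<B ∷ v<B ∷ TT'<B) ← bounded-rows (u ∷ v ∷ T ++ T') = finish (proj₂ (Width-any C' wd))
  where
  S = map (map suc) T
  S' = map (map suc) T'
  -- Each tableau is padded by the number of rows of the other, so both have `L` rows: the final
  -- marks depend on this number as well as on ρ. The extra `length u` rows leave room for the rows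
  -- created on the way.
  m = length S' + length u
  m' = length S + length u
  len : ∀ T m → length (pad T m) ≡ length T + m
  len T m = trans (length-++ T) (cong (length T +_) (length-replicate m))
  lens : length (pad S m) ≡ length (pad S' m')
  lens = trans (len S m) (trans (+-assoc-swap (length S) (length S') (length u)) (sym (len S' m')))
    where
    +-assoc-swap : ∀ a b c → a + (b + c) ≡ b + (a + c)
    +-assoc-swap a b c = trans (sym (+-assoc a b c)) (trans (cong (_+ c) (+-comm a b)) (+-assoc b a c))
  L = length (pad S m)
  C' = suc (suc B + (1 + L))
  rows< : ∀ {T} m → All (All (_< B)) T → All (All (_< suc B)) (pad (map (map suc) T) m)
  rows< m ps = pad-All m [] (Allₚ.map⁺ (All.map suc-< ps))
  letters< : ∀ {w} → All (_< B) w → All (_< suc B + 1) (map suc w)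
  letters< ps = All.map (λ l → ≤-trans l (m≤m+n (suc B) 1)) (suc-< ps)
  P : Passes (suc B) (pad S m) (map suc u) (map (code (suc B) L) ρ)
  P = Passes-Run (suc-< u<B) (rows< m (Allₚ.++⁻ˡ T TT'<B))
        (≤-trans (≤-reflexive (length-map suc u)) (m≤n+m (length u) (length S'))) (Run-suc R)
  P' : Passes (suc B) (pad S' m') (map suc v) (map (code (suc B) L) ρ)
  P' = subst (λ n → Passes (suc B) (pad S' m') (map suc v) (map (code (suc B) n) ρ)) (sym lens)
         (Passes-Run (suc-< v<B) (rows< m' (Allₚ.++⁻ʳ T TT'<B))
           (≤-trans (≤-reflexive (trans (length-map suc v)
             (trans (Run-length R') (sym (Run-length R))))) (m≤n+m (length u) (length S))) (Run-suc R'))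
  finish : ∀ {b'} → Width C' b' k → ∃ λ t → D.Pick C b v t × s ≤ t
  finish {b'} wd'
    with t , q , h ← Passes-D⇒ wd' 0 (pad-All m [] (suc-sorted sT)) (rows< m (Allₚ.++⁻ˡ T TT'<B)) P
           (letters< u<B) ≤-refl
           (shift-in u wd wd'
             (All.map (λ l → ≤-trans l (≤-trans (m≤m+n (suc B) (1 + L)) (n≤1+n _))) (suc-< u<B)) p)
    with t' , q' , h' ← Passes-D⇐ wd' 0 (pad-All m' [] (suc-sorted sT')) (rows< m' (Allₚ.++⁻ʳ T TT'<B)) P'
           (letters< v<B) (s≤s (≤-reflexive (cong (λ n → suc B + (1 + n)) (sym lens)))) (s≤s z≤n)
           (pad-All m' [] (Allₚ.map⁺ (All.universal suc-positive T'))) (suc-positive v) q =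
    t' , shift-out v wd wd' v<C q' , ≤-trans h h'

-- Chains and the shape of the insertion tableau

data Above : List ℕ → List ℕ → Set where
  []  : ∀ {r} → Above r []
  _∷_ : ∀ {x y r s} → x < y → Above r s → Above (x ∷ r) (y ∷ s)

data Columns : Tableau → Set where
  []  : Columns []
  one : ∀ {x r} → Columns ((x ∷ r) ∷ [])
  _∷_ : ∀ {r y s T} → Above r (y ∷ s) → Columns ((y ∷ s) ∷ T) → Columns (r ∷ (y ∷ s) ∷ T)

Above-insertˡ : ∀ {x r r' y s} → RowIns x r r' (just y) → Above r s → Above r' s
Above-insertˡ _           []       = []
Above-insertˡ (here h)    (k ∷ rs) = <-trans h k ∷ rs
Above-insertˡ (there _ R) (k ∷ rs) = k ∷ Above-insertˡ R rs

Above-end : ∀ {x r r' s} → RowIns x r r' nothing → Above r s → Above r' s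
Above-end _           []       = []
Above-end (there _ R) (k ∷ rs) = k ∷ Above-end R rs

Above-bump : ∀ {x r r' y s s' b} → RowIns x r r' (just y) → Above r s → RowIns y s s' b → Above r' s'
Above-bump (here h)    _        end         = h ∷ []
Above-bump (here h)    (_ ∷ rs) (here _)    = h ∷ rs
Above-bump (here _)    (k ∷ _)  (there l _) = ⊥-elim (<⇒≱ k l)
Above-bump (there k R) _        end         = ≤-<-trans k (RowIns-< R) ∷ []
Above-bump (there k R) (_ ∷ rs) (here _)    = ≤-<-trans k (RowIns-< R) ∷ Above-insertˡ R rs
Above-bump (there _ R) (l ∷ rs) (there _ S) = l ∷ Above-bump R rs S

Ins-Columns : ∀ {x T T' i} → Ins x T T' i → Columns T → Columns T'
Ins-Columns new                            []       = one
Ins-Columns (stop end)                     c        = case-nil c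
  where
  case-nil : ∀ {x T} → Columns ([] ∷ T) → Columns ((x ∷ []) ∷ T)
  case-nil (() ∷ _)
Ins-Columns (stop (there k R))             one      = one
Ins-Columns (stop R@(there _ _))           (a ∷ c)  = Above-end R a ∷ c
Ins-Columns (bump R new)                   one      = Above-bump R [] end ∷ one
Ins-Columns (bump R I@(stop S@(there _ _))) (a ∷ c) = Above-bump R a S ∷ Ins-Columns I c
Ins-Columns (bump R I@(bump S@(here _) _)) (a ∷ c)  = Above-bump R a S ∷ Ins-Columns I c
Ins-Columns (bump R I@(bump S@(there _ _) _)) (a ∷ c) = Above-bump R a S ∷ Ins-Columns I c

Run-Columns : ∀ {T u ρ T'} → Run T u ρ T' → Columns T → Columns T'
Run-Columns []      c = c
Run-Columns (p ∷ R) c = Run-Columns R (Ins-Columns p c)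

-- `col₁` is the length of the second column; that of the first is `length`, as rows are nonempty in
-- a tableau with `Columns`.
row₀ row₁ col₁ size : Tableau → ℕ
row₀ []      = 0
row₀ (r ∷ _) = length r
row₁ []      = 0
row₁ (_ ∷ T) = row₀ T
col₁ []                = 0
col₁ ((_ ∷ _ ∷ _) ∷ T) = suc (col₁ T)
col₁ (_ ∷ T)           = col₁ T
size []      = 0
size (r ∷ T) = length r + size T

Above-length : ∀ {r s} → Above r s → length s ≤ length r
Above-length []       = z≤n
Above-length (_ ∷ rs) = s≤s (Above-length rs)

RowIns-length-bump : ∀ {x r r' y} → RowIns x r r' (just y) → length r' ≡ length r
RowIns-length-bump (here _)    = refl
RowIns-length-bump (there _ R) = cong suc (RowIns-length-bump R)

RowIns-length-end : ∀ {x r r'} → RowIns x r r' nothing → length r' ≡ suc (length r)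
RowIns-length-end end         = refl
RowIns-length-end (there _ R) = cong suc (RowIns-length-end R)

Ins-size : ∀ {x T T' i} → Ins x T T' i → size T' ≡ suc (size T)
Ins-size new                = refl
Ins-size (stop {T = T} R)   = cong (_+ size T) (RowIns-length-end R)
Ins-size (bump {r = r} R I) =
  trans (cong₂ _+_ (RowIns-length-bump R) (Ins-size I)) (+-suc (length r) _)

Run-size : ∀ {T u ρ T'} → Run T u ρ T' → size T' ≡ length u + size T
Run-size [] = refl
Run-size {T} (_∷_ {u = u} p R) =
  trans (Run-size R) (trans (cong (length u +_) (Ins-size p)) (+-suc (length u) (size T)))

size-thin : ∀ {r T} → Columns (r ∷ T) → length r ≤ 1 → size (r ∷ T) ≤ length (r ∷ T)
size-thin one h = ≤-trans (≤-reflexive (+-identityʳ _)) h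
size-thin (a ∷ c) h = +-mono-≤ h (size-thin c (≤-trans (Above-length a) h))

size-col₁ : ∀ T → col₁ T ≡ 0 → size T ≤ length T
size-col₁ []             _ = z≤n
size-col₁ ([] ∷ T)       h = m≤n⇒m≤1+n (size-col₁ T h)
size-col₁ ((_ ∷ []) ∷ T) h = s≤s (size-col₁ T h)

-- Such a shape is a hook with at most the second cell of the second row added, and a hook has one
-- cell fewer than the sum of its arms.
size-near-hook : ∀ {T} → Columns T → row₁ T ≤ 2 → col₁ T ≤ 2 → size T ≤ row₀ T + length T
size-near-hook [] _ _ = z≤n
size-near-hook (one {r = r}) _ _ = +-monoʳ-≤ (suc (length r)) z≤n
size-near-hook (_∷_ {r} {s = []} _ c) _ _ = +-monoʳ-≤ (length r) (m≤n⇒m≤1+n (size-thin c ≤-refl))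
size-near-hook (_∷_ {r = r@(_ ∷ _ ∷ _)} {s = _ ∷ s} {T} (_ ∷ _ ∷ _) _) (s≤s (s≤s h)) (s≤s (s≤s k)) =
  +-monoʳ-≤ (length r) (s≤s (s≤s (+-mono-≤ h (size-col₁ T (n≤0⇒n≡0 k)))))

private
  -- After chains have run up the first two columns of the reading word, these are the bounds left
  -- for what follows; a missing column leaves the initial bound `C`.
  top₀ top₁ : ℕ → Tableau → ℕ
  top₀ C ((x ∷ _) ∷ _)     = x
  top₀ C _                 = C
  top₁ C ((_ ∷ y ∷ _) ∷ _) = y
  top₁ C _                 = C

  top₀-< : ∀ {C x r T} → x < C → Columns ((x ∷ r) ∷ T) → x < top₀ C T
  top₀-< h one           = h
  top₀-< h ((k ∷ _) ∷ _) = k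

  top₁-< : ∀ {C x y r T} → y < C → Columns ((x ∷ y ∷ r) ∷ T) → y < top₁ C T
  top₁-< h one                = h
  top₁-< h ((_ ∷ []) ∷ _)     = h
  top₁-< h ((_ ∷ k ∷ _) ∷ _)  = k

  top₁-C : ∀ {C x T} → Columns ((x ∷ []) ∷ T) → top₁ C T ≡ C
  top₁-C one            = refl
  top₁-C ((_ ∷ []) ∷ _) = refl

  Columns-tail : ∀ {r T} → Columns (r ∷ T) → Columns T
  Columns-tail one     = []
  Columns-tail (_ ∷ c) = c

  reading-assoc : ∀ r T w → reading T ++ r ++ w ≡ reading (r ∷ T) ++ w
  reading-assoc r T w = sym (++-assoc (reading T) r w)

  column-D : ∀ {C} T → Columns T → All (All (_< C)) T → ∀ {w s} → D.Pick (top₀ C T) 0 w s →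
             D.Pick C 0 (reading T ++ w) (length T + s)
  column-D [] _ _ p = p
  column-D {C} ((x ∷ r) ∷ T) c ((x<C ∷ _) ∷ T<C) {w} {s} p =
    subst₂ (D.Pick C 0) (reading-assoc (x ∷ r) T w) (+-suc (length T) s)
      (column-D T (Columns-tail c) T<C (D.left (top₀-< x<C c) (D.Pick-++ r p)))
  column-D ([] ∷ T) (() ∷ _)

  columns-D : ∀ {C} T → Columns T → All (All (_< C)) T → ∀ {w s} → D.Pick (top₀ C T) (top₁ C T) w s →
              D.Pick C C (reading T ++ w) (length T + col₁ T + s)
  columns-D [] _ _ p = p
  columns-D ([] ∷ T) (() ∷ _)
  columns-D {C} ((x ∷ []) ∷ T) c ((x<C ∷ _) ∷ T<C) {w} {s} p =
    subst₂ (D.Pick C C) (reading-assoc (x ∷ []) T w) (+-suc (length T + col₁ T) s)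
      (columns-D T (Columns-tail c) T<C
        (D.left (top₀-< x<C c) (subst (λ b → D.Pick x b w s) (sym (top₁-C c)) p)))
  columns-D {C} ((x ∷ y ∷ r) ∷ T) c ((x<C ∷ y<C ∷ _) ∷ T<C) {w} {s} p =
    subst₂ (D.Pick C C) (reading-assoc (x ∷ y ∷ r) T w) (arith (length T) (col₁ T) s)
      (columns-D T (Columns-tail c) T<C
        (D.left (top₀-< x<C c) (D.right (top₁-< y<C c) (D.Pick-++ r p))))
    where
    arith : ∀ a b c → a + b + suc (suc c) ≡ suc a + suc b + c
    arith = solve 3 (λ a b c → a :+ b :+ (con 2 :+ c) := con 1 :+ a :+ (con 1 :+ b) :+ c) refl
      where open +-*-Solver

  reading-D-≤ : ∀ {a} T → SortedRows T → ∀ {w s} → D.Pick a 0 (reading T ++ w) s →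
                ∃ λ t → D.Pick a 0 w t × s ≤ length T + t
  reading-D-≤ [] _ p = _ , p , ≤-refl
  reading-D-≤ {a} (r ∷ T) (sr ∷ sT) {w} {s} p
    with t , q , h ← reading-D-≤ T sT (subst (λ v → D.Pick a 0 v s) (sym (reading-assoc r T w)) p)
    with t' , q' , h' ← Pick-row r sr q =
    t' , q' , ≤-trans h (≤-trans (+-monoʳ-≤ (length T)
      (≤-trans h' (+-monoʳ-≤ t' (≤-trans (≤-reflexive (+-identityʳ (live a))) (live-≤1 a)))))
      (≤-reflexive (arith (length T) t')))
    where
    live-≤1 : ∀ a → live a ≤ 1
    live-≤1 zero    = z≤n
    live-≤1 (suc _) = ≤-refl
    arith : ∀ a b → a + (b + 1) ≡ suc (a + b)
    arith = solve 2 (λ a b → a :+ (b :+ con 1) := con 1 :+ (a :+ b)) refl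
      where open +-*-Solver

  row-W : ∀ {a b w s} r → Sorted r → All (a ≤_) r → (∀ a' → W.Pick a' b w s) →
          W.Pick (just a) b (r ++ w) (length r + s)
  row-W []      _        _       p = p _
  row-W (x ∷ r) (x≤ ∷ s) (h ∷ _) p = W.left (bound h) (row-W r s x≤ p)

  nil-W : ∀ {a b} → W.Pick a b [] 0
  nil-W = W.done

  last-row-W : ∀ {b} r → Sorted r → W.Pick (just 0) b r (length r)
  last-row-W {b} r s = subst₂ (W.Pick (just 0) b) (++-identityʳ r) (+-identityʳ (length r))
    (row-W r s (All.universal (λ _ → z≤n) r) (λ _ → nil-W))

  first-row-W : ∀ T → SortedRows T → W.Pick (just 0) nothing (reading T) (row₀ T)
  first-row-W []      _        = nil-W
  first-row-W (r ∷ T) (s ∷ _)  = W.Pick-++ (reading T) (last-row-W r s)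

  two-rows-W : ∀ T → SortedRows T → W.Pick (just 0) (just 0) (reading T) (row₀ T + row₁ T)
  two-rows-W []          _           = nil-W
  two-rows-W (r ∷ [])    (s ∷ _)     = subst (W.Pick _ _ r) (sym (+-identityʳ (length r))) (last-row-W r s)
  two-rows-W (r ∷ q ∷ T) (s ∷ t ∷ _) =
    subst₂ (W.Pick _ _) (sym (++-assoc (reading T) q r)) (+-comm (length q) (length r))
      (W.Pick-++ (reading T) (W.Pick-swap
        (row-W q t (All.universal (λ _ → z≤n) q) (λ _ → W.Pick-swap (last-row-W r s)))))

  -- Over letters distinct from `x`, the bound `x` may be replaced by its successor. Hence weakly
  -- increasing chains of a word without repetitions are strict.
  data Raise (u : List ℕ) : Maybe ℕ → Maybe ℕ → Set where
    keep  : ∀ {a} → Raise u a a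
    raise : ∀ {x} → All (x ≢_) u → Raise u (just x) (just (suc x))

  Raise-tail : ∀ {x u a a'} → Raise (x ∷ u) a a' → Raise u a a'
  Raise-tail keep          = keep
  Raise-tail (raise (_ ∷ p)) = raise p

  Raise-≤ : ∀ {x u a a'} → Raise (x ∷ u) a a' → a admits x → a' admits x
  Raise-≤ keep h = h
  Raise-≤ (raise (p ∷ _)) (bound h) = bound (≤∧≢⇒< h p)

  W⇒I : ∀ {u a a' b b' s} → Unique u → Raise u a a' → Raise u b b' → W.Pick a b u s → I.Pick a' b' u s
  W⇒I _        _ _ W.done        = I.done
  W⇒I (_ ∷ un) f g (W.skip p)    = I.skip (W⇒I un (Raise-tail f) (Raise-tail g) p)
  W⇒I (n ∷ un) f g (W.left h p)  = I.left (Raise-≤ f h) (W⇒I un (raise n) (Raise-tail g) p)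
  W⇒I (n ∷ un) f g (W.right h p) = I.right (Raise-≤ g h) (W⇒I un (Raise-tail f) (raise n) p)

data Mode (C : ℕ) : Maybe ℕ → ℕ → ℕ → Set where
  one : Mode C nothing 0 1
  two : Mode C (just 0) C 2

private
  data Below (C : ℕ) : Maybe ℕ → ℕ → Set where
    off : Below C nothing 0
    on  : ∀ {a} → a ≤ C → Below C (just a) C

  data Fits : Maybe ℕ → ℕ → Set where
    off : ∀ {A} → Fits nothing A
    on  : ∀ {a A} → a ≤ A → Fits (just a) A

  Below-Fits : ∀ {C a A} → Below C a A → Fits a A
  Below-Fits off    = off
  Below-Fits (on h) = on h

  -- `acc` is the reversed prefix. The continuation rebuilds its chains under any decreasing bounds
  -- that are at least the present increasing ones, since the next letter to be put in front is not
  -- yet known.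
  I⇒D-acc : ∀ {C a b A B w s acc t} → Below C a A → Below C b B → All (_< C) w →
    (∀ {A B} → Fits a A → Fits b B → D.Pick A B acc t) → I.Pick a b w s → D.Pick A B (w ʳ++ acc) (s + t)
  I⇒D-acc f g _ k I.done = k (Below-Fits f) (Below-Fits g)
  I⇒D-acc f g (_ ∷ w<) k (I.skip p) = I⇒D-acc f g w< (λ x y → D.skip (k x y)) p
  I⇒D-acc {t = t} (on _) g (x< ∷ w<) k (I.left {s = s} (bound h) p) =
    subst (D.Pick _ _ _) (+-suc s t) (I⇒D-acc (on x<) g w< (λ { (on l) y → D.left l (k (on h) y) }) p)
  I⇒D-acc {t = t} f (on _) (x< ∷ w<) k (I.right {s = s} (bound h) p) =
    subst (D.Pick _ _ _) (+-suc s t) (I⇒D-acc f (on x<) w< (λ { y (on l) → D.right l (k y (on h)) }) p)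

  data Fitsᴰ : Bool → ℕ → Maybe ℕ → Set where
    off : Fitsᴰ false 0 nothing
    on  : ∀ {a A} → a ≤ A → Fitsᴰ true A (just a)

  data Start : Bool → ℕ → Maybe ℕ → Set where
    off : Start false 0 nothing
    on  : ∀ {A} → Start true A (just 0)

  Start-Fitsᴰ : ∀ {m A a} → Start m A a → Fitsᴰ m A a
  Start-Fitsᴰ off = off
  Start-Fitsᴰ on  = on z≤n

  D⇒I-acc : ∀ {m n a b A B w s acc t} → Start m A a → Start n B b →
    (∀ {a b} → Fitsᴰ m A a → Fitsᴰ n B b → I.Pick a b acc t) → D.Pick A B w s → I.Pick a b (w ʳ++ acc) (s + t)
  D⇒I-acc f g k D.done = k (Start-Fitsᴰ f) (Start-Fitsᴰ g)
  D⇒I-acc f g k (D.skip p) = D⇒I-acc f g (λ x y → I.skip (k x y)) p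
  D⇒I-acc {t = t} on g k (D.left {s = s} h p) =
    subst (I.Pick _ _ _) (+-suc s t) (D⇒I-acc on g (λ { (on l) y → I.left (bound l) (k (on h) y) }) p)
  D⇒I-acc {t = t} f on k (D.right {s = s} h p) =
    subst (I.Pick _ _ _) (+-suc s t) (D⇒I-acc f on (λ { y (on l) → I.right (bound l) (k y (on h)) }) p)

I⇒D : ∀ {C b B k w s} → Mode C b B k → All (_< C) w → I.Pick (just 0) b w s → D.Pick C B (List.reverse w) s
I⇒D {C} {B = B} {w = w} one w< p =
  subst (D.Pick C B (List.reverse w)) (+-identityʳ _) (I⇒D-acc (on z≤n) off w< (λ _ _ → D.done) p)
I⇒D {C} {B = B} {w = w} two w< p =
  subst (D.Pick C B (List.reverse w)) (+-identityʳ _) (I⇒D-acc (on z≤n) (on z≤n) w< (λ _ _ → D.done) p)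

D⇒I : ∀ {C b B k w s} → Mode C b B k → D.Pick C B w s → I.Pick (just 0) b (List.reverse w) s
D⇒I {b = b} {w = w} one p =
  subst (I.Pick (just 0) b (List.reverse w)) (+-identityʳ _) (D⇒I-acc on off (λ _ _ → I.done) p)
D⇒I {b = b} {w = w} two p =
  subst (I.Pick (just 0) b (List.reverse w)) (+-identityʳ _) (D⇒I-acc on on (λ _ _ → I.done) p)

-- An increasing and a decreasing chain share at most one letter: after a common letter their
-- bounds are incompatible.
private
  meet : Maybe ℕ → ℕ → ℕ
  meet nothing  _ = 0
  meet (just a) c with a <? c
  ... | yes _ = 1
  ... | no  _ = 0

  meet-mono : ∀ {a a' c c'} → a ≤ a' → c' ≤ c → meet (just a') c' ≤ meet (just a) c
  meet-mono {a} {a'} {c} {c'} h k with a' <? c' | a <? c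
  ... | yes _ | yes _ = ≤-refl
  ... | yes p | no q  = ⊥-elim (q (≤-<-trans h (<-≤-trans p k)))
  ... | no _  | _     = z≤n

  meet-monoᴵ : ∀ {a x} c → a admits x → meet (just (suc x)) c ≤ meet a c
  meet-monoᴵ c (bound h) = meet-mono (m≤n⇒m≤1+n h) ≤-refl

  meet-monoᴰ : ∀ {c x} a → x < c → meet a x ≤ meet a c
  meet-monoᴰ nothing  _ = z≤n
  meet-monoᴰ (just a) h = meet-mono ≤-refl (<⇒≤ h)

  meet-drop : ∀ {a c x} → a admits x → x < c → suc (meet (just (suc x)) x) ≤ meet a c
  meet-drop {just a} {c} {x} (bound h) k with suc x <? x | a <? c
  ... | yes p | _     = ⊥-elim (<⇒≱ p (n≤1+n x))
  ... | no _  | yes _ = ≤-refl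
  ... | no _  | no q  = ⊥-elim (q (≤-<-trans h k))

  meets : Maybe ℕ → Maybe ℕ → ℕ → ℕ → ℕ
  meets a b c d = (meet a c + meet a d) + (meet b c + meet b d)

  meet-≤1 : ∀ a c → meet a c ≤ 1
  meet-≤1 nothing  _ = z≤n
  meet-≤1 (just a) c with a <? c
  ... | yes _ = ≤-refl
  ... | no  _ = z≤n

  meet-0 : ∀ a → meet a 0 ≡ 0
  meet-0 nothing  = refl
  meet-0 (just a) = refl

  common : ∀ l s t {m m'} → s + t ≤ l + m → m < m' → suc s + suc t ≤ suc l + m'
  common l s t g h = s≤s (≤-trans (≤-reflexive (+-suc s t))
    (≤-trans (s≤s g) (≤-trans (≤-reflexive (sym (+-suc l _))) (+-monoʳ-≤ l h))))

  -- `meets` counts the pairs of an increasing and a decreasing chain that may still share a letter.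
  -- A letter counted on both sides closes its pair, and the other three terms never grow.
  chains-meet : ∀ {a b c d w s t} → I.Pick a b w s → D.Pick c d w t → s + t ≤ length w + meets a b c d
  chains-meet I.done D.done = z≤n
  chains-meet (I.skip p) (D.skip q) = m≤n⇒m≤1+n (chains-meet p q)
  chains-meet {a} {b} {c} {d} {w = _ ∷ w} (I.skip {s = s} p) (D.left {s = t} k q) =
    ≤-trans (≤-reflexive (+-suc s t)) (s≤s (≤-trans (chains-meet p q) (+-monoʳ-≤ (length w)
      (+-mono-≤ (+-monoˡ-≤ _ (meet-monoᴰ a k)) (+-monoˡ-≤ _ (meet-monoᴰ b k))))))
  chains-meet {a} {b} {c} {d} {w = _ ∷ w} (I.skip {s = s} p) (D.right {s = t} k q) =
    ≤-trans (≤-reflexive (+-suc s t)) (s≤s (≤-trans (chains-meet p q) (+-monoʳ-≤ (length w)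
      (+-mono-≤ (+-monoʳ-≤ (meet a c) (meet-monoᴰ a k)) (+-monoʳ-≤ (meet b c) (meet-monoᴰ b k))))))
  chains-meet {c = c} {d} {w = _ ∷ w} (I.left h p) (D.skip q) =
    s≤s (≤-trans (chains-meet p q) (+-monoʳ-≤ (length w)
      (+-monoˡ-≤ _ (+-mono-≤ (meet-monoᴵ c h) (meet-monoᴵ d h)))))
  chains-meet {a} {c = c} {d} {w = _ ∷ w} (I.right h p) (D.skip q) =
    s≤s (≤-trans (chains-meet p q) (+-monoʳ-≤ (length w)
      (+-monoʳ-≤ (meet a c + meet a d) (+-mono-≤ (meet-monoᴵ c h) (meet-monoᴵ d h)))))
  chains-meet {a} {b} {c} {d} {w = _ ∷ w} (I.left {s = s} h p) (D.left {s = t} k q) =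
    common (length w) s t (chains-meet p q)
      (+-mono-<-≤ (+-mono-<-≤ (meet-drop h k) (meet-monoᴵ d h)) (+-monoˡ-≤ (meet b d) (meet-monoᴰ b k)))
  chains-meet {a} {b} {c} {d} {w = _ ∷ w} (I.left {s = s} h p) (D.right {s = t} k q) =
    common (length w) s t (chains-meet p q)
      (+-mono-<-≤ (+-mono-≤-< (meet-monoᴵ c h) (meet-drop h k)) (+-monoʳ-≤ (meet b c) (meet-monoᴰ b k)))
  chains-meet {a} {b} {c} {d} {w = _ ∷ w} (I.right {s = s} h p) (D.left {s = t} k q) =
    common (length w) s t (chains-meet p q)
      (+-mono-≤-< (+-monoˡ-≤ (meet a d) (meet-monoᴰ a k)) (+-mono-<-≤ (meet-drop h k) (meet-monoᴵ d h)))
  chains-meet {a} {b} {c} {d} {w = _ ∷ w} (I.right {s = s} h p) (D.right {s = t} k q) =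
    common (length w) s t (chains-meet p q)
      (+-mono-≤-< (+-monoʳ-≤ (meet a c) (meet-monoᴰ a k)) (+-mono-≤-< (meet-monoᴵ c h) (meet-drop h k)))

overlap₁ : ∀ {C w s t} → I.Pick (just 0) nothing w s → D.Pick C 0 w t → s + t ≤ length w + 1
overlap₁ {C} {w} p q = ≤-trans (chains-meet p q) (+-monoʳ-≤ (length w)
  (≤-trans (≤-reflexive (trans (+-identityʳ _)
    (trans (cong (meet (just 0) C +_) (meet-0 (just 0))) (+-identityʳ _)))) (meet-≤1 (just 0) C)))

overlap₂ : ∀ {C w s t} → I.Pick (just 0) (just 0) w s → D.Pick C C w t → s + t ≤ length w + 4
overlap₂ {C} {w} p q = ≤-trans (chains-meet p q) (+-monoʳ-≤ (length w)
  (+-mono-≤ (+-mono-≤ h h) (+-mono-≤ h h)))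
  where h = meet-≤1 (just 0) C

private
  count< : ℕ → List ℕ → ℕ
  count< a []      = 0
  count< a (x ∷ r) with x <? a
  ... | yes _ = suc (count< a r)
  ... | no  _ = count< a r

  count<-cons : ∀ {a b x y r r'} → (x < a → y < b) → count< a r ≤ count< b r' → count< a (x ∷ r) ≤ count< b (y ∷ r')
  count<-cons {a} {b} {x} {y} f h with x <? a | y <? b
  ... | yes _ | yes _ = s≤s h
  ... | yes p | no q  = ⊥-elim (q (f p))
  ... | no _  | yes _ = m≤n⇒m≤1+n h
  ... | no _  | no _  = h

  count<-mono : ∀ {a b} r → a ≤ b → count< a r ≤ count< b r
  count<-mono []      _ = z≤n
  count<-mono (x ∷ r) h = count<-cons {x = x} {x} {r} {r} (λ l → ≤-trans l h) (count<-mono r h)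

  count<-≤ : ∀ a r → count< a r ≤ length r
  count<-≤ a []      = z≤n
  count<-≤ a (x ∷ r) with x <? a
  ... | yes _ = s≤s (count<-≤ a r)
  ... | no  _ = m≤n⇒m≤1+n (count<-≤ a r)

  count<-skip : ∀ {a x r r' b} → RowIns x r r' b → count< a r ≤ count< a r'
  count<-skip end = z≤n
  count<-skip {a} {x} (here {y} {r} h)  = count<-cons {a} {a} {y} {x} {r} {r} (<-trans h) ≤-refl
  count<-skip {a} (there {y} {r} {r'} _ R) = count<-cons {a} {a} {y} {y} {r} {r'} (λ l → l) (count<-skip R)

  count<-take : ∀ {a x r r' b} → a ≤ x → RowIns x r r' b → suc (count< a r) ≤ count< (suc x) r'
  count<-take {x = x} h end with x <? suc x
  ... | yes _ = ≤-refl
  ... | no q  = ⊥-elim (q ≤-refl)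
  count<-take {a} {x} h (here {y} {r} k) with y <? a | x <? suc x
  ... | _     | no q  = ⊥-elim (q ≤-refl)
  ... | yes l | yes _ = ⊥-elim (<⇒≱ (<-≤-trans l h) (<⇒≤ k))
  ... | no _  | yes _ = s≤s (count<-mono r (m≤n⇒m≤1+n h))
  count<-take {a} {x} h (there {y} k R) with y <? a | y <? suc x
  ... | yes _ | yes _ = s≤s (count<-take h R)
  ... | no _  | yes _ = m≤n⇒m≤1+n (count<-take h R)
  ... | _     | no q  = ⊥-elim (q (s≤s k))

  Ins-firstRowow : ∀ {x T T' i} → Ins x T T' i → ∃ λ b → RowIns x (firstRow T) (firstRow T') b
  Ins-firstRowow new        = _ , end
  Ins-firstRowow (stop R)   = _ , R
  Ins-firstRowow (bump R _) = _ , R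

  firstRow-length : ∀ T → length (firstRow T) ≡ row₀ T
  firstRow-length []      = refl
  firstRow-length (_ ∷ _) = refl

  -- The number of letters below the bound in the first row never falls under an insertion, and it
  -- rises by at least one whenever the chain takes the inserted letter and moves its bound past it.
  increasing-count : ∀ {a w s T ρ T'} → I.Pick (just a) nothing w s → Run T w ρ T' →
                     count< a (firstRow T) + s ≤ row₀ T'
  increasing-count {a} {T = T} I.done [] =
    ≤-trans (≤-reflexive (+-identityʳ _)) (≤-trans (count<-≤ a (firstRow T)) (≤-reflexive (firstRow-length T)))
  increasing-count {s = s} (I.skip p) (q ∷ R) =
    ≤-trans (+-monoˡ-≤ s (count<-skip (proj₂ (Ins-firstRowow q)))) (increasing-count p R)
  increasing-count (I.left {s = s} (bound h) p) (q ∷ R) =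
    ≤-trans (≤-reflexive (+-suc _ s))
      (≤-trans (+-monoˡ-≤ s (count<-take h (proj₂ (Ins-firstRowow q)))) (increasing-count p R))

increasing-≤ : ∀ {w s ρ P} → I.Pick (just 0) nothing w s → Run [] w ρ P → s ≤ row₀ P
increasing-≤ = increasing-count

decreasing-≤ : ∀ {C w s ρ P} → D.Pick C 0 w s → Run [] w ρ P → s ≤ length P
decreasing-≤ {C} {w} {s} {P = P} p R
  with t , q , h ← reading-D-≤ P (Run-SortedRows R [])
         (subst (λ v → D.Pick C 0 v s) (sym (++-identityʳ (reading P))) (proj₁ (≋⇒D (≋-Run [] R)) p))
  with D.done ← q = ≤-trans h (≤-reflexive (+-identityʳ _))

private
  Run-rows< : ∀ {C T u ρ T'} → Run T u ρ T' → All (_< C) u → All (All (_< C)) T → All (All (_< C)) T'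
  Run-rows< []      _        h = h
  Run-rows< (p ∷ R) (x< ∷ u<) h = Run-rows< R u< (Ins-All p x< h)
    where
    Ins-All : ∀ {P : ℕ → Set} {x T T' i} → Ins x T T' i → P x → All (All P) T → All (All P) T'
    Ins-All new        px _        = (px ∷ []) ∷ []
    Ins-All (stop R)   px (r ∷ ps) = RowIns-All R px r ∷ ps
    Ins-All (bump R I) px (r ∷ ps) = RowIns-All R px r ∷ Ins-All I (RowIns-bumped R r) ps

module _ {C : ℕ} {w ρ : List ℕ} {P : Tableau} (w< : All (_< C) w) (R : Run [] w ρ P) where
  private
    from-reading : ∀ {b s} → D.Pick C b (reading P ++ []) s → D.Pick C b w s
    from-reading {b} {s} p =
      proj₂ (≋⇒D (≋-Run [] R)) (subst (λ v → D.Pick C b v s) (++-identityʳ (reading P)) p)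

  D-rows : D.Pick C 0 w (length P)
  D-rows = subst (D.Pick C 0 w) (+-identityʳ (length P))
    (from-reading (column-D P (Run-Columns R []) (Run-rows< R w< []) D.done))

  D-columns : D.Pick C C w (length P + col₁ P)
  D-columns = subst (D.Pick C C w) (+-identityʳ (length P + col₁ P))
    (from-reading (columns-D P (Run-Columns R []) (Run-rows< R w< []) D.done))

module _ {w ρ : List ℕ} {P : Tableau} (un : Unique w) (R : Run [] w ρ P) where

  I-row : I.Pick (just 0) nothing w (row₀ P)
  I-row = W⇒I un keep keep (proj₂ (≋⇒W (≋-Run [] R)) (first-row-W P (Run-SortedRows R [])))

  I-rows : I.Pick (just 0) (just 0) w (row₀ P + row₁ P)
  I-rows = W⇒I un keep keep (proj₂ (≋⇒W (≋-Run [] R)) (two-rows-W P (Run-SortedRows R [])))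

-- Words recorded like their reverse

-- Equality of the recording tableaux is weakened to a common row sequence from some starting
-- tableaux, so that the property passes to centred segments.
Balanced : List ℕ → Set
Balanced w = ∃ λ T → ∃ λ T' → ∃ λ ρ → ∃ λ T₁ → ∃ λ T₁' →
  SortedRows T × SortedRows T' × Run T w ρ T₁ × Run T' (List.reverse w) ρ T₁'

Balanced-D : ∀ {w C b k s} → Balanced w → Width C b k → All (_< C) (List.reverse w) →
             D.Pick C b w s → ∃ λ t → D.Pick C b (List.reverse w) t × s ≤ t
Balanced-D (_ , _ , _ , _ , _ , sT , sT' , A , B) wd h p = Run-D sT sT' A B wd h p

Balanced-D-reverse : ∀ {w C b k s} → Balanced w → Width C b k → All (_< C) w →
                     D.Pick C b (List.reverse w) s → ∃ λ t → D.Pick C b w t × s ≤ t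
Balanced-D-reverse (_ , _ , _ , _ , _ , sT , sT' , A , B) wd h p = Run-D sT' sT B A wd h p

module _ {w ρ : List ℕ} {P : Tableau} (un : Unique w) (R : Run [] w ρ P) (bal : Balanced w) where

  private
    C = proj₁ (bounded w)
    w< = proj₂ (bounded w)

    rw< : All (_< C) (List.reverse w)
    rw< = All-resp-↭ (↭-sym (↭-reverse w)) w<

    back : ∀ {b B k s} → Mode C b B k → D.Pick C B (List.reverse w) s → I.Pick (just 0) b w s
    back {b} {s = s} m p = subst (λ v → I.Pick (just 0) b v s) (reverse-involutive w) (D⇒I m p)

  -- Increasing chains of `w` are decreasing chains of its reverse, and the common row sequence
  -- carries these back to `w`; the other inequality reverses the route.
  row₀≡rows : row₀ P ≡ length P
  row₀≡rows = ≤-antisym le ge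
    where
    le : row₀ P ≤ length P
    le with t , p , h ← Balanced-D-reverse bal one w< (I⇒D one w< (I-row un R)) = ≤-trans h (decreasing-≤ p R)
    ge : length P ≤ row₀ P
    ge with t , p , h ← Balanced-D bal one rw< (D-rows w< R) = ≤-trans h (increasing-≤ (back one p) R)

  private
    +-double : ∀ {s t n} → s ≤ t → s + t ≤ n → s + s ≤ n
    +-double {s} h k = ≤-trans (+-monoʳ-≤ s h) k

  -- The first two rows give two increasing chains; by reversal and the common row sequence `w` also
  -- has two decreasing chains of at least that total size. Counting both exceeds `length w` by at
  -- most four.
  two-rows-≤ : (row₀ P + row₁ P) + (row₀ P + row₁ P) ≤ length w + 4
  two-rows-≤ with t , p , h ← Balanced-D-reverse bal two w< (I⇒D two w< (I-rows un R)) =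
    +-double h (overlap₂ (I-rows un R) p)

  two-columns-≤ : (length P + col₁ P) + (length P + col₁ P) ≤ length w + 4
  two-columns-≤ with t , p , h ← Balanced-D bal two rw< (D-columns w< R) =
    +-double h (≤-trans (≤-reflexive (+-comm (length P + col₁ P) t)) (overlap₂ (back two p) (D-columns w< R)))

  -- With `a` rows and 2a + 1 letters, the bounds on two rows and two columns leave at most two
  -- cells in the second row and in the second column, so there would be at most 2a cells.
  not-near-hook : length w ≢ suc (length P + length P)
  not-near-hook e = 1+n≰n (≤-trans (≤-reflexive (trans (sym e) size-w))
    (≤-trans (size-near-hook (Run-Columns R []) (small (row₁ P) rows) (small (col₁ P) two-columns-≤))
      (≤-reflexive (cong (_+ length P) row₀≡rows))))
    where
    a = length P
    size-w : length w ≡ size P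
    size-w = sym (trans (Run-size R) (+-identityʳ (length w)))
    rows : (a + row₁ P) + (a + row₁ P) ≤ length w + 4
    rows = subst (λ z → (z + row₁ P) + (z + row₁ P) ≤ length w + 4) row₀≡rows two-rows-≤
    small : ∀ c → (a + c) + (a + c) ≤ length w + 4 → c ≤ 2
    small zero          _ = z≤n
    small (suc zero)    _ = s≤s z≤n
    small (suc (suc zero)) _ = ≤-refl
    -- Three or more cells would give 2a + 6 ≤ 2a + 5.
    small (suc (suc (suc c))) h = ⊥-elim (1+n≰n (≤-trans (m≤m+n _ (c + c)) (≤-trans (≤-reflexive (arith a c))
      (≤-trans h (≤-reflexive (cong (_+ 4) e))))))
      where
      open +-*-Solver
      arith : ∀ a c → suc (suc (a + a) + 4) + (c + c) ≡ (a + (3 + c)) + (a + (3 + c))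
      arith = solve 2 (λ a c → con 1 :+ (con 1 :+ (a :+ a) :+ con 4) :+ (c :+ c) :=
                (a :+ (con 3 :+ c)) :+ (a :+ (con 3 :+ c))) refl

  hook-≤ : length P + length P ≤ length w + 1
  hook-≤ = subst (λ z → z + length P ≤ length w + 1) row₀≡rows (overlap₁ (I-row un R) (D-rows w< R))

-- For `w` and for its reverse alike, deleting both end letters deletes the first and the last entry
-- of the common row sequence.
Balanced-inner : ∀ {x v y} → Balanced (x ∷ v ∷ʳ y) → Balanced v
Balanced-inner {x} {v} {y} (T , T' , _ , T₁ , T₁' , sT , sT' , (p ∷ A) , B)
  with σ , τ , T₂ , refl , A₁ , (_∷_ {i = i} _ []) ← Run-split v A
  with (q ∷ B') ← subst (λ z → Run T' z _ T₁')
         (trans (unfold-reverse x (v ∷ʳ y)) (cong (_∷ʳ x) (reverse-++ v (y ∷ [])))) B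
  with σ' , τ' , T₃ , e , B₁ , (_∷_ {i = j} _ []) ← Run-split (List.reverse v) B'
  = _ , _ , σ , T₂ , T₃ , Ins-SortedRows p sT , Ins-SortedRows q sT' , A₁ ,
    subst (λ z → Run _ (List.reverse v) z T₃) (sym (proj₁ (∷ʳ-injective σ σ' e))) B₁

Run-rows-mono : ∀ {w ρ P x y ρ' P'} → Run [] w ρ P → Run [] (x ∷ w ∷ʳ y) ρ' P' → length P ≤ length P'
Run-rows-mono {w} {x = x} {y} R R' with C , (x< ∷ h) ← bounded (x ∷ w ∷ʳ y) =
  decreasing-≤ (D.skip (extend (D-rows (Allₚ.++⁻ˡ w h) R))) R'
  where
  extend : ∀ {w s a b} → D.Pick a b w s → D.Pick a b (w ∷ʳ y) s
  extend D.done        = D.skip D.done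
  extend (D.skip p)    = D.skip (extend p)
  extend (D.left h p)  = D.left h (extend p)
  extend (D.right h p) = D.right h (extend p)

Unique-inner : ∀ {x : ℕ} {v y} → Unique (x ∷ v ∷ʳ y) → Unique v
Unique-inner (_ ∷ un) = init un
  where
  init : ∀ {v} {y : ℕ} → Unique (v ∷ʳ y) → Unique v
  init {[]}    _         = []
  init {_ ∷ v} (h ∷ un) = Allₚ.++⁻ˡ v h ∷ init un

data Nested : List ℕ → Set where
  []     : Nested []
  single : ∀ x → Nested [ x ]
  wrap   : ∀ x {v} y → Nested v → Nested (x ∷ v ∷ʳ y)

nested : ∀ n w → length w ≤ n → Nested w
nested _ [] _ = []
nested (suc n) (x ∷ w) (s≤s h) with initLast w
... | []       = single x
... | v ∷ʳ′ y = wrap x y (nested n v (≤-trans (≤-trans (m≤m+n (length v) 1) (≤-reflexive (sym (length-++ v)))) h))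

-- Removing the first and the last letter lowers the number of rows by at most one; if it
-- stays the same, a word of length 2a + 1 has a rows and a columns and contradicts the counts
-- of pairs of chains.
Balanced-hook : ∀ {w ρ P} → Nested w → Unique w → Balanced w → Run [] w ρ P → w ≢ [] →
                length P + length P ≡ length w + 1
Balanced-hook [] _ _ _ ne = ⊥-elim (ne refl)
Balanced-hook (single x) _ _ (new ∷ []) _ = refl
Balanced-hook {w} {P = P} (wrap x {[]} y []) un bal R _ =
  ⊥-elim (two-letters P (row₀≡rows un R bal) (hook-≤ un R bal) (Run-size R))
  where
  two-letters : ∀ P → row₀ P ≡ length P → length P + length P ≤ 3 → size P ≢ 2
  two-letters (r ∷ []) e _ s = case (trans (sym s) (trans (+-identityʳ (length r)) e))
    where
    case : ¬ (2 ≡ 1)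
    case ()
  two-letters (r ∷ q ∷ T) _ h _ =
    ⊥-elim (<⇒≱ (≤-trans (m≤m+n 4 (length T + length T)) (≤-reflexive (sym (arith (length T))))) h)
    where
    open +-*-Solver
    arith : ∀ a → suc (suc a) + suc (suc a) ≡ 4 + (a + a)
    arith = solve 1 (λ a → con 2 :+ a :+ (con 2 :+ a) := con 4 :+ (a :+ a)) refl
Balanced-hook {w} {P = P} (wrap x {v@(_ ∷ _)} y ns) un bal R _
  with _ , P' , R' ← run [] v
  with ih ← Balanced-hook ns (Unique-inner un) (Balanced-inner bal) R' (λ ())
  with m≤n⇒m<n∨m≡n (Run-rows-mono R' R)
... | inj₂ e = ⊥-elim (not-near-hook un R bal (trans (cong suc (trans (length-++ v) ih'))
                 (cong₂ (λ a b → suc (a + b)) e e)))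
  where
  ih' : length v + 1 ≡ length P' + length P'
  ih' = sym ih
... | inj₁ l = ≤-antisym (hook-≤ un R bal)
      (≤-trans (≤-reflexive (trans (cong (λ z → suc z + 1) (trans (length-++ v) (sym ih))) (arith (length P'))))
        (+-mono-≤ l l))
  where
  open +-*-Solver
  arith : ∀ a → suc (a + a) + 1 ≡ suc a + suc a
  arith = solve 1 (λ a → con 1 :+ (a :+ a) :+ con 1 := con 1 :+ a :+ (con 1 :+ a)) refl

-- Hooks and descents

Unique-resp-↭ : {A : Set} {u v : List A} → u ↭ v → Unique u → Unique v
Unique-resp-↭ Perm.refl         un                   = un
Unique-resp-↭ (Perm.prep _ p)   (h ∷ un)             = All-resp-↭ p h ∷ Unique-resp-↭ p un
Unique-resp-↭ (Perm.swap _ _ p) ((n ∷ h) ∷ k ∷ un) =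
  ((λ e → n (sym e)) ∷ All-resp-↭ p k) ∷ All-resp-↭ p h ∷ Unique-resp-↭ p un
Unique-resp-↭ (Perm.trans p q)  un                   = Unique-resp-↭ q (Unique-resp-↭ p un)

-- Recording tableaux and row sequences

build : ℕ → List ℕ → Tableau → Tableau
build k []      Q = Q
build k (i ∷ ρ) Q = build (suc k) ρ (addAt k i Q)

rsAux-Run : ∀ {P u ρ P'} k Q → Run P u ρ P' → proj₂ (rsAux k u P Q) ≡ build k ρ Q
rsAux-Run k Q [] = refl
rsAux-Run {P} k Q (_∷_ {x = x} p R) with insertP x P | insertP-Ins x P
... | P₁ , i | p' with refl , refl ← Ins-functional p p' = rsAux-Run (suc k) _ R

data Valid : ℕ → List ℕ → Set where
  []  : ∀ {h} → Valid h []
  _∷_ : ∀ {h i ρ} → i ≤ h → Valid (h ⊔ suc i) ρ → Valid h (i ∷ ρ)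

Ins-≤ : ∀ {x T T' i} → Ins x T T' i → i ≤ length T
Ins-≤ new        = z≤n
Ins-≤ (stop _)   = z≤n
Ins-≤ (bump _ I) = s≤s (Ins-≤ I)

Ins-length : ∀ {x T T' i} → Ins x T T' i → length T' ≡ length T ⊔ suc i
Ins-length new              = refl
Ins-length (stop {T = T} _) = cong suc (sym (⊔-identityʳ (length T)))
Ins-length (bump _ I)       = cong suc (Ins-length I)

Run-Valid : ∀ {T u ρ T'} → Run T u ρ T' → Valid (length T) ρ
Run-Valid []      = []
Run-Valid {ρ = i ∷ ρ} (p ∷ R) = Ins-≤ p ∷ subst (λ h → Valid h ρ) (Ins-length p) (Run-Valid R)

data InRow (t : ℕ) : ℕ → Tableau → Set where
  here  : ∀ {r Q} → t ∈ r → InRow t 0 (r ∷ Q)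
  there : ∀ {r Q i} → InRow t i Q → InRow t (suc i) (r ∷ Q)

InRow-addAt : ∀ {t i k} j Q → InRow t i Q → InRow t i (addAt k j Q)
InRow-addAt zero    (r ∷ Q) (here m)  = here (∈-++⁺ˡ m)
InRow-addAt (suc j) (r ∷ Q) (here m)  = here m
InRow-addAt zero    (r ∷ Q) (there m) = there m
InRow-addAt (suc j) (r ∷ Q) (there m) = there (InRow-addAt j Q m)

InRow-new : ∀ {k} j Q → j ≤ length Q → InRow k j (addAt k j Q)
InRow-new zero    []      _       = here (here refl)
InRow-new zero    (r ∷ Q) _       = here (∈-++⁺ʳ r (here refl))
InRow-new (suc j) (r ∷ Q) (s≤s h) = there (InRow-new j Q h)

InRow-addAt⁻ : ∀ {t i k} j Q → j ≤ length Q → InRow t i (addAt k j Q) → (t ≡ k × i ≡ j) ⊎ InRow t i Q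
InRow-addAt⁻ zero [] _ (here (here refl)) = inj₁ (refl , refl)
InRow-addAt⁻ zero (r ∷ Q) _ (here m) with ∈-++⁻ r m
... | inj₁ m'          = inj₂ (here m')
... | inj₂ (here refl) = inj₁ (refl , refl)
InRow-addAt⁻ zero (r ∷ Q) _ (there m) = inj₂ (there m)
InRow-addAt⁻ (suc j) (r ∷ Q) _ (here m) = inj₂ (here m)
InRow-addAt⁻ (suc j) (r ∷ Q) (s≤s h) (there m) with InRow-addAt⁻ j Q h m
... | inj₁ (refl , refl) = inj₁ (refl , refl)
... | inj₂ m'            = inj₂ (there m')

length-addAt : ∀ k j Q → j ≤ length Q → length (addAt k j Q) ≡ length Q ⊔ suc j
length-addAt k zero    []      _       = refl
length-addAt k zero    (r ∷ Q) _       = cong suc (sym (⊔-identityʳ (length Q)))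
length-addAt k (suc j) (r ∷ Q) (s≤s h) = cong suc (length-addAt k j Q h)

Labelled : ℕ → Tableau → Set
Labelled k Q = (∀ {t i} → InRow t i Q → t < k) × (∀ {t i j} → InRow t i Q → InRow t j Q → i ≡ j)

addAt-Labelled : ∀ {k j Q} → j ≤ length Q → Labelled k Q → Labelled (suc k) (addAt k j Q)
addAt-Labelled {k} {j} {Q} h (lt , un) = lt' , un'
  where
  lt' : ∀ {t i} → InRow t i (addAt k j Q) → t < suc k
  lt' m with InRow-addAt⁻ j Q h m
  ... | inj₁ (refl , _) = ≤-refl
  ... | inj₂ m'         = m<n⇒m<1+n (lt m')
  un' : ∀ {t i i'} → InRow t i (addAt k j Q) → InRow t i' (addAt k j Q) → i ≡ i'
  un' m n with InRow-addAt⁻ j Q h m | InRow-addAt⁻ j Q h n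
  ... | inj₁ (refl , refl) | inj₁ (_ , refl) = refl
  ... | inj₁ (refl , _)    | inj₂ n'         = ⊥-elim (<-irrefl refl (lt n'))
  ... | inj₂ m'            | inj₁ (refl , _) = ⊥-elim (<-irrefl refl (lt m'))
  ... | inj₂ m'            | inj₂ n'         = un m' n'

build-Labelled : ∀ {k} ρ Q → Valid (length Q) ρ → Labelled k Q → ∃ λ k' → Labelled k' (build k ρ Q)
build-Labelled []      Q _       l = _ , l
build-Labelled {k} (i ∷ ρ) Q (h ∷ v) l =
  build-Labelled ρ (addAt k i Q) (subst (λ n → Valid n ρ) (sym (length-addAt k i Q h)) v) (addAt-Labelled h l)

InRow-build : ∀ {t i} k ρ Q → InRow t i Q → InRow t i (build k ρ Q)
InRow-build k []      Q m = m
InRow-build k (j ∷ ρ) Q m = InRow-build (suc k) ρ (addAt k j Q) (InRow-addAt j Q m)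

-- The label `k` stays in the row where it was put and occurs in only one row of the final tableau,
-- so the heads of the two sequences agree.
build-injective : ∀ {k Q Q'} ρ ρ' → length ρ ≡ length ρ' → Valid (length Q) ρ → Valid (length Q') ρ' →
                  Labelled k Q → build k ρ Q ≡ build k ρ' Q' → ρ ≡ ρ'
build-injective []      []        _ _ _ _ _ = refl
build-injective {k} {Q} {Q'} (i ∷ ρ) (j ∷ ρ') l (h ∷ v) (h' ∷ v') lab e
  with _ , _ , un ← build-Labelled (i ∷ ρ) Q (h ∷ v) lab
  with refl ← un (InRow-build (suc k) ρ (addAt k i Q) (InRow-new i Q h))
                 (subst (InRow k j) (sym e) (InRow-build (suc k) ρ' (addAt k j Q') (InRow-new j Q' h'))) =
  cong (i ∷_) (build-injective ρ ρ' (suc-injective l)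
    (subst (λ n → Valid n ρ) (sym (length-addAt k i Q h)) v)
    (subst (λ n → Valid n ρ') (sym (length-addAt k i Q' h')) v')
    (addAt-Labelled h lab) e)

-- The rows of the new cells while a tableau with h rows grows by cells at the end of the first
-- row (false) or of the first column (true).
hook-rows : ℕ → List Bool → List ℕ
hook-rows h []           = []
hook-rows h (false ∷ bs) = 0 ∷ hook-rows h bs
hook-rows h (true ∷ bs)  = h ∷ hook-rows (suc h) bs

Ins-row₀-stop : ∀ {x T T'} → Ins x T T' 0 → row₀ T' ≡ suc (row₀ T)
Ins-row₀-stop new      = refl
Ins-row₀-stop (stop R) = RowIns-length-end R

Ins-row₀-bump : ∀ {x T T' i} → Ins x T T' (suc i) → row₀ T' ≡ row₀ T
Ins-row₀-bump (bump R _) = RowIns-length-bump R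

private
  arms : Tableau → ℕ
  arms T = row₀ T + length T

  data Step (T T' : Tableau) : ℕ → Set where
    row   : arms T' ≡ suc (arms T) → length T' ≡ length T → Step T T' 0
    col   : arms T' ≡ suc (arms T) → length T' ≡ suc (length T) → Step T T' (length T)
    inner : ∀ {i} → arms T' ≤ arms T → Step T T' i

  step : ∀ {x T T' i} → 0 < length T → Ins x T T' i → Step T T' i
  step {T = T} {i = zero} 0< p = row (cong₂ _+_ (Ins-row₀-stop p) e) e
    where e = trans (Ins-length p) (m≥n⇒m⊔n≡m 0<)
  step {T = T} {T'} {suc i} _ p with m≤n⇒m<n∨m≡n (Ins-≤ p)
  ... | inj₁ i< = inner (≤-reflexive (cong₂ _+_ (Ins-row₀-bump p) (trans (Ins-length p) (m≥n⇒m⊔n≡m i<))))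
  ... | inj₂ i≡ = subst (Step T T') (sym i≡)
    (col (trans (cong₂ _+_ (Ins-row₀-bump p) e) (+-suc (row₀ T) (length T))) e)
    where e = trans (Ins-length p) (trans (cong (λ z → length T ⊔ suc z) i≡) (m≤n⇒m⊔n≡n (n≤1+n _)))

  Ins-nonempty : ∀ {x T T' i} → Ins x T T' i → 0 < length T'
  Ins-nonempty new        = s≤s z≤n
  Ins-nonempty (stop _)   = s≤s z≤n
  Ins-nonempty (bump _ _) = s≤s z≤n

  Step-≤ : ∀ {T T' i} → Step T T' i → arms T' ≤ suc (arms T)
  Step-≤ (row e _) = ≤-reflexive e
  Step-≤ (col e _) = ≤-reflexive e
  Step-≤ (inner h) = m≤n⇒m≤1+n h

  arms-≤ : ∀ {T u ρ T'} → 0 < length T → Run T u ρ T' → arms T' ≤ length u + arms T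
  arms-≤ _ [] = ≤-refl
  arms-≤ {T} 0< (_∷_ {u = u} p R) = ≤-trans (arms-≤ (Ins-nonempty p) R)
    (≤-trans (+-monoʳ-≤ (length u) (Step-≤ (step 0< p))) (≤-reflexive (+-suc (length u) (arms T))))

  -- No insertion raises `arms` by more than one. Growth by the full length of `u` therefore rules
  -- out every `inner` step.
  arms-hook : ∀ {T u ρ T'} → 0 < length T → Run T u ρ T' → length u + arms T ≤ arms T' →
              ∃ λ bs → ρ ≡ hook-rows (length T) bs
  arms-hook _ [] _ = [] , refl
  arms-hook {T} {T' = T'} 0< (_∷_ {u = u} {ρ = ρ} {T' = T₁} p R) h = go (step 0< p)
    where
    rest : arms T₁ ≡ suc (arms T) → ∃ λ bs → ρ ≡ hook-rows (length T₁) bs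
    rest e = arms-hook (Ins-nonempty p) R
      (≤-trans (≤-reflexive (trans (cong (length u +_) e) (+-suc (length u) (arms T)))) h)
    go : ∀ {i} → Step T T₁ i → ∃ λ bs → i ∷ ρ ≡ hook-rows (length T) bs
    go (row e l) with bs , e' ← rest e = false ∷ bs , cong (0 ∷_) (trans e' (cong (λ n → hook-rows n bs) l))
    go (col e l) with bs , e' ← rest e = true ∷ bs , cong (length T ∷_) (trans e' (cong (λ n → hook-rows n bs) l))
    go (inner k) = ⊥-elim (1+n≰n (≤-trans h (≤-trans (arms-≤ (Ins-nonempty p) R) (+-monoʳ-≤ (length u) k))))

Run-hook : ∀ {w ρ P} → Run [] w ρ P → w ≢ [] → length w + 1 ≤ row₀ P + length P →
           ∃ λ bs → ρ ≡ 0 ∷ hook-rows 1 bs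
Run-hook [] ne _ = ⊥-elim (ne refl)
Run-hook (_∷_ {u = u} new R) _ h with bs , e ← arms-hook (s≤s z≤n) R (≤-trans (≤-reflexive (+-suc (length u) 1)) h) =
  bs , cong (0 ∷_) e

-- Row bumping and descents

RowIns-weak : ∀ {x y r r₁ r₂ b z} → x ≤ y → Sorted r → RowIns x r r₁ b → RowIns y r₁ r₂ (just z) →
              ∃ λ z' → b ≡ just z' × z' ≤ z
RowIns-weak h _ end (here k) = ⊥-elim (<⇒≱ k h)
RowIns-weak h _ end (there _ ())
RowIns-weak h (_ ∷ _) (here _) (here k) = ⊥-elim (<⇒≱ k h)
RowIns-weak h (y≤ ∷ _) (here _) (there _ S) = _ , refl , RowIns-bumped S y≤
RowIns-weak h _ (there k R) (here l) = ⊥-elim (<⇒≱ l (≤-trans k h))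
RowIns-weak h (_ ∷ s) (there _ R) (there _ S) = RowIns-weak h s R S

RowIns-strict : ∀ {x y r r₁ r₂ b b'} → y < x → RowIns x r r₁ b → RowIns y r₁ r₂ b' →
                ∃ λ z → b' ≡ just z × z ≤ x
RowIns-strict h end         (here _)    = _ , refl , ≤-refl
RowIns-strict h end         (there k _) = ⊥-elim (<⇒≱ h k)
RowIns-strict h (here _)    (here _)    = _ , refl , ≤-refl
RowIns-strict h (here _)    (there k _) = ⊥-elim (<⇒≱ h k)
RowIns-strict h (there k _) (here _)    = _ , refl , k
RowIns-strict h (there _ R) (there _ S) = RowIns-strict h R S

-- If the second insertion bumps a letter, so did the first, and the bumped letters are again weakly
-- ordered; this repeats row by row.
Ins-weak : ∀ {x y T T₁ T₂ i j} → x ≤ y → SortedRows T → Ins x T T₁ i → Ins y T₁ T₂ j → j ≤ i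
Ins-weak _ _ _ (stop _) = z≤n
Ins-weak h _ new (bump S _) with _ , () , _ ← RowIns-weak h [] end S
Ins-weak h (s ∷ _) (stop R) (bump S _) with RowIns-weak h s R S
... | _ , () , _
Ins-weak h (s ∷ ss) (bump R I) (bump S J) with RowIns-weak h s R S
... | _ , refl , k = s≤s (Ins-weak k ss I J)

-- The smaller second letter always bumps something at most `x`, while anything bumped by `x`
-- exceeds `x`; so the strict order descends with the rows.
Ins-strict : ∀ {x y T T₁ T₂ i j} → y < x → Ins x T T₁ i → Ins y T₁ T₂ j → i < j
Ins-strict h new (stop S) with RowIns-strict h end S
... | _ , () , _
Ins-strict h (stop R) (stop S) with RowIns-strict h R S
... | _ , () , _
Ins-strict h (bump R _) (stop S) with RowIns-strict h R S
... | _ , () , _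
Ins-strict h new (bump _ _) = s≤s z≤n
Ins-strict h (stop _) (bump _ _) = s≤s z≤n
Ins-strict h (bump R I) (bump S J) with RowIns-strict h R S
... | _ , refl , k = s≤s (Ins-strict (≤-<-trans k (RowIns-< R)) I J)

descents : List ℕ → List Bool
descents []          = []
descents (x ∷ [])    = []
descents (x ∷ y ∷ u) = (y <ᵇ x) ∷ descents (y ∷ u)

<ᵇ-true : ∀ {x y} → x < y → (x <ᵇ y) ≡ true
<ᵇ-true {x} {y} h with x <ᵇ y in e
... | true  = refl
... | false = ⊥-elim (subst Bool.T e (<⇒<ᵇ h))

<ᵇ-false : ∀ {x y} → y ≤ x → (x <ᵇ y) ≡ false
<ᵇ-false {x} {y} h with x <ᵇ y in e
... | false = refl
... | true  = ⊥-elim (<⇒≱ (<ᵇ⇒< x y (subst Bool.T (sym e) tt)) h)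

private
  -- After a descent the new cell is strictly lower than the previous one, hence not in the first
  -- row. Otherwise it is not lower, hence not in a new row.
  descents-hook : ∀ {x T T₁ i u h bs T'} → SortedRows T → Ins x T T₁ i → h ≡ length T₁ →
                  Run T₁ u (hook-rows h bs) T' → bs ≡ descents (x ∷ u)
  descents-hook {bs = []} _ _ _ [] = refl
  descents-hook {bs = false ∷ bs} s p e (q ∷ R) =
    cong₂ _∷_ (sym (<ᵇ-false (≮⇒≥ λ y<x → n≮0 (Ins-strict y<x p q))))
      (descents-hook (Ins-SortedRows p s) q
        (trans e (sym (trans (Ins-length q) (m≥n⇒m⊔n≡m (Ins-nonempty p))))) R)
  descents-hook {T = T} {i = i} {bs = true ∷ bs} s p refl (q ∷ R) =
    cong₂ _∷_ (sym (<ᵇ-true (≰⇒> λ x≤y → <⇒≱ (≤-trans (m≤n⊔m (length T) (suc i)) (≤-reflexive (sym (Ins-length p))))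
        (Ins-weak x≤y s p q))))
      (descents-hook (Ins-SortedRows p s) q
        (sym (trans (Ins-length q) (m≤n⇒m⊔n≡n (n≤1+n _)))) R)

Run-descents : ∀ {w bs P} → Run [] w (0 ∷ hook-rows 1 bs) P → bs ≡ descents w
Run-descents (p@new ∷ R) = descents-hook [] p refl R

<ᵇ-not : ∀ {x y} → x ≢ y → (x <ᵇ y) ≡ not (y <ᵇ x)
<ᵇ-not {x} {y} ne with x <? y
... | yes h = trans (<ᵇ-true h) (cong not (sym (<ᵇ-false (<⇒≤ h))))
... | no  h = trans (<ᵇ-false (≮⇒≥ h)) (cong not (sym (<ᵇ-true (≤∧≢⇒< (≮⇒≥ h) (λ e → ne (sym e))))))

descents-∷ʳ : ∀ u x y → descents (u ∷ʳ x ∷ʳ y) ≡ descents (u ∷ʳ x) ∷ʳ (y <ᵇ x)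
descents-∷ʳ []          x y = refl
descents-∷ʳ (_ ∷ [])    x y = refl
descents-∷ʳ (_ ∷ b ∷ u) x y = cong (_ ∷_) (descents-∷ʳ (b ∷ u) x y)

descents-reverse : ∀ w → Unique w → descents (List.reverse w) ≡ List.reverse (map not (descents w))
descents-reverse []          _ = refl
descents-reverse (x ∷ [])    _ = refl
descents-reverse (x ∷ y ∷ u) ((x≢y ∷ _) ∷ un) =
  trans (cong descents (trans (unfold-reverse x (y ∷ u)) (cong (_∷ʳ x) (unfold-reverse y u))))
    (trans (descents-∷ʳ (List.reverse u) y x)
      (trans (cong₂ _∷ʳ_ (trans (cong descents (sym (unfold-reverse y u))) (descents-reverse (y ∷ u) un)) (<ᵇ-not x≢y))
        (sym (unfold-reverse (not (y <ᵇ x)) (map not (descents (y ∷ u)))))))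

-- For distinct letters this condition on the descents says that a word and its reverse have the
-- same descents.
AntiPalindrome : List Bool → Set
AntiPalindrome bs = List.reverse bs ≡ map not bs

map-not-involutive : ∀ bs → map not (map not bs) ≡ bs
map-not-involutive bs = trans (sym (map-∘ bs)) (trans (map-cong not-involutive bs) (map-id bs))

reverse-not : ∀ {bs} → AntiPalindrome bs → List.reverse (map not bs) ≡ bs
reverse-not {bs} a = trans (cong List.reverse (sym a)) (reverse-involutive bs)

Qlist : List ℕ → Tableau
Qlist w = proj₂ (rsAux 1 w [] [])

Labelled-[] : ∀ {k} → Labelled k []
Labelled-[] = (λ ()) , (λ ())

module _ {w ρ : List ℕ} {P : Tableau} (un : Unique w) (ne : w ≢ []) (R : Run [] w ρ P) where
  private
    r = run [] (List.reverse w)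
    ρ' = proj₁ r
    P' = proj₁ (proj₂ r)
    R' = proj₂ (proj₂ r)
    C = proj₁ (bounded w)
    w< = proj₂ (bounded w)
    ne' : List.reverse w ≢ []
    ne' e = ne (trans (sym (reverse-involutive w)) (cong List.reverse e))

    same-length : length ρ ≡ length ρ'
    same-length = trans (sym (Run-length R)) (trans (sym (length-reverse w)) (Run-length R'))

  Q≡⇒hook : Qlist w ≡ Qlist (List.reverse w) → ∃ λ bs → ρ ≡ 0 ∷ hook-rows 1 bs × AntiPalindrome bs
  Q≡⇒hook e = bs , hook ,
    sym (trans (cong (map not) bs≡) (trans (sym (reverse-involutive _)) (cong List.reverse (sym bs≡'))))
    where
    ρ≡ : ρ ≡ ρ'
    ρ≡ = build-injective ρ ρ' same-length (Run-Valid R) (Run-Valid R') Labelled-[]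
           (trans (sym (rsAux-Run 1 [] R)) (trans e (rsAux-Run 1 [] R')))
    bal : Balanced w
    bal = [] , [] , ρ , P , P' , [] , [] , R , subst (λ σ → Run [] (List.reverse w) σ P') (sym ρ≡) R'
    arms≡ : length w + 1 ≤ row₀ P + length P
    arms≡ = ≤-reflexive (sym (trans (cong (_+ length P) (row₀≡rows un R bal))
              (Balanced-hook (nested _ w ≤-refl) un bal R ne)))
    bs = proj₁ (Run-hook R ne arms≡)
    hook = proj₂ (Run-hook R ne arms≡)
    bs≡ : bs ≡ descents w
    bs≡ = Run-descents (subst (λ σ → Run [] w σ P) hook R)
    bs≡' : bs ≡ List.reverse (map not (descents w))
    bs≡' = trans (Run-descents (subst (λ σ → Run [] (List.reverse w) σ P') (trans (sym ρ≡) hook) R'))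
      (descents-reverse w un)

  -- Reversal exchanges increasing and decreasing chains, so the arms for the reverse are long
  -- enough to force a hook. Its bits are the descents of the reverse, which equal `bs` by `anti`.
  hook⇒Q≡ : ∀ bs → ρ ≡ 0 ∷ hook-rows 1 bs → length w + 1 ≤ row₀ P + length P → AntiPalindrome bs →
            Qlist w ≡ Qlist (List.reverse w)
  hook⇒Q≡ bs hook arms≤ anti =
    trans (rsAux-Run 1 [] R) (trans (cong (λ σ → build 1 σ []) ρ≡) (sym (rsAux-Run 1 [] R')))
    where
    rows≤ : length P ≤ row₀ P'
    rows≤ = increasing-≤ (D⇒I one (D-rows w< R)) R'
    row₀≤ : row₀ P ≤ length P'
    row₀≤ = decreasing-≤ (I⇒D one w< (I-row un R)) R'
    arms≤' : length (List.reverse w) + 1 ≤ row₀ P' + length P'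
    arms≤' = ≤-trans (≤-reflexive (cong (_+ 1) (length-reverse w)))
      (≤-trans arms≤ (≤-trans (≤-reflexive (+-comm (row₀ P) (length P))) (+-mono-≤ rows≤ row₀≤)))
    bs' = proj₁ (Run-hook R' ne' arms≤')
    hook' = proj₂ (Run-hook R' ne' arms≤')
    bs≡ : bs ≡ bs'
    bs≡ = trans (sym (reverse-not anti))
      (trans (cong (λ z → List.reverse (map not z)) (Run-descents (subst (λ σ → Run [] w σ P) hook R)))
        (trans (sym (descents-reverse w un))
          (sym (Run-descents (subst (λ σ → Run [] (List.reverse w) σ P') hook' R')))))
    ρ≡ : ρ ≡ ρ'
    ρ≡ = trans hook (trans (cong (λ z → 0 ∷ hook-rows 1 z) bs≡) (sym hook'))

-- Shape and entries of a hook-shaped recording tableau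

incr : ℕ → List ℕ → List ℕ
incr _       []       = 1 ∷ []
incr zero    (l ∷ ls) = suc l ∷ ls
incr (suc i) (l ∷ ls) = l ∷ incr i ls

shape-addAt : ∀ k i Q → shape (addAt k i Q) ≡ incr i (shape Q)
shape-addAt k zero    []      = refl
shape-addAt k zero    (r ∷ Q) = cong (_∷ shape Q) (trans (length-++ r) (+-comm (length r) 1))
shape-addAt k (suc i) []      = refl
shape-addAt k (suc i) (r ∷ Q) = cong (length r ∷_) (shape-addAt k i Q)

shape-Ins : ∀ {x T T' i} → Ins x T T' i → shape T' ≡ incr i (shape T)
shape-Ins new                = refl
shape-Ins (stop {T = T} R)   = cong (_∷ shape T) (RowIns-length-end R)
shape-Ins (bump R I)         = cong₂ _∷_ (RowIns-length-bump R) (shape-Ins I)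

shape-build : ∀ {T u ρ T'} k Q → Run T u ρ T' → shape Q ≡ shape T → shape (build k ρ Q) ≡ shape T'
shape-build k Q [] e = e
shape-build k Q (_∷_ {i = i} p R) e =
  shape-build (suc k) (addAt k i Q) R (trans (shape-addAt k i Q) (trans (cong (incr i) e) (sym (shape-Ins p))))

shape-Qlist : ∀ {w ρ P} → Run [] w ρ P → shape (Qlist w) ≡ shape P
shape-Qlist R = trans (cong shape (rsAux-Run 1 [] R)) (shape-build 1 [] R refl)

-- With bits numbered from `k`, these are the labels of the true and of the false bits. In a
-- recording tableau the numbering starts at 2, as 1 is the corner.
ones zeros : ℕ → List Bool → List ℕ
ones k []           = []
ones k (true ∷ bs)  = k ∷ ones (suc k) bs
ones k (false ∷ bs) = ones (suc k) bs
zeros k bs = ones k (map not bs)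

addAt-column : ∀ k r c → addAt k (suc (length c)) (r ∷ map [_] c) ≡ r ∷ map [_] (c ++ [ k ])
addAt-column k r c = cong (r ∷_) (go c)
  where
  go : ∀ c → addAt k (length c) (map [_] c) ≡ map [_] (c ++ [ k ])
  go []      = refl
  go (x ∷ c) = cong ([ x ] ∷_) (go c)

build-hook : ∀ k bs r c → build k (hook-rows (suc (length c)) bs) (r ∷ map [_] c) ≡
             (r ++ zeros k bs) ∷ map [_] (c ++ ones k bs)
build-hook k [] r c = cong₂ (λ a b → a ∷ map [_] b) (sym (++-identityʳ r)) (sym (++-identityʳ c))
build-hook k (false ∷ bs) r c = trans (build-hook (suc k) bs (r ++ [ k ]) c)
  (cong (_∷ map [_] (c ++ ones (suc k) bs)) (++-assoc r [ k ] (zeros (suc k) bs)))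
build-hook k (true ∷ bs) r c =
  trans (cong₂ (build (suc k)) (cong (λ h → hook-rows (suc h) bs) (trans (+-comm 1 (length c)) (sym (length-++ c))))
          (addAt-column k r c))
    (trans (build-hook (suc k) bs r (c ++ [ k ]))
      (cong (λ z → (r ++ zeros (suc k) bs) ∷ map [_] z) (++-assoc c [ k ] (ones (suc k) bs))))

Q-hook : ∀ {w bs P} → Run [] w (0 ∷ hook-rows 1 bs) P → Qlist w ≡ (1 ∷ zeros 2 bs) ∷ map [_] (ones 2 bs)
Q-hook {bs = bs} R = trans (rsAux-Run 1 [] R) (build-hook 2 bs (1 ∷ []) [])

trues : List Bool → ℕ
trues []           = 0
trues (true ∷ bs)  = suc (trues bs)
trues (false ∷ bs) = trues bs

length-ones : ∀ k bs → length (ones k bs) ≡ trues bs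
length-ones k []           = refl
length-ones k (true ∷ bs)  = cong suc (length-ones (suc k) bs)
length-ones k (false ∷ bs) = length-ones (suc k) bs

trues-∷ʳ : ∀ bs b → trues (bs ∷ʳ b) ≡ trues (b ∷ bs)
trues-∷ʳ []           b     = refl
trues-∷ʳ (false ∷ bs) false = trues-∷ʳ bs false
trues-∷ʳ (false ∷ bs) true  = trues-∷ʳ bs true
trues-∷ʳ (true ∷ bs)  false = cong suc (trues-∷ʳ bs false)
trues-∷ʳ (true ∷ bs)  true  = cong suc (trues-∷ʳ bs true)

trues-cons : ∀ b {bs bs'} → trues bs ≡ trues bs' → trues (b ∷ bs) ≡ trues (b ∷ bs')
trues-cons false e = e
trues-cons true  e = cong suc e

trues-reverse : ∀ bs → trues (List.reverse bs) ≡ trues bs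
trues-reverse []       = refl
trues-reverse (b ∷ bs) = trans (cong trues (unfold-reverse b bs))
  (trans (trues-∷ʳ (List.reverse bs) b) (trues-cons b (trues-reverse bs)))

trues-not : ∀ bs → trues (map not bs) + trues bs ≡ length bs
trues-not []           = refl
trues-not (true ∷ bs)  = trans (+-suc _ _) (cong suc (trues-not bs))
trues-not (false ∷ bs) = cong suc (trues-not bs)

AntiPalindrome-trues : ∀ {bs} → AntiPalindrome bs → trues (map not bs) ≡ trues bs
AntiPalindrome-trues {bs} a = trans (cong trues (sym a)) (trues-reverse bs)

data Nth (b : Bool) : ℕ → List Bool → Set where
  here  : ∀ {bs} → Nth b 0 (b ∷ bs)
  there : ∀ {j c bs} → Nth b j bs → Nth b (suc j) (c ∷ bs)

Nth-tail : ∀ {j b c bs} → Nth b (suc j) (c ∷ bs) → Nth b j bs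
Nth-tail (there n) = n

Nth-< : ∀ {b j bs} → Nth b j bs → j < length bs
Nth-< here      = s≤s z≤n
Nth-< (there m) = s≤s (Nth-< m)

Nth-++ : ∀ {b j bs} cs → Nth b j bs → Nth b j (bs ++ cs)
Nth-++ cs here      = here
Nth-++ cs (there m) = there (Nth-++ cs m)

Nth-∷ʳ : ∀ bs b → Nth b (length bs) (bs ∷ʳ b)
Nth-∷ʳ []       b = here
Nth-∷ʳ (_ ∷ bs) b = there (Nth-∷ʳ bs b)

Nth-reverse : ∀ {b j bs} → Nth b j bs → Nth b (length bs ∸ suc j) (List.reverse bs)
Nth-reverse {b} {bs = _ ∷ bs} here =
  subst₂ (Nth b) (length-reverse bs) (sym (unfold-reverse b bs)) (Nth-∷ʳ (List.reverse bs) b)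
Nth-reverse {b} {bs = c ∷ bs} (there m) =
  subst (Nth b _) (sym (unfold-reverse c bs)) (Nth-++ (c ∷ []) (Nth-reverse m))

ones⁻ : ∀ {x} k bs → x ∈ ones k bs → ∃ λ j → x ≡ k + j × Nth true j bs
ones⁻ k (true ∷ bs) (here refl) = 0 , sym (+-identityʳ k) , here
ones⁻ k (true ∷ bs) (there m) with j , e , n ← ones⁻ (suc k) bs m = suc j , trans e (sym (+-suc k j)) , there n
ones⁻ k (false ∷ bs) m with j , e , n ← ones⁻ (suc k) bs m = suc j , trans e (sym (+-suc k j)) , there n

ones⁺ : ∀ k {j bs} → Nth true j bs → k + j ∈ ones k bs
ones⁺ k here = here (+-identityʳ k)
ones⁺ k {suc j} {true ∷ bs}  (there n) = there (subst (_∈ ones (suc k) bs) (sym (+-suc k j)) (ones⁺ (suc k) n))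
ones⁺ k {suc j} {false ∷ bs} (there n) = subst (_∈ ones (suc k) bs) (sym (+-suc k j)) (ones⁺ (suc k) n)

-- An inclusion between the positions of true bits is an equality once the counts agree. This
-- supplies the converse implication that condition (ii) does not state.
squeeze : ∀ xs ys → length xs ≡ length ys → (∀ {j} → Nth true j xs → Nth true j ys) →
          trues ys ≤ trues xs → xs ≡ ys
squeeze []           []           _ _ _ = refl
squeeze (true ∷ xs)  (true ∷ ys)  l f (s≤s h) =
  cong (true ∷_) (squeeze xs ys (suc-injective l) (λ n → Nth-tail (f (there n))) h)
squeeze (false ∷ xs) (false ∷ ys) l f h =
  cong (false ∷_) (squeeze xs ys (suc-injective l) (λ n → Nth-tail (f (there n))) h)
squeeze (true ∷ xs)  (false ∷ ys) l f _ with () ← f here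
squeeze (false ∷ xs) (true ∷ ys)  l f h = ⊥-elim (<⇒≱ h (more xs ys (λ n → Nth-tail (f (there n)))))
  where
  more : ∀ xs ys → (∀ {j} → Nth true j xs → Nth true j ys) → trues xs ≤ trues ys
  more []           _            _ = z≤n
  more (true ∷ xs)  (true ∷ ys)  f = s≤s (more xs ys (λ n → Nth-tail (f (there n))))
  more (false ∷ xs) (true ∷ ys)  f = m≤n⇒m≤1+n (more xs ys (λ n → Nth-tail (f (there n))))
  more (false ∷ xs) (false ∷ ys) f = more xs ys (λ n → Nth-tail (f (there n)))
  more (true ∷ xs)  (false ∷ ys) f with () ← f here
  more (true ∷ xs)  []           f with () ← f here
  more (false ∷ xs) []           f = more xs [] (λ n → case (f (there n)))
    where
    case : ∀ {j} → Nth true (suc j) [] → Nth true j []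
    case ()

mirror : ∀ {n j} → j < n → n ∸ suc (n ∸ suc j) ≡ j
mirror {suc n} {j} (s≤s h) = m∸[m∸n]≡n h

firstCol-columns : ∀ x r c → firstCol ((x ∷ r) ∷ map [_] c) ≡ x ∷ c
firstCol-columns x r c = cong (x ∷_) (go c)
  where
  go : ∀ c → concatMap (take 1) (map [_] c) ≡ c
  go []      = refl
  go (y ∷ c) = cong (y ∷_) (go c)

module _ (bs : List Bool) where
  private
    Q : Tableau
    Q = (1 ∷ zeros 2 bs) ∷ map [_] (ones 2 bs)
    N = length bs

  -- The label i = j + 2 belongs to bit j. With n = N + 1, the label n - i + 2 belongs to the
  -- mirrored bit N - 1 - j.
  AntiPalindrome⇒CondII : AntiPalindrome bs → CondII (suc N) Q
  AntiPalindrome⇒CondII a i (s≤s ()) _ (here refl)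
  AntiPalindrome⇒CondII a i 2≤i i≤ (there m) with j , refl , n ← ones⁻ 2 (map not bs) m =
    subst (N ∸ suc j + 2 ∈_) (sym (firstCol-columns 1 (zeros 2 bs) (ones 2 bs)))
      (there (subst (_∈ ones 2 bs) (+-comm 2 (N ∸ suc j)) (ones⁺ 2
        (subst₂ (Nth true) (cong (_∸ suc j) (length-reverse bs)) (reverse-involutive bs)
          (Nth-reverse (subst (Nth true j) (sym a) n))))))

  -- Condition (ii) yields only that a false bit has a true mirror image; the equal counts come from
  -- the symmetry of the shape.
  CondII⇒AntiPalindrome : trues (map not bs) ≡ trues bs → CondII (suc N) Q → AntiPalindrome bs
  CondII⇒AntiPalindrome e cond = sym (squeeze (map not bs) (List.reverse bs)
    (trans (length-map not bs) (sym (length-reverse bs))) sub (≤-reflexive (trans (trues-reverse bs) (sym e))))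
    where
    sub : ∀ {j} → Nth true j (map not bs) → Nth true j (List.reverse bs)
    sub {j} n with subst (N ∸ suc j + 2 ∈_) (firstCol-columns 1 (zeros 2 bs) (ones 2 bs))
                     (cond (2 + j) (s≤s (s≤s z≤n)) (s≤s j<) (there (ones⁺ 2 n)))
      where
      j< : j < N
      j< = ≤-trans (Nth-< n) (≤-reflexive (length-map not bs))
    ... | here e' with () ← trans (+-comm 2 (N ∸ suc j)) e'
    ... | there m with j' , e' , n' ← ones⁻ 2 bs m
      with refl ← +-cancelˡ-≡ 2 (N ∸ suc j) j' (trans (+-comm 2 (N ∸ suc j)) e') =
      subst (λ z → Nth true z (List.reverse bs))
        (mirror (≤-trans (Nth-< n) (≤-reflexive (length-map not bs)))) (Nth-reverse n')

-- Symmetric hook shapes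

private
  conj-first : ∀ a l → length (filter (0 <?_) (suc a ∷ replicate l 1)) ≡ suc l
  conj-first a l = trans (cong length (filter-all (0 <?_) {xs = suc a ∷ replicate l 1}
      (s≤s z≤n ∷ Allₚ.replicate⁺ l (s≤s z≤n))))
    (cong suc (length-replicate l))

  conj-rest : ∀ {a j} l → j < a → length (filter (suc j <?_) (suc a ∷ replicate l 1)) ≡ 1
  conj-rest {a} {j} l h = cong length (trans (filter-accept (suc j <?_) {x = suc a} {xs = replicate l 1} (s≤s h))
    (cong (suc a ∷_) (filter-none (suc j <?_) (Allₚ.replicate⁺ l λ { (s≤s ()) }))))

  map-const : ∀ (f : ℕ → ℕ) g m → (∀ {j} → j < m → f (g j) ≡ 1) → map f (applyUpTo g m) ≡ replicate m 1
  map-const f g zero    _ = refl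
  map-const f g (suc m) h = cong₂ _∷_ (h (s≤s z≤n)) (map-const f (λ j → g (suc j)) m (λ k → h (s≤s k)))

hook-symmetric : ∀ a → Symmetric (suc a ∷ replicate a 1)
hook-symmetric a = cong₂ _∷_ (conj-first a a) (map-const _ suc a (conj-rest a))

symmetric-hook : ∀ a l → Symmetric (suc a ∷ replicate l 1) → l ≡ a
symmetric-hook a l e = suc-injective (trans (sym (conj-first a l)) (∷-injectiveˡ e))

shape-hook : ∀ bs → shape ((1 ∷ zeros 2 bs) ∷ map [_] (ones 2 bs)) ≡ suc (trues (map not bs)) ∷ replicate (trues bs) 1
shape-hook bs = cong₂ (λ a b → suc a ∷ b) (length-ones 2 (map not bs))
  (trans (go (ones 2 bs)) (cong (λ l → replicate l 1) (length-ones 2 bs)))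
  where
  go : ∀ (c : List ℕ) → shape (map [_] c) ≡ replicate (length c) 1
  go []      = refl
  go (_ ∷ c) = cong (1 ∷_) (go c)

Run-bits-length : ∀ {w bs P} → Run [] w (0 ∷ hook-rows 1 bs) P → length w ≡ suc (length bs)
Run-bits-length {bs = bs} R = trans (Run-length R) (cong suc (go 1 bs))
  where
  go : ∀ h bs → length (hook-rows h bs) ≡ length bs
  go h []           = refl
  go h (true ∷ bs)  = cong suc (go (suc h) bs)
  go h (false ∷ bs) = cong suc (go h bs)

private
  shape-arms : ∀ T {k l} → shape T ≡ k ∷ replicate l 1 → row₀ T + length T ≡ k + suc l
  shape-arms (r ∷ T) {l = l} e = cong₂ (λ a b → a + suc b) (∷-injectiveˡ e)
    (trans (sym (length-map length T)) (trans (cong length (∷-injectiveʳ e)) (length-replicate l)))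

hook-arms : ∀ {w bs P} → Run [] w (0 ∷ hook-rows 1 bs) P → length w + 1 ≤ row₀ P + length P
hook-arms {w} {bs} {P} R = ≤-reflexive (sym (trans (shape-arms P (trans (sym (shape-Qlist R))
    (trans (cong shape (Q-hook R)) (shape-hook bs))))
  (trans (cong suc (trans (+-suc _ _) (trans (cong suc (trues-not bs)) (+-comm 1 _))))
    (cong (_+ 1) (sym (Run-bits-length R))))))

-- The middle term between equality of the recording tableaux and the two properties of the shape;
-- it is also the form that is counted.
HookWord : List ℕ → Set
HookWord w = ∃ λ bs → ∃ λ P → Run [] w (0 ∷ hook-rows 1 bs) P × AntiPalindrome bs

private
  hook-rows⇒HookWord : ∀ {w ρ P} → Run [] w ρ P → (∃ λ bs → ρ ≡ 0 ∷ hook-rows 1 bs × AntiPalindrome bs) →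
                        HookWord w
  hook-rows⇒HookWord R (bs , refl , a) = bs , _ , R , a

  HookWord⇒shape : ∀ {w} → HookWord w → SymmetricHook (length w) (shape (Qlist w)) × CondII (length w) (Qlist w)
  HookWord⇒shape {w} (bs , P , R , anti) =
    subst₂ SymmetricHook n≡ (sym (trans (cong shape (Q-hook R)) (trans (shape-hook bs)
        (cong (λ z → suc z ∷ replicate t 1) (AntiPalindrome-trues anti)))))
      ((suc t , s≤s z≤n , s≤s (m≤m+n t t) , cong (λ l → suc t ∷ replicate l 1) (sym (m+n∸n≡m t t))) ,
        hook-symmetric t) ,
    subst₂ CondII (sym (Run-bits-length R)) (sym (Q-hook R)) (AntiPalindrome⇒CondII bs anti)
    where
    t = trues bs
    n≡ : suc (t + t) ≡ length w
    n≡ = sym (trans (Run-bits-length R) (cong suc (sym (trans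
      (cong (_+ t) (sym (AntiPalindrome-trues anti))) (trues-not bs)))))

  shape⇒HookWord : ∀ {w ρ P} → w ≢ [] → Run [] w ρ P →
    SymmetricHook (length w) (shape (Qlist w)) × CondII (length w) (Qlist w) → HookWord w
  shape⇒HookWord {P = P} ne R (((k , _ , k≤ , e) , symm) , cond)
    with bs , refl ← Run-hook R ne (≤-reflexive (sym (trans (shape-arms P (trans (sym (shape-Qlist R)) e))
           (trans (+-suc k _) (trans (cong suc (m+[n∸m]≡n k≤)) (+-comm 1 _)))))) =
    bs , P , R , CondII⇒AntiPalindrome bs
      (sym (symmetric-hook _ _ (subst Symmetric (trans (cong shape (Q-hook R)) (shape-hook bs)) symm)))
      (subst₂ CondII (Run-bits-length R) (Q-hook R) cond)

module _ {w : List ℕ} (un : Unique w) (ne : w ≢ []) where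

  abstract
    Q≡⇔HookWord : Qlist w ≡ Qlist (List.reverse w) ⇔ HookWord w
    Q≡⇔HookWord = mk⇔ (λ e → hook-rows⇒HookWord R (Q≡⇒hook un ne R e))
      λ (bs , P , R , a) → hook⇒Q≡ un ne R bs refl (hook-arms R) a
      where
      R : Run [] w (proj₁ (run [] w)) (proj₁ (proj₂ (run [] w)))
      R = proj₂ (proj₂ (run [] w))

    HookWord⇔shape : HookWord w ⇔ (SymmetricHook (length w) (shape (Qlist w)) × CondII (length w) (Qlist w))
    HookWord⇔shape = mk⇔ HookWord⇒shape (shape⇒HookWord ne (proj₂ (proj₂ (run [] w))))

-- Counting

open import Data.Nat.Combinatorics using (_C_; nCk≡nC[n∸k]; nCn≡1; k>n⇒nCk≡0; nCk+nC[k+1]≡[n+1]C[k+1])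

StrictlySorted : List ℕ → Set
StrictlySorted = AllPairs _<_

-- HookRun bs u r c: inserting the letters of u from the last to the first gives the hook with
-- first row r and remaining first column c, and bs tells, again from the last step to the first,
-- which insertions create a new row.
data HookRun : List Bool → List ℕ → List ℕ → List ℕ → Set where
  start : ∀ {x} → HookRun [] [ x ] [ x ] []
  row   : ∀ {bs u r r' c x} → HookRun bs u r c → RowIns x r r' nothing →
          HookRun (false ∷ bs) (x ∷ u) r' c
  col   : ∀ {bs u r r' c x y} → HookRun bs u r c → RowIns x r r' (just y) → All (y <_) c →
          HookRun (true ∷ bs) (x ∷ u) r' (y ∷ c)

-- These conditions describe exactly the pairs reached by some `HookRun bs`: one direction is
-- `HookRun-Hook`, the other `Hook-HookRun`.
record Hook (bs : List Bool) (r c : List ℕ) : Set where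
  constructor hook
  field
    {corner} : ℕ
    {arm}    : List ℕ
    row≡     : r ≡ corner ∷ arm
    sorted   : Sorted r
    strict   : StrictlySorted (corner ∷ c)
    arm≡     : length arm ≡ trues (map not bs)
    leg≡     : length c ≡ trues bs

HookRun-Hook : ∀ {bs u r c} → HookRun bs u r c → Hook bs r c
HookRun-Hook start = hook refl ([] ∷ []) ([] ∷ []) refl refl
HookRun-Hook (row H R) with hook refl s t a l ← HookRun-Hook H with R
... | there _ R' = hook refl (RowIns-sorted R s) t (trans (RowIns-length-end R') (cong suc a)) l
HookRun-Hook (col H R y<) with hook refl s (h ∷ t) a l ← HookRun-Hook H with R
... | here x<y   = hook refl (RowIns-sorted R s) ((x<y ∷ All.map (<-trans x<y) y<) ∷ y< ∷ t) a (cong suc l)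
... | there k R' = hook refl (RowIns-sorted R s) ((≤-<-trans k (RowIns-< R') ∷ h) ∷ y< ∷ t)
                     (trans (RowIns-length-bump R') a) (cong suc l)

RowIns-↭-end : ∀ {x r r'} → RowIns x r r' nothing → r' ↭ x ∷ r
RowIns-↭-end end         = Perm.refl
RowIns-↭-end (there _ R) = Perm.trans (Perm.prep _ (RowIns-↭-end R)) (Perm.swap _ _ Perm.refl)

RowIns-↭-bump : ∀ {x r r' y} → RowIns x r r' (just y) → y ∷ r' ↭ x ∷ r
RowIns-↭-bump (here _)    = Perm.swap _ _ Perm.refl
RowIns-↭-bump (there _ R) = Perm.trans (Perm.swap _ _ Perm.refl)
  (Perm.trans (Perm.prep _ (RowIns-↭-bump R)) (Perm.swap _ _ Perm.refl))

HookRun-↭ : ∀ {bs u r c} → HookRun bs u r c → r ++ c ↭ u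
HookRun-↭ start = Perm.refl
HookRun-↭ (row {c = c} H R) = Perm.trans (Permₚ.++⁺ʳ c (RowIns-↭-end R)) (Perm.prep _ (HookRun-↭ H))
HookRun-↭ (col {r' = r'} {c} {y = y} H R _) = Perm.trans (shift y r' c)
  (Perm.trans (Permₚ.++⁺ʳ c (RowIns-↭-bump R)) (Perm.prep _ (HookRun-↭ H)))

RowIns-inserted : ∀ {P : ℕ → Set} {x r r' b} → RowIns x r r' b → All P r' → P x
RowIns-inserted end         (p ∷ _)  = p
RowIns-inserted (here _)    (p ∷ _)  = p
RowIns-inserted (there _ R) (_ ∷ ps) = RowIns-inserted R ps

RowIns-before : ∀ {P : ℕ → Set} {x r r' y} → RowIns x r r' (just y) → P y → All P r' → All P r
RowIns-before (here _)    p (_ ∷ qs) = p ∷ qs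
RowIns-before (there _ R) p (q ∷ qs) = q ∷ RowIns-before R p qs

RowIns-injective : ∀ {x x' r r' q y} → Sorted r → Sorted r' →
                   RowIns x r q (just y) → RowIns x' r' q (just y) → x ≡ x' × r ≡ r'
RowIns-injective _ _ (here _) (here _) = refl , refl
RowIns-injective (y≤ ∷ _) _ (here _) (there _ S) = ⊥-elim (<⇒≱ (RowIns-< S) (RowIns-inserted S y≤))
RowIns-injective _ (y≤ ∷ _) (there _ R) (here _) = ⊥-elim (<⇒≱ (RowIns-< R) (RowIns-inserted R y≤))
RowIns-injective (_ ∷ s) (_ ∷ s') (there _ R) (there _ S) with refl , refl ← RowIns-injective s s' R S = refl , refl

HookRun-injective : ∀ {bs u u' r c} → HookRun bs u r c → HookRun bs u' r c → u ≡ u'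
HookRun-injective start start = refl
HookRun-injective (row {r = r} H R) (row {r = r'} H' R')
  with refl , refl ← ∷ʳ-injective r r' (trans (sym (RowIns-end R)) (RowIns-end R')) =
  cong (_ ∷_) (HookRun-injective H H')
HookRun-injective (col H R _) (col H' R' _)
  with refl , refl ← RowIns-injective (Hook.sorted (HookRun-Hook H)) (Hook.sorted (HookRun-Hook H')) R R' =
  cong (_ ∷_) (HookRun-injective H H')

-- Reverse bumping: `y` takes the place of the last letter smaller than it. The final alternative
-- tells what becomes of the corner, which must stay below the remaining column.
unbump : ∀ {a r y} → a < y → Sorted (a ∷ r) →
         ∃ λ x → ∃ λ b → ∃ λ q → RowIns x (b ∷ q) (a ∷ r) (just y) × Sorted (b ∷ q) × (b ≡ a ⊎ b ≡ y)
unbump {a} {[]} a<y s = a , _ , [] , here a<y , [] ∷ [] , inj₂ refl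
unbump {a} {b ∷ r} {y} a<y (a≤ ∷ s@(b≤ ∷ s')) with b <? y
... | no b≮y = a , y , b ∷ r , here a<y ,
               ((≮⇒≥ b≮y ∷ All.map (≤-trans (≮⇒≥ b≮y)) b≤) ∷ s) , inj₂ refl
... | yes b<y with x , d , q , R , sq , _ ← unbump b<y s =
  x , a , d ∷ q , there (RowIns-inserted R a≤) R , RowIns-before R (<⇒≤ a<y) a≤ ∷ sq , inj₁ refl

unappend : ∀ {x} r → Sorted (r ∷ʳ x) → RowIns x r (r ∷ʳ x) nothing × Sorted r
unappend []      _        = end , []
unappend (a ∷ r) (a≤ ∷ s) with R , t ← unappend r s =
  there (proj₂ (Allₚ.∷ʳ⁻ a≤)) R , Allₚ.++⁻ˡ r a≤ ∷ t

private
  corner-< : ∀ {a b y : ℕ} {c} → b ≡ a ⊎ b ≡ y → All (a <_) c → All (y <_) c → All (b <_) c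
  corner-< (inj₁ refl) a<c _ = a<c
  corner-< (inj₂ refl) _ y<c = y<c

Hook-HookRun : ∀ bs {r c} → Hook bs r c → ∃ λ u → HookRun bs u r c
Hook-HookRun [] {c = []} (hook {arm = []} refl _ _ refl refl) = _ , start
Hook-HookRun (false ∷ bs) (hook {a} {arm} refl s t e l) with initLast arm
... | q ∷ʳ′ x with R , s' ← unappend (a ∷ q) s
  with u , H ← Hook-HookRun bs (hook refl s' t
         (suc-injective (trans (trans (+-comm 1 (length q)) (sym (length-++ q))) e)) l) = x ∷ u , row H R
Hook-HookRun (true ∷ bs) {c = y ∷ c} (hook refl s ((a<y ∷ a<c) ∷ y<c ∷ t) e l)
  with unbump a<y s
... | x , b , q , R , s' , h
  with u , H ← Hook-HookRun bs (hook refl s' (corner-< h a<c y<c ∷ t)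
         (trans (suc-injective (sym (RowIns-length-bump R))) e) (suc-injective l)) = x ∷ u , col H R y<c

hook-rows-∷ʳ-false : ∀ h bs → hook-rows h (bs ∷ʳ false) ≡ hook-rows h bs ∷ʳ 0
hook-rows-∷ʳ-false h []           = refl
hook-rows-∷ʳ-false h (false ∷ bs) = cong (0 ∷_) (hook-rows-∷ʳ-false h bs)
hook-rows-∷ʳ-false h (true ∷ bs)  = cong (h ∷_) (hook-rows-∷ʳ-false (suc h) bs)

hook-rows-∷ʳ-true : ∀ h bs → hook-rows h (bs ∷ʳ true) ≡ hook-rows h bs ∷ʳ (h + trues bs)
hook-rows-∷ʳ-true h []           = cong [_] (sym (+-identityʳ h))
hook-rows-∷ʳ-true h (false ∷ bs) = cong (0 ∷_) (hook-rows-∷ʳ-true h bs)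
hook-rows-∷ʳ-true h (true ∷ bs)  = cong (h ∷_) (trans (hook-rows-∷ʳ-true (suc h) bs)
  (cong (hook-rows (suc h) bs ∷ʳ_) (sym (+-suc h (trues bs)))))

Ins-column : ∀ {y c} → StrictlySorted (y ∷ c) → Ins y (map [_] c) (map [_] (y ∷ c)) (length c)
Ins-column {c = []}    _                  = new
Ins-column {c = z ∷ c} ((y<z ∷ _) ∷ t) = bump (here y<z) (Ins-column t)

HookRun-Run : ∀ {bs u r c} → HookRun bs u r c →
              Run [] (List.reverse u) (0 ∷ hook-rows 1 (List.reverse bs)) (r ∷ map [_] c)
HookRun-Run start = new ∷ []
HookRun-Run (row {bs} {u} {r' = r} {c} {x} H R) =
  subst₂ (λ v ρ → Run [] v ρ (r ∷ map [_] c)) (sym (unfold-reverse x u))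
    (cong (0 ∷_) (sym (trans (cong (hook-rows 1) (unfold-reverse false bs))
      (hook-rows-∷ʳ-false 1 (List.reverse bs)))))
    (Run-++ (HookRun-Run H) (stop R ∷ []))
HookRun-Run (col {bs} {u} {r' = r} {c} {x} {y} H R y<) with hook _ _ (_ ∷ t) _ l ← HookRun-Hook H =
  subst₂ (λ v ρ → Run [] v ρ (r ∷ map [_] (y ∷ c))) (sym (unfold-reverse x u))
    (cong (0 ∷_) (sym (trans (cong (hook-rows 1) (unfold-reverse true bs))
      (trans (hook-rows-∷ʳ-true 1 (List.reverse bs))
        (cong (λ n → hook-rows 1 (List.reverse bs) ∷ʳ suc n) (trans (trues-reverse bs) (sym l)))))))
    (Run-++ (HookRun-Run H) (bump R (Ins-column (y< ∷ t)) ∷ []))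

private
  Ins-column⁻ : ∀ {y c T} → StrictlySorted c → Ins y (map [_] c) T (length c) → T ≡ map [_] (y ∷ c) × All (y <_) c
  Ins-column⁻ {c = []}    _ new = refl , []
  Ins-column⁻ {c = z ∷ c} (z< ∷ t) (bump (here y<z) I) with refl , _ ← Ins-column⁻ t I =
    refl , y<z ∷ All.map (<-trans y<z) z<
  Ins-column⁻ {c = z ∷ c} _ (bump (there _ ()) I)

  Run-HookRun-acc : ∀ {bs u r c v P} bs' {h} → HookRun bs u r c → h ≡ length c →
    Run (r ∷ map [_] c) v (hook-rows (suc h) bs') P →
    ∃ λ r' → ∃ λ c' → P ≡ r' ∷ map [_] c' × HookRun (bs' ʳ++ bs) (v ʳ++ u) r' c'
  Run-HookRun-acc [] H _ [] = _ , _ , refl , H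
  Run-HookRun-acc (false ∷ bs') H e (stop R ∷ S) = Run-HookRun-acc bs' (row H R) e S
  Run-HookRun-acc (true ∷ bs') H refl (bump R I ∷ S)
    with hook _ _ (_ ∷ t) _ _ ← HookRun-Hook H
    with refl , y< ← Ins-column⁻ t I = Run-HookRun-acc bs' (col H R y<) refl S

Run-HookRun : ∀ {u bs P} → Run [] u (0 ∷ hook-rows 1 bs) P →
              ∃ λ r → ∃ λ c → P ≡ r ∷ map [_] c × HookRun (List.reverse bs) (List.reverse u) r c
Run-HookRun {bs = bs} (new ∷ R) = Run-HookRun-acc bs start refl R

-- Decoding is a relation, total only on the listed codes; injectivity and functionality are all
-- that transporting the list needs.
image : {X Y : Set} (H : X → Y → Set) → (∀ {x x' y} → H x y → H x' y → x ≡ x') →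
  (∀ {x y y'} → H x y → H x y' → y ≡ y') → ∀ xs → Unique xs → (∀ {x} → x ∈ xs → ∃ (H x)) →
  ∃ λ ys → Unique ys × length ys ≡ length xs × (∀ y → y ∈ ys ⇔ (∃ λ x → x ∈ xs × H x y))
image H inj fun [] _ _ = [] , [] , refl , λ y → mk⇔ (λ ()) (λ { (_ , () , _) })
image H inj fun (x ∷ xs) (x∉ ∷ un) f
  with ys , un' , l , mem ← image H inj fun xs un (λ m → f (there m)) | y , h ← f (here refl) =
  y ∷ ys , All.tabulate fresh ∷ un' , cong suc l , λ z → mk⇔ to from
  where
  fresh : ∀ {z} → z ∈ ys → y ≢ z
  fresh m refl with _ , m' , h' ← Equivalence.to (mem y) m = All.lookup x∉ m' (inj h h')
  to : ∀ {z} → z ∈ y ∷ ys → ∃ λ x' → x' ∈ x ∷ xs × H x' z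
  to (here refl) = x , here refl , h
  to (there m) with x' , m' , h' ← Equivalence.to (mem _) m = x' , there m' , h'
  from : ∀ {z} → (∃ λ x' → x' ∈ x ∷ xs × H x' z) → z ∈ y ∷ ys
  from (_ , here refl , h') = here (fun h' h)
  from (x' , there m , h') = there (Equivalence.from (mem _) (x' , m , h'))

-- Distributing an interval of letters over arm and leg

data Split : ℕ → ℕ → List ℕ → List ℕ → Set where
  nil : ∀ {lo} → Split lo 0 [] []
  inˡ : ∀ {lo l r c} → Split (suc lo) l r c → Split lo (suc l) (lo ∷ r) c
  inʳ : ∀ {lo l r c} → Split (suc lo) l r c → Split lo (suc l) r (lo ∷ c)

Split-length : ∀ {lo l r c} → Split lo l r c → length r + length c ≡ l
Split-length nil     = refl
Split-length (inˡ S) = cong suc (Split-length S)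
Split-length (inʳ S) = trans (+-suc _ _) (cong suc (Split-length S))

Split-≥ : ∀ {lo l r c} → Split lo l r c → All (lo ≤_) (r ++ c)
Split-≥ nil     = []
Split-≥ (inˡ S) = ≤-refl ∷ All.map <⇒≤ (Split-≥ S)
Split-≥ {r = r} {lo ∷ c} (inʳ S) =
  All-resp-↭ (↭-sym (shift lo r c)) (≤-refl ∷ All.map <⇒≤ (Split-≥ S))

Split-< : ∀ {lo l r c} → Split lo l r c → All (_< lo + l) (r ++ c)
Split-< nil = []
Split-< {lo} {suc l} (inˡ S) =
  m<m+n lo (s≤s z≤n) ∷ All.map (λ h → ≤-trans h (≤-reflexive (sym (+-suc lo l)))) (Split-< S)
Split-< {lo} {suc l} {r} {lo ∷ c} (inʳ S) = All-resp-↭ (↭-sym (shift lo r c))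
  (m<m+n lo (s≤s z≤n) ∷ All.map (λ h → ≤-trans h (≤-reflexive (sym (+-suc lo l)))) (Split-< S))

Split-Unique : ∀ {lo l r c} → Split lo l r c → Unique (r ++ c)
Split-Unique nil     = []
Split-Unique (inˡ S) = All.map <⇒≢ (Split-≥ S) ∷ Split-Unique S
Split-Unique {r = r} {lo ∷ c} (inʳ S) =
  Unique-resp-↭ (↭-sym (shift lo r c)) (All.map <⇒≢ (Split-≥ S) ∷ Split-Unique S)

Split-strict : ∀ {lo l r c} → Split lo l r c → StrictlySorted r × StrictlySorted c
Split-strict nil = [] , []
Split-strict {r = _ ∷ r} (inˡ S) with s , t ← Split-strict S = Allₚ.++⁻ˡ r (Split-≥ S) ∷ s , t
Split-strict {r = r} (inʳ S) with s , t ← Split-strict S = s , Allₚ.++⁻ʳ r (Split-≥ S) ∷ t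

private
  min-first : ∀ {lo r} → StrictlySorted r → All (lo ≤_) r →
              (∃ λ r' → r ≡ lo ∷ r' × StrictlySorted r' × All (lo <_) r') ⊎ All (lo <_) r
  min-first [] [] = inj₂ []
  min-first {lo} {x ∷ r} (x< ∷ s) (lo≤x ∷ _) with lo ≟ x
  ... | yes refl = inj₁ (r , refl , s , x<)
  ... | no ne    = inj₂ (lo<x ∷ All.map (<-trans lo<x) x<)
    where lo<x = ≤∧≢⇒< lo≤x ne

Split-complete : ∀ {lo r c} l → StrictlySorted r → StrictlySorted c → Unique (r ++ c) →
  All (lo ≤_) (r ++ c) → All (_< lo + l) (r ++ c) → l ≤ length r + length c → Split lo l r c
Split-complete {lo} {[]}    {[]}    zero _ _ _ _ _ _ = nil
Split-complete {lo} {[]}    {y ∷ c} zero _ _ _ (h ∷ _) (k ∷ _) _ =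
  ⊥-elim (<⇒≱ k (≤-trans (≤-reflexive (+-identityʳ lo)) h))
Split-complete {lo} {x ∷ r} {c}     zero _ _ _ (h ∷ _) (k ∷ _) _ =
  ⊥-elim (<⇒≱ k (≤-trans (≤-reflexive (+-identityʳ lo)) h))
Split-complete {lo} {r} {c} (suc l) s t un ge lt len
  with min-first s (Allₚ.++⁻ˡ r ge) | min-first t (Allₚ.++⁻ʳ r ge)
... | inj₁ (r' , refl , s' , lo<) | _ with n ∷ un' ← un | _ ∷ lt' ← lt =
  inˡ (Split-complete l s' t un' (All.zipWith (λ (a , b) → ≤∧≢⇒< a b) (All.tail ge , n))
    (All.map (λ h → ≤-trans h (≤-reflexive (+-suc lo l))) lt') (s≤s⁻¹ len))
... | inj₂ lo<r | inj₁ (c' , refl , t' , lo<c) with _ ∷ un' ← Unique-resp-↭ (shift lo r c') un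
                                                | _ ∷ lt' ← All-resp-↭ (shift lo r c') lt =
  inʳ (Split-complete l s t' un' (Allₚ.++⁺ lo<r lo<c)
    (All.map (λ h → ≤-trans h (≤-reflexive (+-suc lo l))) lt') (s≤s⁻¹ (≤-trans len (≤-reflexive (+-suc _ _)))))
-- If `lo` occurred in neither list, the letters would split the interval of length `l` above it and
-- be too few.
... | inj₂ lo<r | inj₂ lo<c = ⊥-elim (1+n≰n (≤-trans len (≤-reflexive (Split-length
  (Split-complete l s t un (Allₚ.++⁺ lo<r lo<c) (All.map (λ h → ≤-trans h (≤-reflexive (+-suc lo l))) lt)
    (≤-trans (n≤1+n l) len))))))

consˡ consʳ : ℕ → List ℕ × List ℕ → List ℕ × List ℕ
consˡ x (r , c) = x ∷ r , c
consʳ x (r , c) = r , x ∷ c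

splits : ℕ → ℕ → ℕ → List (List ℕ × List ℕ)
splits lo zero    zero    = ([] , []) ∷ []
splits lo zero    (suc m) = []
splits lo (suc l) zero    = map (consˡ lo) (splits (suc lo) l zero)
splits lo (suc l) (suc m) = map (consˡ lo) (splits (suc lo) l (suc m)) ++ map (consʳ lo) (splits (suc lo) l m)

nC0≡1 : ∀ n → n C 0 ≡ 1
nC0≡1 n = trans (nCk≡nC[n∸k] {0} {n} z≤n) (nCn≡1 n)

length-splits : ∀ lo l m → length (splits lo l m) ≡ l C m
length-splits lo zero    zero    = refl
length-splits lo zero    (suc m) = sym (k>n⇒nCk≡0 {0} {suc m} (s≤s z≤n))
length-splits lo (suc l) zero    =
  trans (length-map (consˡ lo) (splits (suc lo) l zero))
    (trans (length-splits (suc lo) l zero) (trans (nC0≡1 l) (sym (nC0≡1 (suc l)))))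
length-splits lo (suc l) (suc m) =
  trans (length-++ (map (consˡ lo) (splits (suc lo) l (suc m))))
    (trans (cong₂ _+_ (trans (length-map (consˡ lo) (splits (suc lo) l (suc m))) (length-splits (suc lo) l (suc m)))
                      (trans (length-map (consʳ lo) (splits (suc lo) l m)) (length-splits (suc lo) l m)))
      (trans (+-comm (l C suc m) (l C m)) (nCk+nC[k+1]≡[n+1]C[k+1] l m)))

∈-splits⁻ : ∀ {lo r c} l m → (r , c) ∈ splits lo l m → Split lo l r c × length c ≡ m
∈-splits⁻ zero zero (here refl) = nil , refl
∈-splits⁻ {lo} (suc l) zero m∈ with _ , m∈' , refl ← ∈-map⁻ (consˡ lo) m∈
  with S , e ← ∈-splits⁻ l zero m∈' = inˡ S , e
∈-splits⁻ {lo} (suc l) (suc m) m∈ with ∈-++⁻ (map (consˡ lo) (splits (suc lo) l (suc m))) m∈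
... | inj₁ m₁ with _ , m∈' , refl ← ∈-map⁻ (consˡ lo) m₁
  with S , e ← ∈-splits⁻ l (suc m) m∈' = inˡ S , e
... | inj₂ m₂ with _ , m∈' , refl ← ∈-map⁻ (consʳ lo) m₂
  with S , e ← ∈-splits⁻ l m m∈' = inʳ S , cong suc e

∈-splits⁺ : ∀ {lo l r c} → Split lo l r c → (r , c) ∈ splits lo l (length c)
∈-splits⁺ nil = here refl
∈-splits⁺ {lo} {c = []}    (inˡ S) = ∈-map⁺ (consˡ lo) (∈-splits⁺ S)
∈-splits⁺ {lo} {c = _ ∷ _} (inˡ S) = ∈-++⁺ˡ (∈-map⁺ (consˡ lo) (∈-splits⁺ S))
∈-splits⁺ {lo} {suc l} {c = _ ∷ c} (inʳ S) =
  ∈-++⁺ʳ (map (consˡ lo) (splits (suc lo) l (suc (length c)))) (∈-map⁺ (consʳ lo) (∈-splits⁺ S))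

splits-Unique : ∀ lo l m → Unique (splits lo l m)
splits-Unique lo zero    zero    = [] ∷ []
splits-Unique lo zero    (suc m) = []
splits-Unique lo (suc l) zero    = Uniqueₚ.map⁺ (λ { refl → refl }) (splits-Unique (suc lo) l zero)
splits-Unique lo (suc l) (suc m) = Uniqueₚ.++⁺
  (Uniqueₚ.map⁺ (λ { refl → refl }) (splits-Unique (suc lo) l (suc m)))
  (Uniqueₚ.map⁺ (λ { refl → refl }) (splits-Unique (suc lo) l m)) disjoint
  where
  disjoint : ∀ {p} → ¬ (p ∈ map (consˡ lo) (splits (suc lo) l (suc m)) × p ∈ map (consʳ lo) (splits (suc lo) l m))
  disjoint (m₁ , m₂) with _ , _ , refl ← ∈-map⁻ (consˡ lo) m₁ with _ , m' , refl ← ∈-map⁻ (consʳ lo) m₂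
    with h ∷ _ ← Split-≥ (proj₁ (∈-splits⁻ l m m')) = <-irrefl refl h

-- Enumeration of anti-palindromes

bools : ℕ → List (List Bool)
bools zero    = [] ∷ []
bools (suc m) = map (true ∷_) (bools m) ++ map (false ∷_) (bools m)

length-bools : ∀ m → length (bools m) ≡ 2 ^ m
length-bools zero    = refl
length-bools (suc m) = trans (length-++ (map (true ∷_) (bools m))) (cong₂ _+_
  (trans (length-map _ (bools m)) (length-bools m))
  (trans (trans (length-map _ (bools m)) (length-bools m)) (sym (+-identityʳ (2 ^ m)))))

bools-Unique : ∀ m → Unique (bools m)
bools-Unique zero    = [] ∷ []
bools-Unique (suc m) = Uniqueₚ.++⁺
  (Uniqueₚ.map⁺ ∷-injectiveʳ (bools-Unique m)) (Uniqueₚ.map⁺ ∷-injectiveʳ (bools-Unique m))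
  λ (m₁ , m₂) → disjoint m₁ m₂
  where
  disjoint : ∀ {p} → p ∈ map (true ∷_) (bools m) → ¬ (p ∈ map (false ∷_) (bools m))
  disjoint m₁ m₂ with _ , _ , refl ← ∈-map⁻ (true ∷_) m₁ with _ , _ , () ← ∈-map⁻ (false ∷_) m₂

∈-bools⁺ : ∀ bs → bs ∈ bools (length bs)
∈-bools⁺ []           = here refl
∈-bools⁺ (true ∷ bs)  = ∈-++⁺ˡ (∈-map⁺ (true ∷_) (∈-bools⁺ bs))
∈-bools⁺ (false ∷ bs) = ∈-++⁺ʳ (map (true ∷_) (bools (length bs))) (∈-map⁺ (false ∷_) (∈-bools⁺ bs))

∈-bools⁻ : ∀ m {bs} → bs ∈ bools m → length bs ≡ m
∈-bools⁻ zero (here refl) = refl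
∈-bools⁻ (suc m) m∈ with ∈-++⁻ (map (true ∷_) (bools m)) m∈
... | inj₁ m₁ with _ , m' , refl ← ∈-map⁻ (true ∷_) m₁ = cong suc (∈-bools⁻ m m')
... | inj₂ m₂ with _ , m' , refl ← ∈-map⁻ (false ∷_) m₂ = cong suc (∈-bools⁻ m m')

-- The second half of an anti-palindrome of even length is the reversed complement of the first,
-- which is arbitrary.
unfold-anti : List Bool → List Bool
unfold-anti ys = ys ++ List.reverse (map not ys)

antis : ℕ → List (List Bool)
antis m = map unfold-anti (bools m)

unfold-anti-AntiPalindrome : ∀ ys → AntiPalindrome (unfold-anti ys)
unfold-anti-AntiPalindrome ys = trans (reverse-++ ys (List.reverse (map not ys)))
  (trans (cong₂ _++_ (reverse-involutive (map not ys))
      (sym (trans (reverse-map not (map not ys)) (cong List.reverse (map-not-involutive ys)))))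
    (sym (map-++ not ys (List.reverse (map not ys)))))

++-injective : {A : Set} (xs ys : List A) {us vs : List A} → length xs ≡ length ys →
                xs ++ us ≡ ys ++ vs → xs ≡ ys × us ≡ vs
++-injective []       []       _ e = refl , e
++-injective (x ∷ xs) (y ∷ ys) l e with refl ← ∷-injectiveˡ e
  with refl , e' ← ++-injective xs ys (suc-injective l) (∷-injectiveʳ e) = refl , e'

halve : {A : Set} (m : ℕ) (xs : List A) → length xs ≡ m + m →
        ∃ λ ys → ∃ λ zs → xs ≡ ys ++ zs × length ys ≡ m × length zs ≡ m
halve m xs e = take m xs , drop m xs , sym (take++drop≡id m xs) ,
  trans (length-take m xs) (trans (cong (m ⊓_) e) (m≤n⇒m⊓n≡m (m≤m+n m m))) ,
  trans (length-drop m xs) (trans (cong (_∸ m) e) (m+n∸n≡m m m))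

∈-antis⁻ : ∀ m {bs} → bs ∈ antis m → AntiPalindrome bs × length bs ≡ m + m
∈-antis⁻ m m∈ with ys , m' , refl ← ∈-map⁻ unfold-anti m∈ = unfold-anti-AntiPalindrome ys ,
  trans (length-++ ys) (cong₂ _+_ (∈-bools⁻ m m')
    (trans (length-reverse (map not ys)) (trans (length-map not ys) (∈-bools⁻ m m'))))

∈-antis⁺ : ∀ m {bs} → AntiPalindrome bs → length bs ≡ m + m → bs ∈ antis m
∈-antis⁺ m {bs} a l with ys , zs , refl , ly , lz ← halve m bs l =
  subst (_∈ antis m) (cong (ys ++_) (trans (cong List.reverse (sym e)) (reverse-involutive zs)))
    (∈-map⁺ unfold-anti (subst (λ k → ys ∈ bools k) ly (∈-bools⁺ ys)))
  where
  e : List.reverse zs ≡ map not ys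
  e = proj₁ (++-injective (List.reverse zs) (map not ys)
        (trans (length-reverse zs) (trans lz (trans (sym ly) (sym (length-map not ys)))))
        (trans (sym (reverse-++ ys zs)) (trans a (map-++ not ys zs))))

+-double-injective : ∀ m n → m + m ≡ n + n → m ≡ n
+-double-injective zero    zero    _ = refl
+-double-injective (suc m) (suc n) e = cong suc (+-double-injective m n
  (suc-injective (trans (sym (+-suc m m)) (trans (suc-injective e) (+-suc n n)))))

antis-Unique : ∀ m → Unique (antis m)
antis-Unique m = Uniqueₚ.map⁺ (λ {xs} {ys} e → proj₁ (++-injective xs ys
  (+-double-injective (length xs) (length ys)
    (trans (sym (len xs)) (trans (cong length e) (len ys)))) e)) (bools-Unique m)
  where
  len : ∀ ys → length (unfold-anti ys) ≡ length ys + length ys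
  len ys = trans (length-++ ys) (cong (length ys +_) (trans (length-reverse (map not ys)) (length-map not ys)))

length-antis : ∀ m → length (antis m) ≡ 2 ^ m
length-antis m = trans (length-map unfold-anti (bools m)) (length-bools m)

length-cartesianProduct : {A B : Set} (xs : List A) (ys : List B) →
                          length (cartesianProduct xs ys) ≡ length xs * length ys
length-cartesianProduct []       ys = refl
length-cartesianProduct (x ∷ xs) ys = trans (length-++ (map (x ,_) ys))
  (cong₂ _+_ (length-map (x ,_) ys) (length-cartesianProduct xs ys))

-- Permutations as words, and both characterisations for them

word : ∀ {k n} → Vec (Fin n) k → List ℕ
word w = map toℕ (toList w)

length-word : ∀ {k n} (w : Vec (Fin n) k) → length (word w) ≡ k
length-word []      = refl
length-word (_ ∷ w) = cong suc (length-word w)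

word-< : ∀ {k n} (w : Vec (Fin n) k) → All (_< n) (word w)
word-< []      = []
word-< (x ∷ w) = toℕ<n x ∷ word-< w

word-injective : ∀ {k n} (v w : Vec (Fin n) k) → word v ≡ word w → v ≡ w
word-injective []      []      _ = refl
word-injective (x ∷ v) (y ∷ w) e =
  cong₂ _∷_ (toℕ-injective (∷-injectiveˡ e)) (word-injective v w (∷-injectiveʳ e))

word-reverse : ∀ {n} (w : Vec (Fin n) n) → word (reverse w) ≡ List.reverse (word w)
word-reverse w = trans (cong (map toℕ) (toList-reverse w)) (reverse-map toℕ (toList w))

unword : ∀ {k n} u → All (_< n) u → length u ≡ k → ∃ λ (w : Vec (Fin n) k) → word w ≡ u
unword []      []       refl = [] , refl
unword (x ∷ u) (h ∷ hs) refl with w , e ← unword u hs refl = fromℕ< h ∷ w , cong₂ _∷_ (toℕ-fromℕ< h) e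

word-lookup : ∀ {k n} (w : Vec (Fin n) k) → word w ≡ tabulate (λ i → toℕ (lookup w i))
word-lookup []      = refl
word-lookup (x ∷ w) = cong (toℕ x ∷_) (word-lookup w)

IsPerm⇒Unique : ∀ {n} (w : Vec (Fin n) n) → IsPerm w → Unique (word w)
IsPerm⇒Unique w p = subst Unique (sym (word-lookup w)) (Uniqueₚ.tabulate⁺ λ e → p _ _ (toℕ-injective e))

Unique⇒injective : ∀ {k n} (w : Vec (Fin n) k) → Unique (word w) → ∀ i j → lookup w i ≡ lookup w j → i ≡ j
Unique⇒injective (x ∷ w) (h ∷ un) zero    zero    _ = refl
Unique⇒injective (x ∷ w) (h ∷ un) zero    (suc j) e = ⊥-elim (absent w h j e)
  where
  absent : ∀ {k n} (w : Vec (Fin n) k) {x} → All (toℕ x ≢_) (word w) → ∀ j → x ≢ lookup w j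
  absent (y ∷ w) (p ∷ _)  zero    refl = p refl
  absent (y ∷ w) (_ ∷ ps) (suc j) e    = absent w ps j e
Unique⇒injective (x ∷ w) (h ∷ un) (suc i) zero    e = sym (Unique⇒injective (x ∷ w) (h ∷ un) zero (suc i) (sym e))
Unique⇒injective (x ∷ w) (h ∷ un) (suc i) (suc j) e = cong suc (Unique⇒injective w un i j e)

module _ {n : ℕ} (1≤n : 1 ≤ n) (w : Vec (Fin n) n) (p : IsPerm w) where
  private
    nonempty : word w ≢ []
    nonempty e = <⇒≱ 1≤n (≤-reflexive (trans (sym (length-word w)) (cong length e)))

    reversed : Qtab w ≡ Qtab (reverse w) ⇔ Qlist (word w) ≡ Qlist (List.reverse (word w))
    reversed = mk⇔ (λ e → trans e (cong Qlist (word-reverse w))) (λ e → trans e (cong Qlist (sym (word-reverse w))))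

  Qtab≡⇔HookWord : Qtab w ≡ Qtab (reverse w) ⇔ HookWord (word w)
  Qtab≡⇔HookWord = Q≡⇔HookWord (IsPerm⇒Unique w p) nonempty ⇔-∘ reversed

  Qtab≡⇔shape : Qtab w ≡ Qtab (reverse w) ⇔ (SymmetricHook n (shape (Qtab w)) × CondII n (Qtab w))
  Qtab≡⇔shape = subst (λ k → Qtab w ≡ Qtab (reverse w) ⇔ (SymmetricHook k (shape (Qtab w)) × CondII k (Qtab w)))
    (length-word w) (HookWord⇔shape (IsPerm⇒Unique w p) nonempty ⇔-∘ Qtab≡⇔HookWord)

HookWord-odd : ∀ {w} → HookWord w → ∃ λ t → length w ≡ suc (t + t)
HookWord-odd (bs , _ , R , anti) = trues bs , trans (Run-bits-length R)
  (cong suc (sym (trans (cong (_+ trues bs) (sym (AntiPalindrome-trues anti))) (trues-not bs))))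

strictly : ∀ {r c} → Unique (r ++ c) → Sorted r → StrictlySorted r
strictly _ [] = []
strictly {_ ∷ r} (h ∷ un) (k ∷ s) =
  All.zipWith (λ (a , b) → ≤∧≢⇒< a b) (k , Allₚ.++⁻ˡ r h) ∷ strictly un s

-- The corner is the least letter of its row and of its column, so it is 0; the other letters fill
-- the interval from 1 to `l`.
Hook-Split : ∀ {l bs r c} → Hook bs r c → Unique (r ++ c) → All (_< suc l) (r ++ c) → length (r ++ c) ≡ suc l →
             ∃ λ r' → r ≡ 0 ∷ r' × Split 1 l r' c
Hook-Split {l} {c = c} (hook {b} {r'} refl s (b< ∷ t) _ _) un lt len = r' , corner
  (Split-complete (suc l) (strictly un s) t un (All.universal (λ _ → z≤n) _) lt
    (≤-reflexive (trans (sym len) (length-++ (b ∷ r'))))) b<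
  where
  corner : ∀ {b r c} → Split 0 (suc l) (b ∷ r) c → All (b <_) c → b ∷ r ≡ 0 ∷ r × Split 1 l r c
  corner (inˡ S) _ = refl , S
  corner (inʳ S) (() ∷ _)

-- The cardinality for odd n

module _ {n : ℕ} (m : ℕ) (n≡ : n ≡ suc (m + m)) where

  private
    1≤n : 1 ≤ n
    1≤n = ≤-trans (s≤s z≤n) (≤-reflexive (sym n≡))

    Code : Set
    Code = List Bool × List ℕ × List ℕ

    -- A code is a recording tableau, given by its reversed bits, together with an insertion
    -- tableau, given by its first row and the rest of its first column.
    codes : List Code
    codes = cartesianProduct (antis m) (map (consˡ 0) (splits 1 (m + m) m))

    codes-Unique : Unique codes
    codes-Unique = Uniqueₚ.cartesianProduct⁺ (antis-Unique m)
      (Uniqueₚ.map⁺ (λ { refl → refl }) (splits-Unique 1 (m + m) m))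

    length-codes : length codes ≡ 2 ^ m * ((m + m) C m)
    length-codes = trans (length-cartesianProduct (antis m) (map (consˡ 0) (splits 1 (m + m) m)))
      (cong₂ _*_ (length-antis m)
        (trans (length-map (consˡ 0) (splits 1 (m + m) m)) (length-splits 1 (m + m) m)))

    -- The word is reversed because `HookRun` lists letters, like bits, from the last insertion to
    -- the first.
    Encodes : Code → Vec (Fin n) n → Set
    Encodes (bs , r , c) w = HookRun bs (List.reverse (word w)) r c

    Encodes-run : ∀ {bs r c w} → Encodes (bs , r , c) w →
                  Run [] (word w) (0 ∷ hook-rows 1 (List.reverse bs)) (r ∷ map [_] c)
    Encodes-run {bs} {r} {c} {w} H =
      subst (λ v → Run [] v (0 ∷ hook-rows 1 (List.reverse bs)) (r ∷ map [_] c)) (reverse-involutive (word w))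
        (HookRun-Run H)

    Encodes-injective : ∀ {x x' w} → Encodes x w → Encodes x' w → x ≡ x'
    Encodes-injective {bs , r , c} {bs' , r' , c'} {w} H H'
      with R ← Encodes-run {bs} {r} {c} {w} H | R' ← Encodes-run {bs'} {r'} {c'} {w} H' =
      cong₂ _,_ (reverse-injective (trans (Run-descents R) (sym (Run-descents R'))))
        (cong₂ _,_ (∷-injectiveˡ P≡) (map-injective (∷-injectiveˡ) (∷-injectiveʳ P≡)))
      where P≡ = proj₂ (Run-functional (Encodes-run {bs} {r} {c} {w} H) (Encodes-run {bs'} {r'} {c'} {w} H'))

    Encodes-functional : ∀ {x} w w' → Encodes x w → Encodes x w' → w ≡ w'
    Encodes-functional w w' H H' = word-injective w w' (reverse-injective (HookRun-injective H H'))

    code⁻ : ∀ {bs r c} → (bs , r , c) ∈ codes → ∃ λ r' → r ≡ 0 ∷ r' ×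
            AntiPalindrome bs × length bs ≡ m + m × Split 1 (m + m) r' c × length c ≡ m
    code⁻ x∈ with b∈ , p∈ ← ∈-cartesianProduct⁻ (antis m) _ x∈
      with _ , s∈ , refl ← ∈-map⁻ (consˡ 0) p∈
      with a , l ← ∈-antis⁻ m b∈ | S , e ← ∈-splits⁻ (m + m) m s∈ = _ , refl , a , l , S , e

    half-trues : ∀ {bs} → AntiPalindrome bs → length bs ≡ m + m → trues bs ≡ m
    half-trues {bs} a l = +-double-injective (trues bs) m
      (trans (cong (_+ trues bs) (sym (AntiPalindrome-trues a))) (trans (trues-not bs) l))

    decode : ∀ {x} → x ∈ codes → ∃ (Encodes x)
    decode {bs , r , c} x∈ with r' , refl , a , l , S , e ← code⁻ x∈
      with u , H ← Hook-HookRun bs (hook refl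
             (All.universal (λ _ → z≤n) r' ∷ AllPairs.map <⇒≤ (proj₁ (Split-strict S)))
             (Allₚ.++⁻ʳ r' (Split-≥ S) ∷ proj₂ (Split-strict S))
             (trans (+-cancelʳ-≡ m _ _ (trans (cong (length r' +_) (sym e)) (Split-length S)))
               (trans (sym (half-trues a l)) (sym (AntiPalindrome-trues a))))
             (trans e (sym (half-trues a l))))
      with w , e' ← unword {n} {n} (List.reverse u)
             (All-resp-↭ (Perm.trans (HookRun-↭ H) (↭-sym (↭-reverse u)))
               (≤-trans (s≤s z≤n) (≤-reflexive (sym n≡)) ∷
                All.map (λ h → ≤-trans h (≤-reflexive (sym n≡))) (Split-< S)))
             (trans (length-reverse u) (trans (sym (↭-length (HookRun-↭ H)))
               (trans (cong suc (trans (length-++ r') (Split-length S))) (sym n≡)))) =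
      w , subst (λ v → HookRun bs v r c) (sym (trans (cong List.reverse e') (reverse-involutive u))) H

    decoded : ∀ {x} w → x ∈ codes → Encodes x w → IsPerm w × Qtab w ≡ Qtab (reverse w)
    decoded {bs , r , c} w x∈ H with r' , refl , a , l , S , e ← code⁻ x∈ = perm ,
      Equivalence.from (Qtab≡⇔HookWord 1≤n w perm) (List.reverse bs , _ , Encodes-run {bs} {r} {c} {w} H ,
        trans (reverse-involutive bs) (sym (trans (cong (map not) a) (map-not-involutive bs))))
      where
      perm : IsPerm w
      perm = Unique⇒injective w (Unique-resp-↭ (Perm.trans (HookRun-↭ H) (↭-reverse (word w)))
        (All.map <⇒≢ (Split-≥ S) ∷ Split-Unique S))

    letters : ∀ {bs r c} {w : Vec (Fin n) n} → HookRun bs (List.reverse (word w)) r c → r ++ c ↭ word w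
    letters {w = w} H = Perm.trans (HookRun-↭ H) (↭-reverse (word w))

    encode : ∀ w → IsPerm w → HookWord (word w) → ∃ λ x → x ∈ codes × Encodes x w
    encode w p (bs , P , R , a) with r , c , _ , H ← Run-HookRun R
      with r' , refl , S ← Hook-Split {m + m} (HookRun-Hook H)
             (Unique-resp-↭ (↭-sym (letters {w = w} H)) (IsPerm⇒Unique w p))
             (All.map (λ h → ≤-trans h (≤-reflexive n≡)) (All-resp-↭ (↭-sym (letters {w = w} H)) (word-< w)))
             (trans (↭-length (letters {w = w} H)) (trans (length-word w) n≡)) =
      (List.reverse bs , 0 ∷ r' , c) , ∈-cartesianProduct⁺
        (∈-antis⁺ m anti bits)
        (∈-map⁺ (consˡ 0) (subst (λ k → (r' , c) ∈ splits 1 (m + m) k)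
          (trans (Hook.leg≡ (HookRun-Hook H)) (half-trues anti bits)) (∈-splits⁺ S))) , H
      where
      bits : length (List.reverse bs) ≡ m + m
      bits = trans (length-reverse bs) (suc-injective (trans (sym (Run-bits-length R)) (trans (length-word w) n≡)))
      anti : AntiPalindrome (List.reverse bs)
      anti = trans (reverse-involutive bs) (sym (trans (cong (map not) a) (map-not-involutive bs)))

  card-odd : HasCard n (λ w → Qtab w ≡ Qtab (reverse w)) (2 ^ m * ((m + m) C m))
  card-odd with ws , un , l , mem ← image Encodes (λ {_} {_} {w} → Encodes-injective {w = w})
                                      (λ {_} {w} {w'} → Encodes-functional w w') codes codes-Unique decode =
    ws , un , (λ w → mk⇔
      (λ w∈ → let (_ , x∈ , H) = Equivalence.to (mem w) w∈ in decoded w x∈ H)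
      (λ (p , q) → Equivalence.from (mem w) (encode w p (Equivalence.to (Qtab≡⇔HookWord 1≤n w p) q)))) ,
    trans l length-codes

odd≢even : ∀ m t → m + m ≢ suc (t + t)
odd≢even zero    t ()
odd≢even (suc m) zero    e with () ← trans (sym (+-suc m m)) (suc-injective e)
odd≢even (suc m) (suc t) e = odd≢even m t (suc-injective (trans (sym (+-suc m m))
  (trans (suc-injective e) (cong suc (+-suc t t)))))

theorem1p2 : (n : ℕ) → 1 ≤ n →
    ((w : Vec (Fin n) n) → IsPerm w →
    (Qtab w ≡ Qtab (reverse w) ⇔ (SymmetricHook n (shape (Qtab w)) × CondII n (Qtab w))))
    × ((m : ℕ) → n ≡ 2 * m + 1 →
    HasCard n (λ w → Qtab w ≡ Qtab (reverse w)) (2 ^ m * ((2 * m) C m)))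
    × ((m : ℕ) → n ≡ 2 * m →
    HasCard n (λ w → Qtab w ≡ Qtab (reverse w)) 0)
theorem1p2 n 1≤n = (λ w p → Qtab≡⇔shape 1≤n w p) , odd , even
  where
  double : ∀ m → 2 * m ≡ m + m
  double m = cong (m +_) (+-identityʳ m)
  odd : (m : ℕ) → n ≡ 2 * m + 1 → HasCard n (λ w → Qtab w ≡ Qtab (reverse w)) (2 ^ m * ((2 * m) C m))
  odd m e = subst (λ k → HasCard n (λ w → Qtab w ≡ Qtab (reverse w)) (2 ^ m * (k C m))) (sym (double m))
    (card-odd m (trans e (trans (+-comm (2 * m) 1) (cong suc (double m)))))
  even : (m : ℕ) → n ≡ 2 * m → HasCard n (λ w → Qtab w ≡ Qtab (reverse w)) 0
  even m e = [] , [] , (λ w → mk⇔ (λ ()) λ (p , q) →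
    ⊥-elim (impossible w (HookWord-odd (Equivalence.to (Qtab≡⇔HookWord 1≤n w p) q)))) , refl
    where
    impossible : ∀ (w : Vec (Fin n) n) → ¬ (∃ λ t → length (word w) ≡ suc (t + t))
    impossible w (t , e') = odd≢even m t (trans (sym (trans e (double m))) (trans (sym (length-word w)) e'))
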